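{- The following problem is $\mathrm{W}[1]$-hard when parameterized by $h$: given a temporal graph $(G,\lambda)$, distinct vertices $s,z\in V(G)$, and an integer $h$, decide whether there is a snapshot $s,z$-cut in $(G,\lambda)$ of size at most $h$.
   Context: A graph is a finite undirected loopless multigraph. A temporal graph is a pair $(G,\lambda)$ with $G$ a graph and $\lambda:E(G)\to\mathbb{N}\setminus\{0\}$; an edge $e$ is active at timestep $\lambda(e)$. It is assumed that edges with the same endpoints have distinct values of $\lambda$. The lifetime is $\tau=\max_{e\in E(G)}\lambda(e)$, and $[\tau]=\{1,\dots,\tau\}$. A temporal $s,z$-walk is a sequence $(s=x_0,e_1,x_1,\dots,e_q,x_q=z)$ where $e_i$ has endpoints $x_{i-1}x_i$ and $\lambda(e_1)\le\dots\le\lambda(e_q)$; it is a temporal $s,z$-path if its vertices are pairwise distinct. A set $S\subseteq[\tau]$ is a snapshot $s,z$-cut if every temporal $s,z$-path uses an edge active at some timestep in $S$. $\mathrm{W}[1]$-hardness is with respect to standard parameterized reductions. -}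

module Defs where

open import Data.Bool.Base using (Bool; true; false; _∧_; not; if_then_else_)
open import Data.Bool.ListAction using (and; or)
open import Data.Fin.Base using (Fin; toℕ)
open import Data.Fin.Subset using (Subset; ∣_∣; _∈_)
open import Data.List.Base using (List; []; _∷_; length; map; foldr)
open import Data.List.Extrema.Nat using (max)
open import Data.List.Relation.Unary.Any using (Any)
open import Data.List.Relation.Unary.Linked using (Linked)
open import Data.List.Relation.Unary.Unique.Propositional using (Unique)
open import Data.Nat.Base using (ℕ; zero; suc; _+_; _*_; _^_; _≤_)
open import Data.Nat.Properties using (_≤?_)
open import Data.Nat.Binary.Base using (ℕᵇ; 2[1+_]; 1+[2_]) renaming (fromℕ to binary; zero to 0ᵇ)
open import Data.Product.Base using (Σ-syntax; ∃-syntax; _×_; _,_; proj₁; proj₂)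
open import Data.Sum.Base using (_⊎_)
open import Data.Vec.Base as Vec using (Vec; lookup; toList)
open import Function.Bundles using (_⇔_)
open import Relation.Binary.PropositionalEquality using (_≡_; _≢_)
open import Relation.Nullary.Decidable.Core using (⌊_⌋)

-- Machine model: Jones's WHILE language (N. D. Jones, "Computability and
-- Complexity from a Programming Perspective"), in point-free form.  Binary
-- trees play the role of words.  Unlike in Jones's unit-cost measure, every
-- atomic operation is charged the size of its argument.  Hence the running
-- time bounds the size of all intermediate values, trees cannot be duplicated
-- for free, and Turing machines and these programs simulate each other with
-- polynomial overhead.

infixr 5 _∙_

data Tree : Set where
  nil : Tree
  _∙_ : Tree → Tree → Tree

size : Tree → ℕ
size nil     = 1
size (a ∙ b) = suc (size a + size b)

data Prog : Set where
  id nil hd tl eq : Prog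
  cons            : Prog → Prog → Prog
  _⨾_             : Prog → Prog → Prog
  cond            : Prog → Prog → Prog → Prog
  while           : Prog → Prog → Prog

head tail : Tree → Tree
head nil     = nil
head (a ∙ b) = a
tail nil     = nil
tail (a ∙ b) = b

_==_ : Tree → Tree → Bool
nil     == nil     = true
nil     == (_ ∙ _) = false
(_ ∙ _) == nil     = false
(a ∙ b) == (c ∙ d) = (a == c) ∧ (b == d)

components-equal : Tree → Tree
components-equal x = if head x == tail x then nil ∙ nil else nil

-- p ⊢ x ⇓ y [ t ]: on input x, the program p halts with output y in time t.
-- As a truth value, nil is false and every other tree is true.

infix 4 _⊢_⇓_[_]

data _⊢_⇓_[_] : Prog → Tree → Tree → ℕ → Set where
  id  : ∀ {x} → id  ⊢ x ⇓ x                  [ size x ]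
  nil : ∀ {x} → nil ⊢ x ⇓ nil                [ size x ]
  hd  : ∀ {x} → hd  ⊢ x ⇓ head x             [ size x ]
  tl  : ∀ {x} → tl  ⊢ x ⇓ tail x             [ size x ]
  eq  : ∀ {x} → eq  ⊢ x ⇓ components-equal x [ size x ]

  cons : ∀ {p q x a b t u} →
    p ⊢ x ⇓ a [ t ] → q ⊢ x ⇓ b [ u ] →
    cons p q ⊢ x ⇓ a ∙ b [ suc (t + u) ]

  seq : ∀ {p q x y z t u} →
    p ⊢ x ⇓ y [ t ] → q ⊢ y ⇓ z [ u ] →
    (p ⨾ q) ⊢ x ⇓ z [ suc (t + u) ]

  if-true : ∀ {p q r x a b y t u} →
    p ⊢ x ⇓ a ∙ b [ t ] → q ⊢ x ⇓ y [ u ] →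
    cond p q r ⊢ x ⇓ y [ suc (t + u) ]

  if-false : ∀ {p q r x y t u} →
    p ⊢ x ⇓ nil [ t ] → r ⊢ x ⇓ y [ u ] →
    cond p q r ⊢ x ⇓ y [ suc (t + u) ]

  while-true : ∀ {p q x a b y z t u v} →
    p ⊢ x ⇓ a ∙ b [ t ] → q ⊢ x ⇓ y [ u ] → while p q ⊢ y ⇓ z [ v ] →
    while p q ⊢ x ⇓ z [ suc (t + u + v) ]

  while-false : ∀ {p q x t} →
    p ⊢ x ⇓ nil [ t ] →
    while p q ⊢ x ⇓ x [ suc t ]

unary : ℕ → Tree
unary zero    = nil
unary (suc n) = nil ∙ unary n

bits : ℕᵇ → Tree
bits 0ᵇ        = nil
bits 2[1+ b ]  = nil ∙ bits b
bits 1+[2 b ]  = (nil ∙ nil) ∙ bits b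

index : ∀ {n} → Fin n → Tree
index i = unary (toℕ i)

list : List Tree → Tree
list = foldr _∙_ nil

Computable : (ℕ → ℕ) → Set
Computable f = ∃[ p ] ∀ n → ∃[ t ] p ⊢ unary n ⇓ unary (f n) [ t ]

-- A parameterized problem is a set of pairs (x , k) with parameter k.

Problem : Set₁
Problem = Tree → ℕ → Set

record _≤fpt_ (A B : Problem) : Set where
  field
    program      : Prog
    reduct       : Tree → ℕ → Tree
    parameter    : Tree → ℕ → ℕ
    correct      : ∀ x k → A x k ⇔ B (reduct x k) (parameter x k)
    g            : ℕ → ℕ
    g-computable : Computable g
    parameter≤g  : ∀ x k → parameter x k ≤ g k
    f            : ℕ → ℕ
    f-computable : Computable f
    exponent     : ℕ
    runs         : ∀ x k → ∃[ t ]
                   program ⊢ x ∙ unary k ⇓ reduct x k ∙ unary (parameter x k) [ t ]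
                   × t ≤ f k * size x ^ exponent

-- Boolean circuits are acyclic: a gate refers only to nodes before it.  Nodes
-- are numbered from the most recent one, which has index zero.

data Gate (A : Set) : Set where
  neg  : A → Gate A
  conj : List A → Gate A
  disj : List A → Gate A

mapGate : ∀ {A B : Set} → (A → B) → Gate A → Gate B
mapGate f (neg a)   = neg (f a)
mapGate f (conj as) = conj (map f as)
mapGate f (disj as) = disj (map f as)

predecessors : ∀ {A : Set} → Gate A → List A
predecessors (neg a)   = a ∷ []
predecessors (conj as) = as
predecessors (disj as) = as

-- Circuit n m: n inputs and m nodes altogether.

data Circuit (n : ℕ) : ℕ → Set where
  inputs : Circuit n n
  _▷_    : ∀ {m} → Circuit n m → Gate (Fin m) → Circuit n (suc m)

evaluate : ∀ {A : Set} {n m} → (Gate A → A) → Vec A n → Circuit n m → Vec A m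
evaluate op as inputs  = as
evaluate op as (c ▷ g) = op (mapGate (lookup values) g) Vec.∷ values
  where values = evaluate op as c

boolean : Gate Bool → Bool
boolean (neg b)   = not b
boolean (conj bs) = and bs
boolean (disj bs) = or bs

value : ∀ {n m} → Circuit n m → Subset n → Fin m → Bool
value c S = lookup (evaluate boolean S c)

-- The largest number of gates, respectively of gates of fan-in greater than
-- two, on a path from an input to the given node.

depth : ∀ {n m} → Circuit n m → Fin m → ℕ
depth c = lookup (evaluate (λ g → suc (max 0 (predecessors g))) (Vec.replicate _ 0) c)

large : ∀ {A : Set} → Gate A → ℕ
large g = if ⌊ 3 ≤? length (predecessors g) ⌋ then 1 else 0

weft : ∀ {n m} → Circuit n m → Fin m → ℕ
weft c = lookup (evaluate (λ g → large g + max 0 (predecessors g)) (Vec.replicate _ 0) c)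

gateTree : ∀ {m} → Gate (Fin m) → Tree
gateTree (neg i)   = nil ∙ index i
gateTree (conj is) = (nil ∙ nil) ∙ list (map index is)
gateTree (disj is) = (nil ∙ nil ∙ nil) ∙ list (map index is)

gatesTree : ∀ {n m} → Circuit n m → Tree
gatesTree inputs  = nil
gatesTree (c ▷ g) = gateTree g ∙ gatesTree c

circuitTree : ∀ {n m} → Circuit n m → Fin m → Tree
circuitTree {n} c output = unary n ∙ gatesTree c ∙ index output

-- Weighted satisfiability for circuits of weft at most w and depth at most d,
-- parameterized by the weight k.

WeightedCircuitSat : ℕ → ℕ → Problem
WeightedCircuitSat w d x k =
  ∃[ n ] ∃[ m ] Σ[ c ∈ Circuit n m ] Σ[ output ∈ Fin m ]
    x ≡ circuitTree c output
    × weft c output ≤ w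
    × depth c output ≤ d
    × Σ[ S ∈ Subset n ] (∣ S ∣ ≡ k × value c S output ≡ true)

W[_] : ℕ → Problem → Set
W[ w ] A = ∃[ d ] A ≤fpt WeightedCircuitSat w d

_-hard : (Problem → Set) → Problem → Set₁
(C -hard) B = ∀ A → C A → A ≤fpt B

-- Undirected multigraphs: the order of the two components of an entry of ends
-- is disregarded by Joins.

record Graph : Set where
  field
    order    : ℕ
    edges    : ℕ
    ends     : Vec (Fin order × Fin order) edges
    loopless : ∀ e → proj₁ (lookup ends e) ≢ proj₂ (lookup ends e)

  V E : Set
  V = Fin order
  E = Fin edges

  Joins : E → V → V → Set
  Joins e u v = lookup ends e ≡ (u , v) ⊎ lookup ends e ≡ (v , u)

record TemporalGraph : Set where
  field
    graph : Graph
  open Graph graph public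
  field
    times    : Vec ℕ edges
    positive : ∀ e → 1 ≤ lookup times e
    distinct : ∀ e e′ {u v} → e ≢ e′ → Joins e u v → Joins e′ u v →
               lookup times e ≢ lookup times e′

  time : E → ℕ
  time = lookup times

  lifetime : ℕ
  lifetime = max 0 (toList times)

  data Walk : V → V → Set where
    stop : ∀ x → Walk x x
    step : ∀ x {y z} (e : E) → Joins e x y → Walk y z → Walk x z

  walkVertices : ∀ {x y} → Walk x y → List V
  walkVertices (stop x)       = x ∷ []
  walkVertices (step x _ _ w) = x ∷ walkVertices w

  walkEdges : ∀ {x y} → Walk x y → List E
  walkEdges (stop _)       = []
  walkEdges (step _ e _ w) = e ∷ walkEdges w

  IsTemporal : ∀ {x y} → Walk x y → Set
  IsTemporal w = Linked _≤_ (map time (walkEdges w))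

  IsPath : ∀ {x y} → Walk x y → Set
  IsPath w = Unique (walkVertices w)

  -- The element i of Fin lifetime stands for the timestep suc (toℕ i), so that
  -- Fin lifetime is the set {1, …, lifetime}.

  ActiveIn : Subset lifetime → E → Set
  ActiveIn S e = ∃[ i ] i ∈ S × time e ≡ suc (toℕ i)

  IsSnapshotCut : V → V → Subset lifetime → Set
  IsSnapshotCut s z S =
    (w : Walk s z) → IsTemporal w → IsPath w → Any (ActiveIn S) (walkEdges w)

  -- Vertices are written in unary and times in binary.

  edgeTree : V × V → ℕ → Tree
  edgeTree (u , v) t = index u ∙ index v ∙ bits (binary t)

  instanceTree : V → V → Tree
  instanceTree s z =
    unary order ∙ list (toList (Vec.zipWith edgeTree ends times)) ∙ index s ∙ index z

  HasSnapshotCut : V → V → ℕ → Set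
  HasSnapshotCut s z h = Σ[ S ∈ Subset lifetime ] (∣ S ∣ ≤ h × IsSnapshotCut s z S)

open TemporalGraph using (V; instanceTree; HasSnapshotCut)

SnapshotCut : Problem
SnapshotCut x h =
  Σ[ G ∈ TemporalGraph ] Σ[ s ∈ V G ] Σ[ z ∈ V G ]
    s ≢ z × x ≡ instanceTree G s z × HasSnapshotCut G s z h

{-# OPTIONS --safe #-}
module Submission where

-- A weft-1 circuit of depth d is turned into a hitting set instance whose universe
-- consists of slots.  A hitting set of at most as many elements as there are slots
-- picks exactly one element of each slot.  The k main slots pick the k inputs set
-- to true.  That slot j does not pick v is the monotone clause of all other
-- elements of slot j, so every CNF over the slots is a hitting set instance.
-- Small gates are expanded into unions and products of CNFs, of polynomial size
-- for fixed d.  A large conjunction is again a CNF; for a large disjunction an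
-- additional slot picks a satisfied argument, and since the weft is 1, fewer than
-- 2 ^ d additional slots suffice.
--
-- Hitting set becomes snapshot cut by internally disjoint paths from s to z, one
-- per clause, whose edges are labelled by the elements of the clause in increasing
-- order.
--
-- All functions involved are computed on trees by recursions whose accumulator
-- grows in each step by an amount independent of it, hence in polynomial time.

open import Defs
import Data.Bool.Properties as Bool
import Data.Fin.Properties as Fin
import Data.List.Membership.DecPropositional as DecMembership
import Data.List.Relation.Unary.All.Properties as All
import Data.List.Relation.Unary.Any.Properties as Any
import Data.List.Relation.Unary.Unique.Propositional.Properties as Unique
open import Data.Bool.Base as Bool using (Bool; if_then_else_; not; _∧_)
open import Data.Bool.ListAction using (and; or)
open import Data.Empty as Empty using (⊥-elim)
open import Data.Fin.Base as Fin using (Fin; toℕ)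
open import Data.Fin.Properties using (toℕ-injective; toℕ<n; toℕ-fromℕ<)
open import Data.Fin.Subset as Subset using (Subset; ∣_∣; ⁅_⁆; _∪_; ⊥)
open import Data.Fin.Subset.Properties using (∣⁅x⁆∣≡1; ∣⊥∣≡0; x∈⁅x⁆; x∈⁅y⁆⇒x≡y; x∈p∪q⁺; x∈p∪q⁻; ∉⊥)
open import Data.List.Base using (List; []; _∷_; map; length; _++_)
open import Data.List.Extrema.Nat using (max; xs≤max; max≤v⁺)
open import Data.List.Membership.Propositional using (_∈_; lose; find)
open import Data.List.Membership.Propositional.Properties using (∈-map⁺; ∈-map⁻; ∈-++⁻; ∈-++⁺ˡ; ∈-++⁺ʳ; ∈-∃++)
open import Data.List.Properties using (map-++; length-map; length-++-sucʳ; ∷-injective)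
open import Data.List.Relation.Binary.Subset.Propositional using (_⊆_)
open import Data.List.Relation.Unary.All as All using (All; []; _∷_)
open import Data.List.Relation.Unary.AllPairs using (AllPairs; []; _∷_)
open import Data.List.Relation.Unary.Any as Any using (Any; here; there; any?)
open import Data.List.Relation.Unary.Linked using (Linked; []; [-]; _∷_)
open import Data.List.Relation.Unary.Unique.Propositional using (Unique)
open import Data.Nat.Base
open import Data.Nat.Binary.Base as ℕᵇ using (ℕᵇ; 2[1+_]; 1+[2_])
open import Data.Nat.Binary.Properties using (fromℕ≡fromℕ'; toℕ-fromℕ)
open import Data.Nat.Properties hiding (_≤?_)
open import Data.Nat.Tactic.RingSolver using (solve-∀)
open import Data.Product.Base using (∃-syntax; Σ-syntax; _×_; _,_; proj₁; proj₂)
open import Data.Sum.Base using (_⊎_; inj₁; inj₂)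
open import Data.Unit.Base using (⊤; tt)
open import Data.Vec.Base as Vec using (Vec; lookup; toList; fromList; replicate)
open import Data.Vec.Membership.Propositional.Properties using (∈-lookup; ∈-toList⁺)
open import Data.Vec.Properties using (lookup-map; lookup-replicate; []=⇒lookup; lookup⇒[]=)
open import Function.Bundles using (_⇔_; mk⇔; module Equivalence)
open import Function.Construct.Composition using (_⇔-∘_)
open import Function.Construct.Symmetry using (⇔-sym)
open import Relation.Binary.Definitions using (tri<; tri≈; tri>)
open import Relation.Binary.PropositionalEquality
open import Relation.Nullary using (yes; no; ¬_)
open import Relation.Nullary.Decidable.Core using (does)
open DecMembership _≟_ using (_∈?_)

-- Hitting set is monotone, and its parameter must stay bounded in terms of `k`. A CNF is built for
-- a node together with the value that it is to have, so negations only flip this value and vanish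
-- at the inputs, where either literal is a set of clauses over the main slots. Distributing a large
-- disjunction over its arguments would blow up exponentially; guessing a satisfied argument avoids
-- this. Weft 1 makes one guess enough: below a large gate all gates are small, so its arguments
-- need no slots of their own, whereas nested large gates would demand slots in proportion to the
-- fan-in. The two arguments of a small gate get disjoint blocks of slots, hence the `2 ^ d`.
-- Further clauses keep the main slots from picking an input twice. A slot has as many elements as
-- the circuit has nodes, enough to name an input or an argument.
--
-- An element becomes a timestep, because choosing a timestep cuts every edge with that label, on
-- all paths at once. A tree that encodes no circuit of the required weft and depth has to become a
-- no-instance, so the program also recognises such circuits.

infixl 6 _⊕_
infixl 7 _⊗_
infixr 9 _⊚_

-- Polynomial bounds, closed under composition

data Poly : Set where
  var     : Poly
  con     : ℕ → Poly
  _⊕_ _⊗_ : Poly → Poly → Poly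
  _⊚_     : Poly → Poly → Poly

⟦_⟧ : Poly → ℕ → ℕ
⟦ var ⟧ s   = s
⟦ con n ⟧ s = n
⟦ p ⊕ q ⟧ s = ⟦ p ⟧ s + ⟦ q ⟧ s
⟦ p ⊗ q ⟧ s = ⟦ p ⟧ s * ⟦ q ⟧ s
⟦ p ⊚ q ⟧ s = ⟦ p ⟧ (⟦ q ⟧ s)

⟦⟧-mono : ∀ p {m n} → m ≤ n → ⟦ p ⟧ m ≤ ⟦ p ⟧ n
⟦⟧-mono var     m≤n = m≤n
⟦⟧-mono (con n) m≤n = ≤-refl
⟦⟧-mono (p ⊕ q) m≤n = +-mono-≤ (⟦⟧-mono p m≤n) (⟦⟧-mono q m≤n)
⟦⟧-mono (p ⊗ q) m≤n = *-mono-≤ (⟦⟧-mono p m≤n) (⟦⟧-mono q m≤n)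
⟦⟧-mono (p ⊚ q) m≤n = ⟦⟧-mono p (⟦⟧-mono q m≤n)

-- Not the algebraic degree but an exponent for the base `2 + s`, which also pays for constants: a
-- sum takes one more factor, and a composition two more factors for the summand 2 in `2 + ⟦ q ⟧ s`.
degree : Poly → ℕ
degree var     = 1
degree (con n) = n
degree (p ⊕ q) = suc (degree p + degree q)
degree (p ⊗ q) = degree p + degree q
degree (p ⊚ q) = (2 + degree q) * degree p

n≤2^n : ∀ n → n ≤ 2 ^ n
n≤2^n zero    = z≤n
n≤2^n (suc n) = begin
  1 + n         ≤⟨ +-mono-≤ (>-nonZero⁻¹ (2 ^ n) {{m^n≢0 2 n}}) (n≤2^n n) ⟩
  2 ^ n + 2 ^ n ≡⟨ cong (2 ^ n +_) (sym (+-identityʳ _)) ⟩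
  2 ^ suc n     ∎
  where open ≤-Reasoning

-- The base 2 + s absorbs constants: n ≤ 2 ^ n.
⟦⟧≤^degree : ∀ p s → ⟦ p ⟧ s ≤ (2 + s) ^ degree p
⟦⟧≤^degree var     s = ≤-trans (m≤n+m s 2) (≤-reflexive (sym (^-identityʳ (2 + s))))
⟦⟧≤^degree (con n) s = ≤-trans (n≤2^n n) (^-monoˡ-≤ n (m≤m+n 2 s))
⟦⟧≤^degree (p ⊕ q) s = begin
  ⟦ p ⟧ s + ⟦ q ⟧ s  ≤⟨ +-mono-≤ (≤-trans (⟦⟧≤^degree p s) (^-monoʳ-≤ (2 + s) (m≤m+n a b)))
                                (≤-trans (⟦⟧≤^degree q s) (^-monoʳ-≤ (2 + s) (m≤n+m b a))) ⟩
  c + c              ≡⟨ cong (c +_) (sym (+-identityʳ c)) ⟩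
  2 * c              ≤⟨ *-monoˡ-≤ c (m≤m+n 2 s) ⟩
  (2 + s) * c        ∎
  where
    open ≤-Reasoning
    a = degree p
    b = degree q
    c = (2 + s) ^ (a + b)
⟦⟧≤^degree (p ⊗ q) s = begin
  ⟦ p ⟧ s * ⟦ q ⟧ s                     ≤⟨ *-mono-≤ (⟦⟧≤^degree p s) (⟦⟧≤^degree q s) ⟩
  (2 + s) ^ degree p * (2 + s) ^ degree q ≡⟨ sym (^-distribˡ-+-* (2 + s) (degree p) (degree q)) ⟩
  (2 + s) ^ (degree p + degree q)       ∎
  where open ≤-Reasoning
⟦⟧≤^degree (p ⊚ q) s = begin
  ⟦ p ⟧ (⟦ q ⟧ s)                       ≤⟨ ⟦⟧≤^degree p _ ⟩
  (2 + ⟦ q ⟧ s) ^ degree p              ≤⟨ ^-monoˡ-≤ (degree p) inner ⟩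
  ((2 + s) ^ (2 + degree q)) ^ degree p ≡⟨ ^-*-assoc (2 + s) (2 + degree q) (degree p) ⟩
  (2 + s) ^ ((2 + degree q) * degree p) ∎
  where
    open ≤-Reasoning
    c = (2 + s) ^ degree q
    1≤c : 1 ≤ c
    1≤c = >-nonZero⁻¹ c {{m^n≢0 (2 + s) (degree q)}}
    inner : 2 + ⟦ q ⟧ s ≤ (2 + s) * ((2 + s) * c)
    inner = begin
      2 + ⟦ q ⟧ s             ≤⟨ +-mono-≤ (+-mono-≤ 1≤c 1≤c) (⟦⟧≤^degree q s) ⟩
      c + c + c               ≤⟨ m≤m+n (c + c + c) c ⟩
      c + c + c + c           ≡⟨ four c ⟩
      2 * (2 * c)             ≤⟨ *-mono-≤ (m≤m+n 2 s) (*-monoˡ-≤ c (m≤m+n 2 s)) ⟩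
      (2 + s) * ((2 + s) * c) ∎
      where
        four : ∀ c → c + c + c + c ≡ 2 * (2 * c)
        four = solve-∀

-- Polynomial time

size-pos : ∀ x → 1 ≤ size x
size-pos nil     = s≤s z≤n
size-pos (a ∙ b) = s≤s z≤n

size-head : ∀ x → size (head x) ≤ size x
size-head nil     = ≤-refl
size-head (a ∙ b) = m≤n⇒m≤1+n (m≤m+n (size a) (size b))

size-tail : ∀ x → size (tail x) ≤ size x
size-tail nil     = ≤-refl
size-tail (a ∙ b) = m≤n⇒m≤1+n (m≤n+m (size b) (size a))

ifT : Tree → Tree → Tree → Tree
ifT nil     x y = y
ifT (_ ∙ _) x y = x

same : Tree → Tree → Tree
same a b = components-equal (a ∙ b)

size-same : ∀ x → size (components-equal x) ≤ 3
size-same x with head x == tail x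
... | Bool.true  = ≤-refl
... | Bool.false = s≤s z≤n

-- The first premise of each rule runs on the same input, down to an atomic operation that is
-- charged its size. This settles the loop that stops at once in `size-output`.
size-input : ∀ {p x y t} → p ⊢ x ⇓ y [ t ] → size x ≤ t
size-input id                     = ≤-refl
size-input nil                    = ≤-refl
size-input hd                     = ≤-refl
size-input tl                     = ≤-refl
size-input eq                     = ≤-refl
size-input (cons d e)             = m≤n⇒m≤1+n (m≤n⇒m≤n+o _ (size-input d))
size-input (seq d e)              = m≤n⇒m≤1+n (m≤n⇒m≤n+o _ (size-input d))
size-input (if-true d e)          = m≤n⇒m≤1+n (m≤n⇒m≤n+o _ (size-input d))
size-input (if-false d e)         = m≤n⇒m≤1+n (m≤n⇒m≤n+o _ (size-input d))
size-input (while-true d e f)     = m≤n⇒m≤1+n (m≤n⇒m≤n+o _ (m≤n⇒m≤n+o _ (size-input d)))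
size-input (while-false d)        = m≤n⇒m≤1+n (size-input d)

-- The factor 3 is needed only for eq, which maps nil to nil ∙ nil in time 1.
size-output : ∀ {p x y t} → p ⊢ x ⇓ y [ t ] → size y ≤ 3 * t
size-output (id {x})         = m≤n*m (size x) 3
size-output (nil {x})        = ≤-trans (size-pos x) (m≤n*m (size x) 3)
size-output (hd {x})         = ≤-trans (size-head x) (m≤n*m (size x) 3)
size-output (tl {x})         = ≤-trans (size-tail x) (m≤n*m (size x) 3)
size-output (eq {x})         = ≤-trans (size-same x) (*-monoʳ-≤ 3 (size-pos x))
size-output (cons {a = a} {b} {t} {u} d e) = begin
  1 + (size a + size b)  ≤⟨ +-mono-≤ {1} {3} (s≤s z≤n) (+-mono-≤ (size-output d) (size-output e)) ⟩
  3 + (3 * t + 3 * u)    ≡⟨ distribute t u ⟩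
  3 * suc (t + u)        ∎
  where
    open ≤-Reasoning
    distribute : ∀ t u → 3 + (3 * t + 3 * u) ≡ 3 * suc (t + u)
    distribute = solve-∀
size-output (seq {t = t} {u} d e) = ≤-trans (size-output e) (*-monoʳ-≤ 3 (m≤n⇒m≤1+n (m≤n+m u t)))
size-output (if-true {t = t} {u} d e) = ≤-trans (size-output e) (*-monoʳ-≤ 3 (m≤n⇒m≤1+n (m≤n+m u t)))
size-output (if-false {t = t} {u} d e) = ≤-trans (size-output e) (*-monoʳ-≤ 3 (m≤n⇒m≤1+n (m≤n+m u t)))
size-output (while-true {t = t} {u} {v} d e f) =
  ≤-trans (size-output f) (*-monoʳ-≤ 3 (m≤n⇒m≤1+n (m≤n+m v (t + u))))
size-output (while-false {t = t} d) = ≤-trans (size-input d) (≤-trans (n≤1+n t) (m≤n*m (suc t) 3))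

record PolyTime (f : Tree → Tree) : Set where
  constructor polytime
  field
    program : Prog
    bound   : Poly
    runs    : ∀ x → ∃[ t ] program ⊢ x ⇓ f x [ t ] × t ≤ ⟦ bound ⟧ (size x)

sizeBound : ∀ {f} → PolyTime f → Poly
sizeBound F = con 3 ⊗ PolyTime.bound F

size≤ : ∀ {f} (F : PolyTime f) x → size (f x) ≤ ⟦ sizeBound F ⟧ (size x)
size≤ F x = let t , d , t≤ = PolyTime.runs F x in ≤-trans (size-output d) (*-monoʳ-≤ 3 t≤)

idᵖ : PolyTime (λ x → x)
idᵖ = polytime id var (λ x → size x , id , ≤-refl)

nilᵖ : PolyTime (λ _ → nil)
nilᵖ = polytime nil var (λ x → size x , nil , ≤-refl)

infixr 5 _∙ᵖ_
infixr 9 _∘ᵖ_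

_∙ᵖ_ : ∀ {f g} → PolyTime f → PolyTime g → PolyTime (λ x → f x ∙ g x)
polytime p b r ∙ᵖ polytime q c s = polytime (cons p q) (con 1 ⊕ (b ⊕ c)) λ x →
  let t , d , t≤ = r x
      u , e , u≤ = s x
  in suc (t + u) , cons d e , s≤s (+-mono-≤ t≤ u≤)

_∘ᵖ_ : ∀ {f g} → PolyTime f → PolyTime g → PolyTime (λ x → f (g x))
_∘ᵖ_ {g = g} (polytime p b r) G@(polytime q c s) = polytime (q ⨾ p) (con 1 ⊕ (c ⊕ b ⊚ sizeBound G)) λ x →
  let t , d , t≤ = s x
      u , e , u≤ = r (g x)
  in suc (t + u) , seq d e , s≤s (+-mono-≤ t≤ (≤-trans u≤ (⟦⟧-mono b (size≤ G x))))

constᵖ : ∀ c → PolyTime (λ _ → c)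
constᵖ nil     = nilᵖ
constᵖ (a ∙ b) = constᵖ a ∙ᵖ constᵖ b

hdᵖ : ∀ {f} → PolyTime f → PolyTime (λ x → head (f x))
hdᵖ F = polytime hd var (λ x → size x , hd , ≤-refl) ∘ᵖ F

tlᵖ : ∀ {f} → PolyTime f → PolyTime (λ x → tail (f x))
tlᵖ F = polytime tl var (λ x → size x , tl , ≤-refl) ∘ᵖ F

sameᵖ : ∀ {f g} → PolyTime f → PolyTime g → PolyTime (λ x → same (f x) (g x))
sameᵖ F G = polytime eq var (λ x → size x , eq , ≤-refl) ∘ᵖ (F ∙ᵖ G)

ifᵖ : ∀ {c f g} → PolyTime c → PolyTime f → PolyTime g → PolyTime (λ x → ifT (c x) (f x) (g x))
ifᵖ {c} {f} {g} (polytime p b r) (polytime q b′ s) (polytime q′ b″ s′) =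
  polytime (cond p q q′) (con 1 ⊕ (b ⊕ (b′ ⊕ b″))) λ x → branch x (c x) refl
  where
    branch : ∀ x y → c x ≡ y → ∃[ t ] cond p q q′ ⊢ x ⇓ ifT y (f x) (g x) [ t ] ×
      t ≤ ⟦ con 1 ⊕ (b ⊕ (b′ ⊕ b″)) ⟧ (size x)
    branch x nil cx≡y =
      let t , d , t≤ = r x
          u , e , u≤ = s′ x
      in suc (t + u) , if-false (subst (λ y → p ⊢ x ⇓ y [ t ]) cx≡y d) e ,
         s≤s (+-mono-≤ t≤ (m≤n⇒m≤o+n _ u≤))
    branch x (_ ∙ _) cx≡y =
      let t , d , t≤ = r x
          u , e , u≤ = s x
      in suc (t + u) , if-true (subst (λ y → p ⊢ x ⇓ y [ t ]) cx≡y d) e ,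
         s≤s (+-mono-≤ t≤ (m≤n⇒m≤n+o _ u≤))

-- Recursion along the right spine in polynomial time

-- A tree is read as the list along its right spine.

para : (Tree → Tree → Tree → Tree) → Tree → Tree → Tree
para step nil     z = z
para step (a ∙ l) z = step a l (para step l z)

-- `para` with the data of a step packed into one tree, as a program receives it: the parameter `x`,
-- the entry, the rest of the list and the result so far.
recur : (Tree → Tree) → Tree → Tree → Tree → Tree
recur step x l z = para (λ a l r → step (x ∙ a ∙ l ∙ r)) l z

num : Tree → ℕ
num nil     = 0
num (_ ∙ l) = suc (num l)

num<size : ∀ x → suc (num x) ≤ size x
num<size nil     = ≤-refl
num<size (a ∙ l) = s≤s (≤-trans (num<size l) (m≤n+m (size l) (size a)))

append : Tree → Tree → Tree
append l m = para (λ a _ r → a ∙ r) l m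

append-nil : ∀ l → append l nil ≡ l
append-nil nil     = refl
append-nil (a ∙ l) = cong (a ∙_) (append-nil l)

reverseOnto : Tree → Tree → Tree
reverseOnto nil     s = s
reverseOnto (a ∙ l) s = reverseOnto l (a ∙ s)

reverseOnto-twice : ∀ l s m → reverseOnto (reverseOnto l s) m ≡ reverseOnto s (append l m)
reverseOnto-twice nil     s m = refl
reverseOnto-twice (a ∙ l) s m = reverseOnto-twice l (a ∙ s) m

size-reverseOnto : ∀ l s → suc (size (reverseOnto l s)) ≡ size l + size s
size-reverseOnto nil     s = refl
size-reverseOnto (a ∙ l) s = trans (size-reverseOnto l (a ∙ s)) (shift (size a) (size l) (size s))
  where
    shift : ∀ a l s → l + suc (a + s) ≡ suc (a + l + s)
    shift = solve-∀

-- This keeps the accumulator polynomial: the growth of a step must not depend on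
-- the accumulator r.

record Growth (step : Tree → Tree) : Set where
  constructor growth
  field
    amount : Poly
    grows  : ∀ x a l r → size (step (x ∙ a ∙ l ∙ r)) ≤ size r + ⟦ amount ⟧ (size (x ∙ a ∙ l))

-- The increments add up instead of compounding, since each is bounded by the amount at the whole
-- list, whatever the accumulator.
size-para : ∀ {step} (G : Growth step) x l z →
  size (recur step x l z) ≤ size z + size l * ⟦ Growth.amount G ⟧ (size (x ∙ l))
size-para G x nil     z = m≤m+n (size z) _
size-para {step} G@(growth p grows) x (a ∙ l) z = begin
  size (step (x ∙ a ∙ l ∙ recur step x l z))                      ≤⟨ grows x a l (recur step x l z) ⟩
  size (recur step x l z) + g                               ≤⟨ +-monoˡ-≤ g (size-para G x l z) ⟩
  size z + size l * ⟦ p ⟧ (size (x ∙ l)) + g                 ≤⟨ +-monoˡ-≤ g (+-monoʳ-≤ (size z) (*-monoʳ-≤ (size l) l≤)) ⟩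
  size z + size l * g + g                                    ≡⟨ collect (size z) (size l) g ⟩
  size z + suc (size l) * g                                  ≤⟨ +-monoʳ-≤ (size z) (*-monoˡ-≤ g (s≤s (m≤n+m (size l) (size a)))) ⟩
  size z + size (a ∙ l) * g                                  ∎
  where
    open ≤-Reasoning
    g = ⟦ p ⟧ (size (x ∙ a ∙ l))
    l≤ : ⟦ p ⟧ (size (x ∙ l)) ≤ g
    l≤ = ⟦⟧-mono p (s≤s (+-monoʳ-≤ (size x) (m≤n⇒m≤1+n (m≤n+m (size l) (size a)))))
    collect : ∀ z l g → z + l * g + g ≡ z + suc l * g
    collect = solve-∀

iterationBound : ∀ {c f} → PolyTime c → PolyTime f → Poly
iterationBound C F = con 1 ⊕ (PolyTime.bound C ⊕ PolyTime.bound F)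

module _ {c f : Tree → Tree} (C : PolyTime c) (F : PolyTime f) where
  private
    loop = while (PolyTime.program C) (PolyTime.program F)
    cost = ⟦ iterationBound C F ⟧

  while-stop : ∀ {M x} → size x ≤ M → c x ≡ nil → ∃[ t ] loop ⊢ x ⇓ x [ t ] × t ≤ cost M
  while-stop {M} {x} x≤M cx with PolyTime.runs C x
  ... | t , d , t≤ rewrite cx =
    suc t , while-false d , s≤s (≤-trans t≤ (≤-trans (⟦⟧-mono (PolyTime.bound C) x≤M) (m≤m+n _ _)))

  -- All states are charged at a common size bound `M`, so the time of a loop is the number of
  -- iterations times one cost.
  while-step : ∀ {M n x y z a b} → size x ≤ M → c x ≡ a ∙ b → f x ≡ y →
    ∃[ t ] (loop ⊢ y ⇓ z [ t ] × t ≤ n * cost M) → ∃[ t ] loop ⊢ x ⇓ z [ t ] × t ≤ suc n * cost M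
  while-step {M} {x = x} x≤M cx refl (v , e , v≤) with PolyTime.runs C x | PolyTime.runs F x
  ... | t , d , t≤ | u , d′ , u≤ rewrite cx =
    suc (t + u + v) , while-true d d′ e ,
    +-mono-≤ (s≤s (+-mono-≤ (≤-trans t≤ (⟦⟧-mono (PolyTime.bound C) x≤M))
                            (≤-trans u≤ (⟦⟧-mono (PolyTime.bound F) x≤M)))) v≤

-- Functions of several arguments are applied to right-nested pairs.

uncurry₂ : (Tree → Tree → Tree) → Tree → Tree
uncurry₂ f y = f (head y) (tail y)

uncurry₃ : (Tree → Tree → Tree → Tree) → Tree → Tree
uncurry₃ f y = f (head y) (head (tail y)) (tail (tail y))

uncurry₄ : (Tree → Tree → Tree → Tree → Tree) → Tree → Tree
uncurry₄ f y = f (head y) (head (tail y)) (head (tail (tail y))) (tail (tail (tail y)))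

-- The states are l ∙ s ∙ x ∙ r.  The first loop moves the list l to the stack
-- s; the second one moves it back while it applies the step to the result r.

module _ {step : Tree → Tree} (S : PolyTime step) (G : Growth step) where
  private
    unload reload : Tree → Tree
    unload st = tail (head st) ∙ (head (head st) ∙ head (tail st)) ∙ tail (tail st)
    reload st = (head (head (tail st)) ∙ head st) ∙ tail (head (tail st)) ∙ head (tail (tail st)) ∙
      step (head (tail (tail st)) ∙ head (head (tail st)) ∙ head st ∙ tail (tail (tail st)))

    Unload : PolyTime unload
    Unload = tlᵖ (hdᵖ idᵖ) ∙ᵖ (hdᵖ (hdᵖ idᵖ) ∙ᵖ hdᵖ (tlᵖ idᵖ)) ∙ᵖ tlᵖ (tlᵖ idᵖ)

    Reload : PolyTime reload
    Reload = (hdᵖ (hdᵖ (tlᵖ idᵖ)) ∙ᵖ hdᵖ idᵖ) ∙ᵖ tlᵖ (hdᵖ (tlᵖ idᵖ)) ∙ᵖ hdᵖ (tlᵖ (tlᵖ idᵖ)) ∙ᵖ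
      (S ∘ᵖ (hdᵖ (tlᵖ (tlᵖ idᵖ)) ∙ᵖ hdᵖ (hdᵖ (tlᵖ idᵖ)) ∙ᵖ hdᵖ idᵖ ∙ᵖ tlᵖ (tlᵖ (tlᵖ idᵖ))))

    First : PolyTime head
    First = hdᵖ idᵖ

    Second : PolyTime (λ st → head (tail st))
    Second = hdᵖ (tlᵖ idᵖ)

    -- Moving an entry to the stack preserves the size of the state, so the bound `M` survives every
    -- iteration.
    unloading : ∀ {M} l s w → size (l ∙ s ∙ w) ≤ M →
      ∃[ t ] while (PolyTime.program First) (PolyTime.program Unload) ⊢ l ∙ s ∙ w ⇓ nil ∙ reverseOnto l s ∙ w [ t ] ×
             t ≤ suc (num l) * ⟦ iterationBound First Unload ⟧ M
    unloading {M} nil s w ≤M =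
      let t , d , t≤ = while-stop First Unload ≤M refl
      in t , d , ≤-trans t≤ (m≤m+n _ _)
    unloading {M} (a ∙ l) s w ≤M =
      while-step First Unload {n = suc (num l)} ≤M refl refl (unloading l (a ∙ s) w
        (≤-trans (≤-reflexive (shift (size a) (size l) (size s) (size w))) ≤M))
      where
        shift : ∀ a l s w → suc (l + suc (suc (a + s) + w)) ≡ suc (suc (a + l) + suc (s + w))
        shift = solve-∀

    -- The result changes during the loop, so the bound is assumed for all splits of the same total
    -- size; in this form it passes on to the next state.
    reloading : ∀ {M} s l x z →
      (∀ s′ l′ → size l′ + size s′ ≡ size l + size s → size (l′ ∙ s′ ∙ x ∙ recur step x l′ z) ≤ M) →
      ∃[ t ] while (PolyTime.program Second) (PolyTime.program Reload) ⊢ l ∙ s ∙ x ∙ recur step x l z ⇓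
                   reverseOnto s l ∙ nil ∙ x ∙ recur step x (reverseOnto s l) z [ t ] ×
             t ≤ suc (num s) * ⟦ iterationBound Second Reload ⟧ M
    reloading {M} nil l x z ≤M =
      let t , d , t≤ = while-stop Second Reload (≤M nil l refl) refl
      in t , d , ≤-trans t≤ (m≤m+n _ _)
    reloading {M} (a ∙ s) l x z ≤M =
      while-step Second Reload {n = suc (num s)} (≤M (a ∙ s) l refl) refl refl (reloading s (a ∙ l) x z
        (λ s′ l′ e → ≤M s′ l′ (trans e (shift (size a) (size l) (size s)))))
      where
        shift : ∀ a l s → suc (a + l + s) ≡ l + suc (a + s)
        shift = solve-∀

    Start : PolyTime (λ y → head (tail y) ∙ nil ∙ head y ∙ tail (tail y))
    Start = hdᵖ (tlᵖ idᵖ) ∙ᵖ nilᵖ ∙ᵖ hdᵖ idᵖ ∙ᵖ tlᵖ (tlᵖ idᵖ)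

    Result : PolyTime (λ st → tail (tail (tail st)))
    Result = tlᵖ (tlᵖ (tlᵖ idᵖ))

    start result : Poly
    start  = PolyTime.bound Start
    result = PolyTime.bound Result

    stateBound : Poly
    stateBound = con 4 ⊕ var ⊕ var ⊗ Growth.amount G

    loops : Poly
    loops = var ⊗ (iterationBound First Unload ⊚ stateBound) ⊕ var ⊗ (iterationBound Second Reload ⊚ stateBound)

    paraBound : Poly
    paraBound = con 3 ⊕ start ⊕ loops ⊕ result ⊚ stateBound

    state≤ : ∀ x l z s′ l′ → size l′ + size s′ ≡ suc (size l) →
      size (l′ ∙ s′ ∙ x ∙ recur step x l′ z) ≤ ⟦ stateBound ⟧ (size (x ∙ l ∙ z))
    state≤ x l z s′ l′ e = begin
      suc (size l′ + suc (size s′ + suc (size x + size r)))   ≡⟨ regroup (size l′) (size s′) (size x) (size r) ⟩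
      3 + (size l′ + size s′) + size x + size r               ≡⟨ cong (λ n → 3 + n + size x + size r) e ⟩
      4 + size l + size x + size r                            ≤⟨ +-monoʳ-≤ (4 + size l + size x) r≤ ⟩
      4 + size l + size x + (size z + Y * g)                  ≤⟨ final (size l) (size x) (size z) (Y * g) ⟩
      4 + Y + Y * g                                           ∎
      where
        open ≤-Reasoning
        Y = size (x ∙ l ∙ z)
        r = recur step x l′ z
        g = ⟦ Growth.amount G ⟧ Y
        l′≤l : size l′ ≤ size l
        l′≤l = +-cancelʳ-≤ 1 (size l′) (size l)
          (≤-trans (+-monoʳ-≤ (size l′) (size-pos s′)) (≤-reflexive (trans e (+-comm 1 (size l)))))
        l′≤Y : size (x ∙ l′) ≤ Y
        l′≤Y = s≤s (+-monoʳ-≤ (size x) (m≤n⇒m≤1+n (≤-trans l′≤l (m≤m+n (size l) (size z)))))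
        r≤ : size r ≤ size z + Y * g
        r≤ = ≤-trans (size-para G x l′ z) (+-monoʳ-≤ (size z) (*-mono-≤
          (≤-trans (m≤n⇒m≤1+n (m≤n+m (size l′) (size x))) l′≤Y) (⟦⟧-mono (Growth.amount G) l′≤Y)))
        regroup : ∀ l s x r → suc (l + suc (s + suc (x + r))) ≡ 3 + (l + s) + x + r
        regroup = solve-∀
        final : ∀ l x z y → 4 + l + x + (z + y) ≤ 4 + suc (x + suc (l + z)) + y
        final l x z y = ≤-trans (m≤n+m _ 2) (≤-reflexive (swap l x z y))
          where
            swap : ∀ l x z y → 2 + (4 + l + x + (z + y)) ≡ 4 + suc (x + suc (l + z)) + y
            swap = solve-∀

    paraProgram : Prog
    paraProgram = PolyTime.program Start ⨾ (while (PolyTime.program First) (PolyTime.program Unload) ⨾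
      (while (PolyTime.program Second) (PolyTime.program Reload) ⨾ PolyTime.program Result))

    paraRuns : ∀ x l z → ∃[ t ] paraProgram
        ⊢ x ∙ l ∙ z ⇓ recur step x l z [ t ] × t ≤ ⟦ paraBound ⟧ (size (x ∙ l ∙ z))
    paraRuns x l z =
      suc (t₁ + suc (t₂ + suc (t₃ + t₄))) , seq d₁ (seq d₂ (seq d₃ d₄)) , total
      where
        open ≤-Reasoning
        Y M b₁ b₂ : ℕ
        Y  = size (x ∙ l ∙ z)
        M  = ⟦ stateBound ⟧ Y
        b₁ = ⟦ iterationBound First Unload ⟧ M
        b₂ = ⟦ iterationBound Second Reload ⟧ M
        l≤Y : size l ≤ Y
        l≤Y = m≤n⇒m≤1+n (m≤n⇒m≤o+n (size x) (m≤n⇒m≤1+n (m≤m+n (size l) (size z))))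
        unloading≤ : size (l ∙ nil ∙ x ∙ z) ≤ M
        unloading≤ = ≤-trans (m≤n+m _ 2) (≤-trans (≤-reflexive (regroup (size l) (size x) (size z))) (m≤m+n _ _))
          where
            regroup : ∀ l x z → 2 + suc (l + suc (1 + suc (x + z))) ≡ 4 + suc (x + suc (l + z))
            regroup = solve-∀
        rev-size : 1 + size (reverseOnto l nil) ≡ suc (size l)
        rev-size = trans (size-reverseOnto l nil) (+-comm (size l) 1)
        step₁ = PolyTime.runs Start (x ∙ l ∙ z)
        step₂ = unloading l nil (x ∙ z) unloading≤
        step₃ : ∃[ t ] while (PolyTime.program Second) (PolyTime.program Reload)
                         ⊢ nil ∙ reverseOnto l nil ∙ x ∙ z ⇓ l ∙ nil ∙ x ∙ recur step x l z [ t ] ×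
                       t ≤ suc (num (reverseOnto l nil)) * b₂
        step₃ = subst (λ m → ∃[ t ] while (PolyTime.program Second) (PolyTime.program Reload)
                         ⊢ nil ∙ reverseOnto l nil ∙ x ∙ z ⇓ m ∙ nil ∙ x ∙ recur step x m z [ t ] ×
                       t ≤ suc (num (reverseOnto l nil)) * b₂)
          (trans (reverseOnto-twice l nil nil) (append-nil l))
          (reloading (reverseOnto l nil) nil x z (λ s′ l′ e → state≤ x l z s′ l′ (trans e rev-size)))
        step₄ = PolyTime.runs Result (l ∙ nil ∙ x ∙ recur step x l z)
        t₁ = proj₁ step₁
        t₂ = proj₁ step₂
        t₃ = proj₁ step₃
        t₄ = proj₁ step₄
        d₁ = proj₁ (proj₂ step₁)
        d₂ = proj₁ (proj₂ step₂)
        d₃ = proj₁ (proj₂ step₃)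
        d₄ = proj₁ (proj₂ step₄)
        t₂≤ : t₂ ≤ Y * b₁
        t₂≤ = ≤-trans (proj₂ (proj₂ step₂)) (*-monoˡ-≤ b₁ (≤-trans (num<size l) l≤Y))
        t₃≤ : t₃ ≤ Y * b₂
        t₃≤ = ≤-trans (proj₂ (proj₂ step₃)) (*-monoˡ-≤ b₂
          (≤-trans (num<size (reverseOnto l nil)) (≤-trans (≤-reflexive (suc-injective rev-size)) l≤Y)))
        t₄≤ : t₄ ≤ ⟦ result ⟧ M
        t₄≤ = ≤-trans (proj₂ (proj₂ step₄)) (⟦⟧-mono result (state≤ x l z nil l (+-comm (size l) 1)))
        regroup : ∀ a b c d → suc (a + suc (b + suc (c + d))) ≡ 3 + a + (b + c) + d
        regroup = solve-∀
        total : suc (t₁ + suc (t₂ + suc (t₃ + t₄))) ≤ ⟦ paraBound ⟧ Y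
        total = begin
          suc (t₁ + suc (t₂ + suc (t₃ + t₄))) ≡⟨ regroup t₁ t₂ t₃ t₄ ⟩
          3 + t₁ + (t₂ + t₃) + t₄
            ≤⟨ +-mono-≤ (+-mono-≤ (+-monoʳ-≤ 3 (proj₂ (proj₂ step₁))) (+-mono-≤ t₂≤ t₃≤)) t₄≤ ⟩
          ⟦ paraBound ⟧ Y ∎

  recurᵖ : ∀ {e f g} → PolyTime e → PolyTime f → PolyTime g → PolyTime (λ x → recur step (e x) (f x) (g x))
  recurᵖ {e} {f} {g} E F H =
    polytime (PolyTime.program Input ⨾ paraProgram) (con 1 ⊕ (PolyTime.bound Input ⊕ paraBound ⊚ sizeBound Input)) λ x →
      let t , d , t≤ = PolyTime.runs Input x
          u , d′ , u≤ = paraRuns (e x) (f x) (g x)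
      in suc (t + u) , seq d d′ , s≤s (+-mono-≤ t≤ (≤-trans u≤ (⟦⟧-mono paraBound (size≤ Input x))))
    where Input = E ∙ᵖ F ∙ᵖ H

  paraᵖ : ∀ {f g} → PolyTime f → PolyTime g → PolyTime (λ x → recur step x (f x) (g x))
  paraᵖ = recurᵖ idᵖ

-- Polynomial-time operations on lists and numerals

growCons : ∀ {f} → PolyTime f → Growth (λ y → f (head y ∙ head (tail y) ∙ head (tail (tail y))) ∙ tail (tail (tail y)))
growCons {f} F = growth (con 1 ⊕ sizeBound F) λ x a l r → begin
  suc (size (f (x ∙ a ∙ l)) + size r) ≡⟨ +-comm (suc (size (f (x ∙ a ∙ l)))) (size r) ⟩
  size r + suc (size (f (x ∙ a ∙ l))) ≤⟨ +-monoʳ-≤ (size r) (s≤s (size≤ F (x ∙ a ∙ l))) ⟩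
  size r + suc (⟦ sizeBound F ⟧ (size (x ∙ a ∙ l))) ∎
  where open ≤-Reasoning

size-append : ∀ l m → size (append l m) ≤ size m + size l
size-append nil     m = m≤m+n (size m) 1
size-append (a ∙ l) m = begin
  suc (size a + size (append l m)) ≤⟨ s≤s (+-monoʳ-≤ (size a) (size-append l m)) ⟩
  suc (size a + (size m + size l)) ≡⟨ swap (size a) (size m) (size l) ⟩
  size m + suc (size a + size l)   ∎
  where
    open ≤-Reasoning
    swap : ∀ a m l → suc (a + (m + l)) ≡ m + suc (a + l)
    swap = solve-∀

-- Projections from the argument x ∙ a ∙ l ∙ r of a step; lᵖ expects x ∙ a ∙ l.

xᵖ : PolyTime head
xᵖ = hdᵖ idᵖ

aᵖ : PolyTime (λ y → head (tail y))
aᵖ = hdᵖ (tlᵖ idᵖ)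

lᵖ : PolyTime (λ y → tail (tail y))
lᵖ = tlᵖ (tlᵖ idᵖ)

rᵖ : PolyTime (λ y → tail (tail (tail y)))
rᵖ = tlᵖ (tlᵖ (tlᵖ idᵖ))

weaken : Tree → Tree
weaken y = head y ∙ head (tail y) ∙ head (tail (tail y))

weakenᵖ : PolyTime weaken
weakenᵖ = xᵖ ∙ᵖ aᵖ ∙ᵖ hdᵖ lᵖ

mapᵖ : ∀ {f g} → PolyTime f → PolyTime g → PolyTime (λ x → para (λ a l r → f (x ∙ a ∙ l) ∙ r) (g x) nil)
mapᵖ F G = paraᵖ ((F ∘ᵖ weakenᵖ) ∙ᵖ rᵖ) (growCons F) G nilᵖ

appendᵖ : PolyTime (uncurry₂ append)
appendᵖ = paraᵖ (aᵖ ∙ᵖ rᵖ) (growCons aᵖ) xᵖ (tlᵖ idᵖ)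

concatMapᵖ : ∀ {f g} → PolyTime f → PolyTime g → PolyTime (λ x → para (λ a l r → append (f (x ∙ a ∙ l)) r) (g x) nil)
concatMapᵖ {f} F G = paraᵖ (appendᵖ ∘ᵖ ((F ∘ᵖ weakenᵖ) ∙ᵖ rᵖ))
  (growth (sizeBound F) λ x a l r →
    ≤-trans (size-append (f (x ∙ a ∙ l)) r) (+-monoʳ-≤ (size r) (size≤ F (x ∙ a ∙ l))))
  G nilᵖ

anyᵖ : ∀ {f g} → PolyTime f → PolyTime g → PolyTime (λ x → para (λ a l r → ifT (f (x ∙ a ∙ l)) (nil ∙ nil) r) (g x) nil)
anyᵖ {f} F G = paraᵖ (ifᵖ (F ∘ᵖ weakenᵖ) (constᵖ (nil ∙ nil)) rᵖ)
  (growth (con 3) λ x a l r → bounded (f (x ∙ a ∙ l)) r) G nilᵖ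
  where
    bounded : ∀ c r → size (ifT c (nil ∙ nil) r) ≤ size r + 3
    bounded nil     r = m≤m+n (size r) 3
    bounded (_ ∙ _) r = m≤n+m 3 (size r)

allᵖ : ∀ {f g} → PolyTime f → PolyTime g → PolyTime (λ x → para (λ a l r → ifT (f (x ∙ a ∙ l)) r nil) (g x) (nil ∙ nil))
allᵖ {f} F G = paraᵖ (ifᵖ (F ∘ᵖ weakenᵖ) rᵖ nilᵖ)
  (growth (con 1) λ x a l r → bounded (f (x ∙ a ∙ l)) r) G (constᵖ (nil ∙ nil))
  where
    bounded : ∀ c r → size (ifT c r nil) ≤ size r + 1
    bounded nil     r = m≤n+m 1 (size r)
    bounded (_ ∙ _) r = m≤m+n (size r) 1

multiply : Tree → Tree → Tree
multiply l m = para (λ _ _ r → append m r) l nil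

multiplyᵖ : PolyTime (uncurry₂ multiply)
multiplyᵖ = concatMapᵖ (tlᵖ xᵖ) xᵖ

len : Tree → Tree
len l = para (λ _ _ r → nil ∙ r) l nil

lenᵖ : PolyTime len
lenᵖ = mapᵖ nilᵖ idᵖ

member : Tree → Tree → Tree
member a l = para (λ b _ r → ifT (same a b) (nil ∙ nil) r) l nil

memberᵖ : PolyTime (uncurry₂ member)
memberᵖ = anyᵖ (sameᵖ (hdᵖ xᵖ) aᵖ) (tlᵖ idᵖ)

drop : Tree → Tree → Tree
drop l x = para (λ _ _ r → tail r) l x

dropᵖ : PolyTime (uncurry₂ drop)
dropᵖ = paraᵖ (tlᵖ rᵖ) (growth (con 0) λ x a l r → m≤n⇒m≤n+o 0 (size-tail r)) xᵖ (tlᵖ idᵖ)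

-- Incrementing may turn many digits 2 into 1, so the digits are padded to equal
-- size while counting; the head of a padded digit is the digit itself.

one two : Tree
one = (nil ∙ nil) ∙ nil
two = nil ∙ nil ∙ nil

-- Bijective base two, least significant digit first: a digit 2 becomes 1 and carries on with `r`,
-- whereas a digit 1 becomes 2 and leaves the higher digits `l` as they are.
increment : Tree → Tree
increment t = para (λ a l r → ifT (same a two) (one ∙ r) (two ∙ l)) t (one ∙ nil)

toBits : Tree → Tree
toBits l = para (λ a _ r → head a ∙ r) (para (λ _ _ r → increment r) l nil) nil

∧-true : ∀ {a b} → (a ∧ b) ≡ Bool.true → a ≡ Bool.true × b ≡ Bool.true
∧-true {Bool.true} {Bool.true} _ = refl , refl

==-sound : ∀ a b → (a == b) ≡ Bool.true → a ≡ b
==-sound nil     nil     _ = refl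
==-sound (a ∙ b) (c ∙ d) e = let p , q = ∧-true e in cong₂ _∙_ (==-sound a c p) (==-sound b d q)

==-refl : ∀ a → (a == a) ≡ Bool.true
==-refl nil     = refl
==-refl (a ∙ b) rewrite ==-refl a = ==-refl b

-- A carry replaces `two` by `one`, which has the same size; the 6 pays for one new digit and its
-- pair.
size-increment : ∀ t → size (increment t) ≤ size t + 6
size-increment nil = ≤-refl
size-increment (a ∙ l) with a == two in e
... | Bool.false = ≤-trans (≤-reflexive (+-comm 6 (size l))) (+-monoˡ-≤ 6 (m≤n⇒m≤1+n (m≤n+m (size l) (size a))))
... | Bool.true rewrite ==-sound a two e = +-monoʳ-≤ 6 (size-increment l)

incrementᵖ : PolyTime increment
incrementᵖ = paraᵖ (ifᵖ (sameᵖ aᵖ (constᵖ two)) (constᵖ one ∙ᵖ rᵖ) (constᵖ two ∙ᵖ hdᵖ lᵖ))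
  -- Where the carry stops, the step returns `l` in place of `r`, hence the summand `var`.
  (growth (con 6 ⊕ var) λ x a l r → bounded (same a two) x a l r) idᵖ (constᵖ (one ∙ nil))
  where
    bounded : ∀ c x a l r → size (ifT c (one ∙ r) (two ∙ l)) ≤ size r + (6 + size (x ∙ a ∙ l))
    bounded nil     x a l r = m≤n⇒m≤o+n (size r) (+-monoʳ-≤ 6
      (m≤n⇒m≤1+n (m≤n⇒m≤o+n (size x) (m≤n⇒m≤1+n (m≤n+m (size l) (size a))))))
    bounded (_ ∙ _) x a l r = ≤-trans (≤-reflexive (+-comm 6 (size r))) (+-monoʳ-≤ (size r) (m≤m+n 6 _))

toBitsᵖ : PolyTime toBits
toBitsᵖ = mapᵖ (hdᵖ aᵖ) (paraᵖ (incrementᵖ ∘ᵖ rᵖ) (growth (con 6) λ x a l r → size-increment r) idᵖ nilᵖ)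

slotT : Tree → Tree → Tree → Tree
slotT N j v = append (multiply j N) v

slotᵖ : PolyTime (uncurry₃ slotT)
slotᵖ = appendᵖ ∘ᵖ ((multiplyᵖ ∘ᵖ (aᵖ ∙ᵖ xᵖ)) ∙ᵖ lᵖ)

rowT : Tree → Tree → Tree → Tree
rowT N j n = para (λ _ v r → slotT N j v ∙ r) n nil

rowᵖ : PolyTime (uncurry₃ rowT)
rowᵖ = mapᵖ (slotᵖ ∘ᵖ (hdᵖ xᵖ ∙ᵖ hdᵖ (tlᵖ xᵖ) ∙ᵖ lᵖ)) lᵖ

othersT : Tree → Tree → Tree → Tree
othersT N j v = para (λ _ u r → append (ifT (same u v) nil (slotT N j u ∙ nil)) r) N nil

othersᵖ : PolyTime (uncurry₃ othersT)
othersᵖ = concatMapᵖ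
  (ifᵖ (sameᵖ lᵖ (tlᵖ (tlᵖ xᵖ))) nilᵖ ((slotᵖ ∘ᵖ (hdᵖ xᵖ ∙ᵖ hdᵖ (tlᵖ xᵖ) ∙ᵖ lᵖ)) ∙ᵖ nilᵖ)) xᵖ

addToAllT : Tree → Tree → Tree
addToAllT C B = para (λ b _ r → append C b ∙ r) B nil

addToAllᵖ : PolyTime (uncurry₂ addToAllT)
addToAllᵖ = mapᵖ (appendᵖ ∘ᵖ (hdᵖ xᵖ ∙ᵖ aᵖ)) (tlᵖ idᵖ)

productT : Tree → Tree → Tree
productT A B = para (λ a _ r → append (addToAllT a B) r) A nil

productᵖ : PolyTime (uncurry₂ productT)
productᵖ = concatMapᵖ (addToAllᵖ ∘ᵖ (aᵖ ∙ᵖ tlᵖ xᵖ)) xᵖ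

-- The reduction on trees

-- The literal `v`: some main slot picks `v`. The main slots are numbered from `o` on, after the
-- additional ones, and `e` is the pair of the slot size and the number of main slots.
positiveT : ℕ → Tree → Tree → Tree
positiveT o e v = para (λ _ i r → slotT (head e) (append (unary o) i) v ∙ r) (tail e) nil ∙ nil

positiveᵖ : ∀ o → PolyTime (uncurry₂ (positiveT o))
positiveᵖ o = mapᵖ (slotᵖ ∘ᵖ (hdᵖ (hdᵖ xᵖ) ∙ᵖ (appendᵖ ∘ᵖ (constᵖ (unary o) ∙ᵖ lᵖ)) ∙ᵖ tlᵖ xᵖ)) (tlᵖ xᵖ) ∙ᵖ nilᵖ

negativeT : ℕ → Tree → Tree → Tree
negativeT o e v = para (λ _ i r → othersT (head e) (append (unary o) i) v ∙ r) (tail e) nil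

negativeᵖ : ∀ o → PolyTime (uncurry₂ (negativeT o))
negativeᵖ o = mapᵖ (othersᵖ ∘ᵖ (hdᵖ (hdᵖ xᵖ) ∙ᵖ (appendᵖ ∘ᵖ (constᵖ (unary o) ∙ᵖ lᵖ)) ∙ᵖ tlᵖ xᵖ)) (tlᵖ xᵖ)

-- The arguments are translated by two different functions because their additional slots have to be
-- disjoint. An empty conjunction yields no clause, an empty disjunction the clause that nothing
-- hits.
smallAndT smallOrT : (C₀ C₁ : Tree → Tree → Tree → Tree) → Tree → Tree → Tree → Tree
smallAndT C₀ C₁ e gs is =
  ifT is (ifT (tail is) (append (C₀ e gs (head is)) (C₁ e gs (head (tail is)))) (C₀ e gs (head is))) nil
smallOrT C₀ C₁ e gs is =
  ifT is (ifT (tail is) (productT (C₀ e gs (head is)) (C₁ e gs (head (tail is)))) (C₀ e gs (head is))) (nil ∙ nil)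

largeAndT : (C : Tree → Tree → Tree → Tree) → Tree → Tree → Tree → Tree
largeAndT C e gs is = para (λ i _ r → append (C e gs i) r) is nil

largeOrT : ℕ → (C : Tree → Tree → Tree → Tree) → Tree → Tree → Tree → Tree
largeOrT o C e gs is =
  para (λ i _ r → slotT (head e) (unary o) i ∙ r) is nil ∙
  para (λ i _ r → append (addToAllT (othersT (head e) (unary o) i) (C e gs i)) r) is nil

module _ (C₀ C₁ : Tree → Tree → Tree → Tree) (P₀ : PolyTime (uncurry₃ C₀)) (P₁ : PolyTime (uncurry₃ C₁)) where
  private
    first : PolyTime (λ y → C₀ (head y) (head (tail y)) (head (tail (tail y))))
    first = P₀ ∘ᵖ (xᵖ ∙ᵖ aᵖ ∙ᵖ hdᵖ lᵖ)
    second : PolyTime (λ y → C₁ (head y) (head (tail y)) (head (tail (tail (tail y)))))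
    second = P₁ ∘ᵖ (xᵖ ∙ᵖ aᵖ ∙ᵖ hdᵖ (tlᵖ lᵖ))

  smallAndᵖ : PolyTime (uncurry₃ (smallAndT C₀ C₁))
  smallAndᵖ = ifᵖ lᵖ (ifᵖ (tlᵖ lᵖ) (appendᵖ ∘ᵖ (first ∙ᵖ second)) first) nilᵖ

  smallOrᵖ : PolyTime (uncurry₃ (smallOrT C₀ C₁))
  smallOrᵖ = ifᵖ lᵖ (ifᵖ (tlᵖ lᵖ) (productᵖ ∘ᵖ (first ∙ᵖ second)) first) (constᵖ (nil ∙ nil))

module _ (C : Tree → Tree → Tree → Tree) (P : PolyTime (uncurry₃ C)) where
  private
    child : PolyTime (λ y → C (head (head y)) (head (tail (head y))) (head (tail y)))
    child = P ∘ᵖ (hdᵖ xᵖ ∙ᵖ hdᵖ (tlᵖ xᵖ) ∙ᵖ aᵖ)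

  largeAndᵖ : PolyTime (uncurry₃ (largeAndT C))
  largeAndᵖ = concatMapᵖ child lᵖ

  largeOrᵖ : ∀ o → PolyTime (uncurry₃ (largeOrT o C))
  largeOrᵖ o = mapᵖ (slotᵖ ∘ᵖ (hdᵖ (hdᵖ xᵖ) ∙ᵖ constᵖ (unary o) ∙ᵖ aᵖ)) lᵖ ∙ᵖ
    concatMapᵖ (addToAllᵖ ∘ᵖ ((othersᵖ ∘ᵖ (hdᵖ (hdᵖ xᵖ) ∙ᵖ constᵖ (unary o) ∙ᵖ aᵖ)) ∙ᵖ child)) lᵖ

-- The recurrence of `2 ^ d - 1`: one slot for a large disjunction, and two blocks for the two
-- arguments of a small gate. Nothing is needed once large gates are excluded.
slots : Bool → ℕ → ℕ
slots Bool.false d       = 0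
slots Bool.true  zero    = 0
slots Bool.true  (suc d) = suc (slots Bool.true d + slots Bool.true d)

module _ (W : ℕ) where
  leafT : Bool → Tree → Tree → Tree
  leafT Bool.true  = positiveT W
  leafT Bool.false = negativeT W

  leafᵖ : ∀ b → PolyTime (uncurry₂ (leafT b))
  leafᵖ Bool.true  = positiveᵖ W
  leafᵖ Bool.false = negativeᵖ W

  -- `big` tells whether large gates may still occur, `o` is the first additional slot of the block
  -- at disposal, and `b` is the value that the node is to have. The recursion on the depth takes
  -- place outside the machine: every `d` has its own program.
  cnfT gateT andT orT : (big : Bool) (d o : ℕ) (b : Bool) → Tree → Tree → Tree → Tree
  cnfT big d o b e gs i =
    -- Gates come before inputs in the numbering: `drop i gs` is empty exactly for an input, and
    -- then `drop gs i` is the number of that input.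
    ifT (drop i gs) (gateT big d o b e (tail (drop i gs)) (head (drop i gs))) (leafT b e (drop gs i))
  gateT big zero    o b e gs g = nil
  gateT big (suc d) o b e gs g =
    ifT (head g)
      -- De Morgan: a gate that is to be false is treated as the dual gate of arguments that are to
      -- be false.
      (ifT (tail (head g)) (if b then orT big d o b e gs (tail g) else andT big d o b e gs (tail g))
                           (if b then andT big d o b e gs (tail g) else orT big d o b e gs (tail g)))
      (cnfT big d o (not b) e gs (tail g))
  andT Bool.false d o b e gs is = smallAndT (cnfT Bool.false d 0 b) (cnfT Bool.false d 0 b) e gs is
  andT Bool.true  d o b e gs is = ifT (tail (tail is))
    (largeAndT (cnfT Bool.false d 0 b) e gs is)
    (smallAndT (cnfT Bool.true d o b) (cnfT Bool.true d (o + slots Bool.true d) b) e gs is)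
  orT Bool.false d o b e gs is = smallOrT (cnfT Bool.false d 0 b) (cnfT Bool.false d 0 b) e gs is
  orT Bool.true  d o b e gs is = ifT (tail (tail is))
    (largeOrT o (cnfT Bool.false d 0 b) e gs is)
    (smallOrT (cnfT Bool.true d o b) (cnfT Bool.true d (o + slots Bool.true d) b) e gs is)

  cnfᵖ  : ∀ big d o b → PolyTime (uncurry₃ (cnfT big d o b))
  gateᵖ : ∀ big d o b → PolyTime (uncurry₃ (gateT big d o b))
  andᵖ  : ∀ big d o b → PolyTime (uncurry₃ (andT big d o b))
  orᵖ   : ∀ big d o b → PolyTime (uncurry₃ (orT big d o b))
  cnfᵖ big d o b = ifᵖ node
    (gateᵖ big d o b ∘ᵖ (xᵖ ∙ᵖ tlᵖ node ∙ᵖ hdᵖ node))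
    (leafᵖ b ∘ᵖ (xᵖ ∙ᵖ (dropᵖ ∘ᵖ (aᵖ ∙ᵖ lᵖ))))
    where node = dropᵖ ∘ᵖ (lᵖ ∙ᵖ aᵖ)
  gateᵖ big zero    o b = nilᵖ
  gateᵖ big (suc d) o Bool.true = ifᵖ (hdᵖ lᵖ)
    (ifᵖ (tlᵖ (hdᵖ lᵖ)) (orᵖ big d o Bool.true ∘ᵖ (xᵖ ∙ᵖ aᵖ ∙ᵖ tlᵖ lᵖ)) (andᵖ big d o Bool.true ∘ᵖ (xᵖ ∙ᵖ aᵖ ∙ᵖ tlᵖ lᵖ)))
    (cnfᵖ big d o Bool.false ∘ᵖ (xᵖ ∙ᵖ aᵖ ∙ᵖ tlᵖ lᵖ))
  gateᵖ big (suc d) o Bool.false = ifᵖ (hdᵖ lᵖ)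
    (ifᵖ (tlᵖ (hdᵖ lᵖ)) (andᵖ big d o Bool.false ∘ᵖ (xᵖ ∙ᵖ aᵖ ∙ᵖ tlᵖ lᵖ)) (orᵖ big d o Bool.false ∘ᵖ (xᵖ ∙ᵖ aᵖ ∙ᵖ tlᵖ lᵖ)))
    (cnfᵖ big d o Bool.true ∘ᵖ (xᵖ ∙ᵖ aᵖ ∙ᵖ tlᵖ lᵖ))
  andᵖ Bool.false d o b = smallAndᵖ (cnfT Bool.false d 0 b) (cnfT Bool.false d 0 b)
    (cnfᵖ Bool.false d 0 b) (cnfᵖ Bool.false d 0 b)
  andᵖ Bool.true  d o b = ifᵖ (tlᵖ (tlᵖ lᵖ)) (largeAndᵖ (cnfT Bool.false d 0 b) (cnfᵖ Bool.false d 0 b))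
    (smallAndᵖ (cnfT Bool.true d o b) (cnfT Bool.true d (o + slots Bool.true d) b)
      (cnfᵖ Bool.true d o b) (cnfᵖ Bool.true d (o + slots Bool.true d) b))
  orᵖ Bool.false d o b = smallOrᵖ (cnfT Bool.false d 0 b) (cnfT Bool.false d 0 b)
    (cnfᵖ Bool.false d 0 b) (cnfᵖ Bool.false d 0 b)
  orᵖ Bool.true  d o b = ifᵖ (tlᵖ (tlᵖ lᵖ)) (largeOrᵖ (cnfT Bool.false d 0 b) (cnfᵖ Bool.false d 0 b) o)
    (smallOrᵖ (cnfT Bool.true d o b) (cnfT Bool.true d (o + slots Bool.true d) b)
      (cnfᵖ Bool.true d o b) (cnfᵖ Bool.true d (o + slots Bool.true d) b))

-- For each input `v`, one of the main slots `i` and `j` picks something else. Otherwise the `k`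
-- picks could describe fewer than `k` inputs.
distinctPairT : ℕ → Tree → Tree → Tree → Tree
distinctPairT W e i j = para (λ _ v r →
  append (othersT (head e) (append (unary W) i) v) (othersT (head e) (append (unary W) j) v) ∙ r) (tail e) nil

distinctPairᵖ : ∀ W → PolyTime (uncurry₃ (distinctPairT W))
distinctPairᵖ W = mapᵖ (appendᵖ ∘ᵖ
  ((othersᵖ ∘ᵖ (hdᵖ (hdᵖ xᵖ) ∙ᵖ (appendᵖ ∘ᵖ (constᵖ (unary W) ∙ᵖ hdᵖ (tlᵖ xᵖ))) ∙ᵖ lᵖ)) ∙ᵖ
   (othersᵖ ∘ᵖ (hdᵖ (hdᵖ xᵖ) ∙ᵖ (appendᵖ ∘ᵖ (constᵖ (unary W) ∙ᵖ tlᵖ (tlᵖ xᵖ))) ∙ᵖ lᵖ)))) (tlᵖ xᵖ)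

distinctFromT : ℕ → Tree → Tree → Tree
distinctFromT W e i = para (λ _ j r → append (distinctPairT W e i j) r) i nil

distinctFromᵖ : ∀ W → PolyTime (uncurry₂ (distinctFromT W))
distinctFromᵖ W = concatMapᵖ (distinctPairᵖ W ∘ᵖ (hdᵖ xᵖ ∙ᵖ tlᵖ xᵖ ∙ᵖ lᵖ)) (tlᵖ idᵖ)

distinctT : ℕ → Tree → Tree → Tree
distinctT W e k = para (λ _ i r → append (distinctFromT W e i) r) k nil

distinctᵖ : ∀ W → PolyTime (uncurry₂ (distinctT W))
distinctᵖ W = concatMapᵖ (distinctFromᵖ W ∘ᵖ (hdᵖ xᵖ ∙ᵖ lᵖ)) (tlᵖ idᵖ)

rowsT : ℕ → Tree → Tree → Tree → Tree
rowsT o N n k = para (λ _ i r → rowT N (append (unary o) i) n ∙ r) k nil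

rowsᵖ : ∀ o → PolyTime (uncurry₃ (rowsT o))
rowsᵖ o = mapᵖ (rowᵖ ∘ᵖ (hdᵖ xᵖ ∙ᵖ (appendᵖ ∘ᵖ (constᵖ (unary o) ∙ᵖ lᵖ)) ∙ᵖ hdᵖ (tlᵖ xᵖ))) lᵖ

-- The rows make every slot pick something: a main slot one of the `n` inputs, an additional slot
-- any of its `N` elements. As there are no more picks than slots, each slot then has exactly one.
clausesT : ℕ → Tree → Tree → Tree → Tree → Tree → Tree
clausesT d N k n gs i =
  append (rowsT W N n k) (append (rowsT 0 N N (unary W)) (append (distinctT W (N ∙ n) k)
    (cnfT W Bool.true d 0 Bool.true (N ∙ k) gs i)))
  where W = slots Bool.true d

clausesᵖ : ∀ d → PolyTime (λ y → clausesT d (head y) (head (tail y)) (head (tail (tail y)))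
  (head (tail (tail (tail y)))) (tail (tail (tail (tail y)))))
clausesᵖ d = appendᵖ ∘ᵖ ((rowsᵖ W ∘ᵖ (N ∙ᵖ n ∙ᵖ k)) ∙ᵖ (appendᵖ ∘ᵖ ((rowsᵖ 0 ∘ᵖ (N ∙ᵖ N ∙ᵖ constᵖ (unary W))) ∙ᵖ
  (appendᵖ ∘ᵖ ((distinctᵖ W ∘ᵖ ((N ∙ᵖ n) ∙ᵖ k)) ∙ᵖ
    (cnfᵖ W Bool.true d 0 Bool.true ∘ᵖ ((N ∙ᵖ k) ∙ᵖ hdᵖ (tlᵖ (tlᵖ (tlᵖ idᵖ))) ∙ᵖ tlᵖ (tlᵖ (tlᵖ (tlᵖ idᵖ))))))))))
  where
    W = slots Bool.true d
    N = hdᵖ idᵖ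
    k = hdᵖ (tlᵖ idᵖ)
    n = hdᵖ (tlᵖ (tlᵖ idᵖ))

-- The state (p ∙ b) ∙ E consists of the last vertex p of the path under
-- construction, the label b of the last edge and the list E of all edges.

extendT : Tree → Tree → Tree → Tree → Tree
extendT C base t r = ifT (member t C)
  ((append base t ∙ toBits (nil ∙ t)) ∙ (head (head r) ∙ append base t ∙ toBits (nil ∙ t)) ∙ tail r) r

traceT : Tree → Tree → Tree → Tree → Tree
traceT C base T E = para (λ _ t r → extendT C base t r) T ((nil ∙ nil) ∙ E)

-- The final edge leads to vertex 1, which is `z`, and repeats the last label: the labels stay
-- sorted and no element is added to the clause.
finishT : Tree → Tree
finishT r = (head (head r) ∙ (nil ∙ nil) ∙ tail (head r)) ∙ tail r

size-head+tail : ∀ x → size (head x) + size (tail x) ≤ suc (size x)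
size-head+tail nil     = ≤-refl
size-head+tail (a ∙ b) = m≤n⇒m≤1+n (n≤1+n _)

-- The old last vertex moves into the new edge and the old edges stay in place; only `v` and `b` are
-- written twice, and they do not depend on `r`.
trace-grows : ∀ c v b r → size (ifT c ((v ∙ b) ∙ (head (head r) ∙ v ∙ b) ∙ tail r) r) ≤
  size r + (4 + (size (v ∙ b) + size (v ∙ b)))
trace-grows nil     v b r = m≤m+n (size r) _
trace-grows (_ ∙ _) v b r = begin
  suc (c + suc (suc (size (head (head r)) + c) + size (tail r)))
    ≤⟨ s≤s (+-monoʳ-≤ c (s≤s (+-monoˡ-≤ (size (tail r)) (s≤s (+-monoˡ-≤ c (size-head (head r))))))) ⟩
  suc (c + suc (suc (size (head r) + c) + size (tail r))) ≡⟨ regroup c (size (head r)) (size (tail r)) ⟩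
  size (head r) + size (tail r) + (3 + (c + c))           ≤⟨ +-monoˡ-≤ (3 + (c + c)) (size-head+tail r) ⟩
  suc (size r) + (3 + (c + c))                            ≡⟨ sym (+-suc (size r) (3 + (c + c))) ⟩
  size r + (4 + (c + c))                                  ∎
  where
    open ≤-Reasoning
    c = size (v ∙ b)
    regroup : ∀ c h t → suc (c + suc (suc (h + c) + t)) ≡ h + t + (3 + (c + c))
    regroup = solve-∀

size-finish : ∀ r → size (finishT r) ≤ size r + 8
size-finish r = begin
  suc (suc (size (head (head r)) + suc (3 + size (tail (head r)))) + size (tail r))
    ≡⟨ regroup (size (head (head r))) (size (tail (head r))) (size (tail r)) ⟩
  size (head (head r)) + size (tail (head r)) + size (tail r) + 6
    ≤⟨ +-monoˡ-≤ 6 (≤-trans (+-monoˡ-≤ (size (tail r)) (size-head+tail (head r))) (s≤s (size-head+tail r))) ⟩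
  suc (suc (size r)) + 6 ≡⟨ +-comm (2 + size r) 6 ⟩
  8 + size r ≡⟨ +-comm 8 (size r) ⟩
  size r + 8 ∎
  where
    open ≤-Reasoning
    regroup : ∀ h b t → suc (suc (h + suc (3 + b)) + t) ≡ h + b + t + 6
    regroup = solve-∀

-- The vertex of the q-th clause from the end for time t has number 2 + q T + t.
-- A label 0, which makes the instance invalid, arises only from an empty clause.

pathT : Tree → Tree → Tree → Tree → Tree
pathT C base T E = finishT (traceT C base T E)

edgesT : Tree → Tree → Tree
edgesT T F = para (λ C l E → pathT C (nil ∙ nil ∙ multiply l T) T E) F nil

private
  extend : Tree → Tree
  extend y = extendT (head (head y)) (head (tail (head y))) (head (tail (tail y))) (tail (tail (tail y)))

  extendᵖ : PolyTime extend
  extendᵖ = ifᵖ (memberᵖ ∘ᵖ (hdᵖ lᵖ ∙ᵖ hdᵖ xᵖ)) ((v ∙ᵖ b) ∙ᵖ (hdᵖ (hdᵖ rᵖ) ∙ᵖ v ∙ᵖ b) ∙ᵖ tlᵖ rᵖ) rᵖ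
    where
      v = appendᵖ ∘ᵖ (hdᵖ (tlᵖ xᵖ) ∙ᵖ hdᵖ lᵖ)
      b = toBitsᵖ ∘ᵖ (nilᵖ ∙ᵖ hdᵖ lᵖ)

  abstract
    extendGrowth : Growth extend
    extendGrowth = growth (con 4 ⊕ (sizeBound new ⊕ sizeBound new)) λ x a l r →
      ≤-trans (trace-grows (member l (head x)) (append (head (tail x)) l) (toBits (nil ∙ l)) r)
        (+-monoʳ-≤ (size r) (+-monoʳ-≤ 4 (+-mono-≤ (size≤ new (x ∙ a ∙ l)) (size≤ new (x ∙ a ∙ l)))))
      where
        new : PolyTime (λ y → append (head (tail (head y))) (tail (tail y)) ∙ toBits (nil ∙ tail (tail y)))
        new = (appendᵖ ∘ᵖ (hdᵖ (tlᵖ xᵖ) ∙ᵖ lᵖ)) ∙ᵖ (toBitsᵖ ∘ᵖ (nilᵖ ∙ᵖ lᵖ))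

  traceᵖ : PolyTime (uncurry₄ traceT)
  traceᵖ = paraᵖ extendᵖ extendGrowth (hdᵖ lᵖ) (constᵖ (nil ∙ nil) ∙ᵖ rᵖ)

  pathᵖ : PolyTime (uncurry₄ pathT)
  pathᵖ = ((hdᵖ (hdᵖ idᵖ) ∙ᵖ constᵖ (nil ∙ nil) ∙ᵖ tlᵖ (hdᵖ idᵖ)) ∙ᵖ tlᵖ idᵖ) ∘ᵖ traceᵖ

  addPath : Tree → Tree
  addPath y = pathT (head (tail y)) (nil ∙ nil ∙ multiply (head (tail (tail y))) (head y)) (head y) (tail (tail (tail y)))

  addPathᵖ : PolyTime addPath
  addPathᵖ = pathᵖ ∘ᵖ (aᵖ ∙ᵖ (nilᵖ ∙ᵖ nilᵖ ∙ᵖ (multiplyᵖ ∘ᵖ (hdᵖ lᵖ ∙ᵖ xᵖ))) ∙ᵖ xᵖ ∙ᵖ rᵖ)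

  abstract
    -- A parameter of the inner recursion with `nil` in place of the edges built so far. The step
    -- reads only the clause and the base, so its growth may be bounded at this parameter; otherwise
    -- the bound would depend on the accumulator of the outer recursion.
    context : PolyTime (λ y → (head (tail y) ∙ (nil ∙ nil ∙ multiply (tail (tail y)) (head y)) ∙ nil) ∙ head y)
    context = (aᵖ ∙ᵖ (nilᵖ ∙ᵖ nilᵖ ∙ᵖ (multiplyᵖ ∘ᵖ (lᵖ ∙ᵖ xᵖ))) ∙ᵖ nilᵖ) ∙ᵖ xᵖ

  addPathGrowth : Growth addPath
  addPathGrowth = growth (con 12 ⊕ var ⊗ Growth.amount extendGrowth ⊚ sizeBound context) λ x C l E →
    let y   = x ∙ C ∙ l
        ctx = (C ∙ (nil ∙ nil ∙ multiply l x) ∙ nil) ∙ x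
        p   = Growth.amount extendGrowth
    in begin
    size (addPath (x ∙ C ∙ l ∙ E))
      ≤⟨ size-finish (traceT C (nil ∙ nil ∙ multiply l x) x E) ⟩
    size (traceT C (nil ∙ nil ∙ multiply l x) x E) + 8
      ≤⟨ +-monoˡ-≤ 8 (size-para extendGrowth (C ∙ (nil ∙ nil ∙ multiply l x) ∙ nil) x ((nil ∙ nil) ∙ E)) ⟩
    4 + size E + size x * ⟦ p ⟧ (size ctx) + 8
      ≤⟨ +-monoˡ-≤ 8 (+-monoʳ-≤ (4 + size E) (*-mono-≤ {u = ⟦ p ⟧ (size ctx)} (m≤n⇒m≤1+n (m≤m+n (size x) _))
           (⟦⟧-mono p (size≤ context y)))) ⟩
    4 + size E + size y * ⟦ p ⟧ (⟦ sizeBound context ⟧ (size y)) + 8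
      ≡⟨ regroup (size E) (size y * ⟦ p ⟧ (⟦ sizeBound context ⟧ (size y))) ⟩
    size E + (12 + size y * ⟦ p ⟧ (⟦ sizeBound context ⟧ (size y))) ∎
    where
      open ≤-Reasoning
      regroup : ∀ e a → 4 + e + a + 8 ≡ e + (12 + a)
      regroup = solve-∀

edgesᵖ : PolyTime (uncurry₂ edgesT)
edgesᵖ = recurᵖ addPathᵖ addPathGrowth xᵖ (tlᵖ idᵖ) nilᵖ

-- Deciding whether a tree encodes a circuit of weft at most 1 and depth at most `d`

unaryT : Tree → Tree
unaryT i = para (λ a _ r → ifT (same a nil) r nil) i (nil ∙ nil)

unaryᵖ : PolyTime unaryT
unaryᵖ = allᵖ (sameᵖ aᵖ nilᵖ) idᵖ

-- A strict bound without arithmetic: `drop i m` is non-empty exactly if the spine of `i` is shorter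
-- than that of `m`. The entries of `m` do not matter.
indexT : Tree → Tree → Tree
indexT m i = ifT (unaryT i) (drop i m) nil

indexᵖ : PolyTime (uncurry₂ indexT)
indexᵖ = ifᵖ (unaryᵖ ∘ᵖ tlᵖ idᵖ) (dropᵖ ∘ᵖ (tlᵖ idᵖ ∙ᵖ xᵖ)) nilᵖ

indicesT : Tree → Tree → Tree
indicesT m is = para (λ i _ r → ifT (indexT m i) r nil) is (nil ∙ nil)

indicesᵖ : PolyTime (uncurry₂ indicesT)
indicesᵖ = allᵖ (indexᵖ ∘ᵖ (hdᵖ xᵖ ∙ᵖ aᵖ)) (tlᵖ idᵖ)

wellFormedGateT : Tree → Tree → Tree
wellFormedGateT m g = ifT g (ifT (head g)
  (ifT (same (head g) (nil ∙ nil)) (indicesT m (tail g))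
    (ifT (same (head g) (nil ∙ nil ∙ nil)) (indicesT m (tail g)) nil))
  (indexT m (tail g))) nil

wellFormedGateᵖ : PolyTime (uncurry₂ wellFormedGateT)
wellFormedGateᵖ = ifᵖ (tlᵖ idᵖ) (ifᵖ aᵖ
  (ifᵖ (sameᵖ aᵖ (constᵖ (nil ∙ nil))) (indicesᵖ ∘ᵖ (xᵖ ∙ᵖ lᵖ))
    (ifᵖ (sameᵖ aᵖ (constᵖ (nil ∙ nil ∙ nil))) (indicesᵖ ∘ᵖ (xᵖ ∙ᵖ lᵖ)) nilᵖ))
  (indexᵖ ∘ᵖ (xᵖ ∙ᵖ lᵖ))) nilᵖ

-- `append l n` has one entry for each node before the gate `g`, and so bounds the references of
-- `g`.
wellFormedT : Tree → Tree → Tree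
wellFormedT n gs = para (λ g l r → ifT (wellFormedGateT (append l n) g) r nil) gs (nil ∙ nil)

wellFormedᵖ : PolyTime (uncurry₂ wellFormedT)
wellFormedᵖ = allᵖ (wellFormedGateᵖ ∘ᵖ ((appendᵖ ∘ᵖ (lᵖ ∙ᵖ hdᵖ xᵖ)) ∙ᵖ aᵖ)) (tlᵖ idᵖ)

parseT : Tree → Tree
parseT x = ifT x (ifT (tail x) (ifT (unaryT n) (ifT (wellFormedT n gs) (indexT (append gs n) i) nil) nil) nil) nil
  where
    n  = head x
    gs = head (tail x)
    i  = tail (tail x)

parseᵖ : PolyTime parseT
parseᵖ = ifᵖ idᵖ (ifᵖ (tlᵖ idᵖ) (ifᵖ (unaryᵖ ∘ᵖ xᵖ) (ifᵖ (wellFormedᵖ ∘ᵖ (xᵖ ∙ᵖ aᵖ))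
  (indexᵖ ∘ᵖ ((appendᵖ ∘ᵖ (aᵖ ∙ᵖ xᵖ)) ∙ᵖ lᵖ)) nilᵖ) nilᵖ) nilᵖ) nilᵖ

predecessorsT : Tree → Tree
predecessorsT g = ifT (head g) (tail g) (tail g ∙ nil)

predecessorsᵖ : PolyTime predecessorsT
predecessorsᵖ = ifᵖ xᵖ (tlᵖ idᵖ) (tlᵖ idᵖ ∙ᵖ nilᵖ)

allShallowT : (Tree → Tree → Tree) → Tree → Tree → Tree
allShallowT C gs is = para (λ i _ r → ifT (C gs i) r nil) is (nil ∙ nil)

allShallowᵖ : ∀ C → PolyTime (uncurry₂ C) → PolyTime (uncurry₂ (allShallowT C))
allShallowᵖ C P = allᵖ (P ∘ᵖ (hdᵖ xᵖ ∙ᵖ aᵖ)) (tlᵖ idᵖ)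

-- `big` is the remaining weft, 1 or 0, and the number is the remaining depth; both are used up on
-- the way down, so that no depth or weft has to be computed.
shallowT shallowGateT : Bool → ℕ → Tree → Tree → Tree
shallowT big d gs i = ifT (drop i gs) (shallowGateT big d (tail (drop i gs)) (head (drop i gs))) (nil ∙ nil)
shallowGateT big        zero    gs g = nil
shallowGateT Bool.false (suc d) gs g = ifT (tail (tail (predecessorsT g))) nil
  (allShallowT (shallowT Bool.false d) gs (predecessorsT g))
shallowGateT Bool.true  (suc d) gs g = ifT (tail (tail (predecessorsT g)))
  (allShallowT (shallowT Bool.false d) gs (predecessorsT g))
  (allShallowT (shallowT Bool.true d) gs (predecessorsT g))

shallowᵖ : ∀ big d → PolyTime (uncurry₂ (shallowT big d))
shallowGateᵖ : ∀ big d → PolyTime (uncurry₂ (shallowGateT big d))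
shallowᵖ big d = ifᵖ node (shallowGateᵖ big d ∘ᵖ (tlᵖ node ∙ᵖ hdᵖ node)) (constᵖ (nil ∙ nil))
  where node = dropᵖ ∘ᵖ (tlᵖ idᵖ ∙ᵖ xᵖ)
shallowGateᵖ big        zero    = nilᵖ
shallowGateᵖ Bool.false (suc d) = ifᵖ (tlᵖ (tlᵖ is)) nilᵖ (allShallowᵖ (shallowT Bool.false d) (shallowᵖ Bool.false d) ∘ᵖ (xᵖ ∙ᵖ is))
  where is = predecessorsᵖ ∘ᵖ tlᵖ idᵖ
shallowGateᵖ Bool.true  (suc d) = ifᵖ (tlᵖ (tlᵖ is))
  (allShallowᵖ (shallowT Bool.false d) (shallowᵖ Bool.false d) ∘ᵖ (xᵖ ∙ᵖ is))
  (allShallowᵖ (shallowT Bool.true d) (shallowᵖ Bool.true d) ∘ᵖ (xᵖ ∙ᵖ is))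
  where is = predecessorsᵖ ∘ᵖ tlᵖ idᵖ

snapshotT : Tree → Tree → Tree
snapshotT T F = (nil ∙ nil ∙ multiply F T) ∙ edgesT T F ∙ nil ∙ (nil ∙ nil)

snapshotᵖ : PolyTime (uncurry₂ snapshotT)
snapshotᵖ = (nilᵖ ∙ᵖ nilᵖ ∙ᵖ (multiplyᵖ ∘ᵖ (tlᵖ idᵖ ∙ᵖ xᵖ))) ∙ᵖ edgesᵖ ∙ᵖ constᵖ (nil ∙ nil ∙ nil)

validT : ℕ → Tree → Tree
validT d x = ifT (parseT x) (shallowT Bool.true d (head (tail x)) (tail (tail x))) nil

validᵖ : ∀ d → PolyTime (validT d)
validᵖ d = ifᵖ parseᵖ (shallowᵖ Bool.true d ∘ᵖ (aᵖ ∙ᵖ lᵖ)) nilᵖ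

nodesT : Tree → Tree
nodesT x = len (append (head (tail x)) (head x))

nodesᵖ : PolyTime nodesT
nodesᵖ = lenᵖ ∘ᵖ (appendᵖ ∘ᵖ (aᵖ ∙ᵖ xᵖ))

parameterT : ℕ → Tree → Tree
parameterT d k = append (unary (slots Bool.true d)) k

parameterᵖ : ∀ d → PolyTime (parameterT d)
parameterᵖ d = appendᵖ ∘ᵖ (constᵖ (unary (slots Bool.true d)) ∙ᵖ idᵖ)

instanceFor : ℕ → Tree → Tree → Tree
instanceFor d x k =
  snapshotT (multiply (parameterT d k) (nodesT x)) (clausesT d (nodesT x) k (head x) (head (tail x)) (tail (tail x)))

instanceᵖ : ∀ d → PolyTime (uncurry₂ (instanceFor d))
instanceᵖ d = snapshotᵖ ∘ᵖ ((multiplyᵖ ∘ᵖ ((parameterᵖ d ∘ᵖ tlᵖ idᵖ) ∙ᵖ N)) ∙ᵖ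
  (clausesᵖ d ∘ᵖ (N ∙ᵖ tlᵖ idᵖ ∙ᵖ xᵖ ∘ᵖ xᵖ ∙ᵖ aᵖ ∘ᵖ xᵖ ∙ᵖ lᵖ ∘ᵖ xᵖ)))
  where N = nodesᵖ ∘ᵖ xᵖ

-- Trees that fail the test are no-instances and have to remain so: `nil` encodes no temporal graph.
reductT : ℕ → Tree → Tree → Tree
reductT d x k = ifT (validT d x) (instanceFor d x k) nil

reductᵖ : ∀ d → PolyTime (uncurry₂ (reductT d))
reductᵖ d = ifᵖ (validᵖ d ∘ᵖ xᵖ) (instanceᵖ d) nilᵖ

abstract
  reductionᵖ : ∀ d → PolyTime (λ y → uncurry₂ (reductT d) y ∙ parameterT d (tail y))
  reductionᵖ d = reductᵖ d ∙ᵖ (parameterᵖ d ∘ᵖ tlᵖ idᵖ)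

-- Composition of an fpt reduction with a polynomial-time reduction

append-unary : ∀ m n → append (unary m) (unary n) ≡ unary (m + n)
append-unary zero    n = refl
append-unary (suc m) n = cong (nil ∙_) (append-unary m n)

multiply-unary : ∀ m n → multiply (unary m) (unary n) ≡ unary (m * n)
multiply-unary zero    n = refl
multiply-unary (suc m) n = trans (cong (append (unary n)) (multiply-unary m n)) (append-unary n (m * n))

^-distribʳ-* : ∀ m n k → (m * n) ^ k ≡ m ^ k * n ^ k
^-distribʳ-* m n zero    = refl
^-distribʳ-* m n (suc k) = trans (cong (m * n *_) (^-distribʳ-* m n k)) ([m*n]*[o*p]≡[m*o]*[n*p] m n (m ^ k) (n ^ k))

-- The factor of the running time that depends on the parameter has to be computable as well; this
-- computes it in unary.
power : ℕ → Tree → Tree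
power zero    x = nil ∙ nil
power (suc D) x = multiply (nil ∙ nil ∙ x) (power D x)

powerᵖ : ∀ D → PolyTime (power D)
powerᵖ zero    = constᵖ (nil ∙ nil)
powerᵖ (suc D) = multiplyᵖ ∘ᵖ ((nilᵖ ∙ᵖ nilᵖ ∙ᵖ idᵖ) ∙ᵖ powerᵖ D)

power-unary : ∀ D n → power D (unary n) ≡ unary ((2 + n) ^ D)
power-unary zero    n = refl
power-unary (suc D) n = trans (cong (multiply (unary (2 + n))) (power-unary D n)) (multiply-unary (2 + n) ((2 + n) ^ D))

computable-∘ : (g f : ℕ → ℕ) {F : Tree → Tree} → PolyTime F → (∀ n → F (unary n) ≡ unary (g n)) → Computable f → Computable (λ n → g (f n))
computable-∘ g f P F≡ (p , runs) = p ⨾ PolyTime.program P , λ n →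
  let t , d = runs n
      u , e , _ = PolyTime.runs P (unary (f n))
  in suc (t + u) , seq d (subst (λ y → PolyTime.program P ⊢ unary (f n) ⇓ y [ u ]) (F≡ (f n)) e)

record PolynomialReduction (B C : Problem) : Set where
  field
    {function} : Tree → Tree
    polyTime   : PolyTime function
    reduct     : Tree → ℕ → Tree
    increase   : ℕ
    computes   : ∀ x k → function (x ∙ unary k) ≡ reduct x k ∙ unary (increase + k)
    correct    : ∀ x k → B x k ⇔ C (reduct x k) (increase + k)

-- The second program runs on an output of size at most `3 * t`, so the total is a polynomial in the
-- time `t` of the first. With `t` at most `f k` times a power of the input size, its bound
-- `(2 + t) ^ D` splits into a factor in `k` and a power of the input size.
≤fpt-trans : ∀ {A B C} → A ≤fpt B → PolynomialReduction B C → A ≤fpt C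
≤fpt-trans {A} {B} {C} R P = record
  { program      = R.program ⨾ P.program
  ; reduct       = λ x k → P.reduct (R.reduct x k) (R.parameter x k)
  ; parameter    = λ x k → P.increase + R.parameter x k
  ; correct      = λ x k → P.correct (R.reduct x k) (R.parameter x k) ⇔-∘ R.correct x k
  ; g            = λ k → P.increase + R.g k
  ; g-computable = computable-∘ (P.increase +_) R.g (appendᵖ ∘ᵖ (constᵖ (unary P.increase) ∙ᵖ idᵖ)) (append-unary P.increase) R.g-computable
  ; parameter≤g  = λ x k → +-monoʳ-≤ P.increase (R.parameter≤g x k)
  ; f            = λ k → (2 + R.f k) ^ D
  ; f-computable = computable-∘ (λ n → (2 + n) ^ D) R.f (powerᵖ D) (power-unary D) R.f-computable
  ; exponent     = R.exponent * D
  ; runs         = runs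
  }
  where
    module R = _≤fpt_ R
    module P where
      open PolynomialReduction P public
      open PolyTime polyTime public using (program; bound)
    total : Poly
    total = con 1 ⊕ (var ⊕ P.bound ⊚ (con 3 ⊗ var))
    D = degree total
    runs : ∀ x k → ∃[ t ] (R.program ⨾ P.program) ⊢ x ∙ unary k ⇓
             P.reduct (R.reduct x k) (R.parameter x k) ∙ unary (P.increase + R.parameter x k) [ t ] ×
           t ≤ (2 + R.f k) ^ D * size x ^ (R.exponent * D)
    runs x k =
      let t , d , t≤ = R.runs x k
          y = R.reduct x k ∙ unary (R.parameter x k)
          u , e , u≤ = PolyTime.runs P.polyTime y
          e′ = subst (λ z → P.program ⊢ y ⇓ z [ u ]) (P.computes (R.reduct x k) (R.parameter x k)) e
      in suc (t + u) , seq d e′ , time t u t≤ (≤-trans u≤ (⟦⟧-mono P.bound (size-output d)))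
      where
        open ≤-Reasoning
        S = size x ^ R.exponent
        1≤S : 1 ≤ S
        1≤S = >-nonZero⁻¹ S {{m^n≢0 (size x) R.exponent {{>-nonZero (size-pos x)}}}}
        time : ∀ t u → t ≤ R.f k * S → u ≤ ⟦ P.bound ⟧ (3 * t) →
          suc (t + u) ≤ (2 + R.f k) ^ D * size x ^ (R.exponent * D)
        time t u t≤ u≤ = begin
          suc (t + u)                ≤⟨ s≤s (+-monoʳ-≤ t u≤) ⟩
          ⟦ total ⟧ t                ≤⟨ ⟦⟧≤^degree total t ⟩
          (2 + t) ^ D                ≤⟨ ^-monoˡ-≤ D (+-mono-≤ (*-monoʳ-≤ 2 1≤S) t≤) ⟩
          (2 * S + R.f k * S) ^ D    ≡⟨ cong (_^ D) (sym (*-distribʳ-+ S 2 (R.f k))) ⟩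
          ((2 + R.f k) * S) ^ D      ≡⟨ ^-distribʳ-* (2 + R.f k) S D ⟩
          (2 + R.f k) ^ D * S ^ D    ≡⟨ cong ((2 + R.f k) ^ D *_) (^-*-assoc (size x) R.exponent D) ⟩
          (2 + R.f k) ^ D * size x ^ (R.exponent * D) ∎

-- Hitting sets and snapshot cuts

truth : Bool → Tree
truth b = if b then nil ∙ nil else nil

clause : List ℕ → Tree
clause C = list (map unary C)

family : List (List ℕ) → Tree
family F = list (map clause F)

==-unary : ∀ m n → (unary m == unary n) ≡ (m ≡ᵇ n)
==-unary zero    zero    = refl
==-unary zero    (suc n) = refl
==-unary (suc m) zero    = refl
==-unary (suc m) (suc n) = ==-unary m n

member-clause : ∀ t C → member (unary t) (clause C) ≡ truth (does (t ∈? C))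
member-clause t []      = refl
member-clause t (c ∷ C) rewrite ==-unary t c with t ≡ᵇ c
... | Bool.true  = refl
... | Bool.false = member-clause t C

padded : ℕᵇ → Tree
padded ℕᵇ.zero  = nil
padded 2[1+ b ] = two ∙ padded b
padded 1+[2 b ] = one ∙ padded b

increment-padded : ∀ b → increment (padded b) ≡ padded (ℕᵇ.suc b)
increment-padded ℕᵇ.zero  = refl
increment-padded 2[1+ b ] = cong (one ∙_) (increment-padded b)
increment-padded 1+[2 b ] = refl

heads-padded : ∀ b → para (λ a _ r → head a ∙ r) (padded b) nil ≡ bits b
heads-padded ℕᵇ.zero  = refl
heads-padded 2[1+ b ] = cong (nil ∙_) (heads-padded b)
heads-padded 1+[2 b ] = cong ((nil ∙ nil) ∙_) (heads-padded b)

count-padded : ∀ n → para (λ _ _ r → increment r) (unary n) nil ≡ padded (ℕᵇ.fromℕ' n)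
count-padded zero    = refl
count-padded (suc n) = trans (cong increment (count-padded n)) (increment-padded (ℕᵇ.fromℕ' n))

toBits-unary : ∀ n → toBits (unary n) ≡ bits (ℕᵇ.fromℕ n)
toBits-unary n = begin
  toBits (unary n)                                    ≡⟨ cong (λ l → para (λ a _ r → head a ∙ r) l nil) (count-padded n) ⟩
  para (λ a _ r → head a ∙ r) (padded (ℕᵇ.fromℕ' n)) nil ≡⟨ heads-padded (ℕᵇ.fromℕ' n) ⟩
  bits (ℕᵇ.fromℕ' n)                                  ≡⟨ cong bits (sym (fromℕ≡fromℕ' n)) ⟩
  bits (ℕᵇ.fromℕ n)                                   ∎
  where open ≡-Reasoning

Edge : Set
Edge = ℕ × ℕ × ℕ

edge : Edge → Tree
edge (u , v , t) = unary u ∙ unary v ∙ bits (ℕᵇ.fromℕ t)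

lastVertex : List ℕ → ℕ → ℕ → ℕ
lastVertex C base zero    = 0
lastVertex C base (suc t) = if does (t ∈? C) then base + t else lastVertex C base t

lastLabel : List ℕ → ℕ → ℕ
lastLabel C zero    = 0
lastLabel C (suc t) = if does (t ∈? C) then suc t else lastLabel C t

trace : List ℕ → ℕ → ℕ → List Edge → List Edge
trace C base zero    E = E
trace C base (suc t) E = if does (t ∈? C)
  then (lastVertex C base t , base + t , suc t) ∷ trace C base t E else trace C base t E

path : List ℕ → ℕ → ℕ → List Edge → List Edge
path C base T E = (lastVertex C base T , 1 , lastLabel C T) ∷ trace C base T E

firstVertex : ℕ → List (List ℕ) → ℕ
firstVertex T F = 2 + length F * T

clausePaths : ℕ → List (List ℕ) → List Edge
clausePaths T []      = []
clausePaths T (C ∷ F) = path C (firstVertex T F) T (clausePaths T F)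

trace-spec : ∀ C base T E → traceT (clause C) (unary base) (unary T) (list (map edge E)) ≡
  (unary (lastVertex C base T) ∙ bits (ℕᵇ.fromℕ (lastLabel C T))) ∙ list (map edge (trace C base T E))
trace-spec C base zero    E = refl
trace-spec C base (suc t) E rewrite trace-spec C base t E | member-clause t C with does (t ∈? C)
... | Bool.false = refl
... | Bool.true rewrite append-unary base t | toBits-unary (suc t) = refl

path-spec : ∀ C base T E → pathT (clause C) (unary base) (unary T) (list (map edge E)) ≡ list (map edge (path C base T E))
path-spec C base T E = cong finishT (trace-spec C base T E)

multiply-list : ∀ {A : Set} (f : A → Tree) xs n → multiply (list (map f xs)) (unary n) ≡ unary (length xs * n)
multiply-list f []       n = refl
multiply-list f (x ∷ xs) n = trans (cong (append (unary n)) (multiply-list f xs n)) (append-unary n (length xs * n))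

clausePaths-spec : ∀ T F → edgesT (unary T) (family F) ≡ list (map edge (clausePaths T F))
clausePaths-spec T []      = refl
clausePaths-spec T (C ∷ F) rewrite clausePaths-spec T F | multiply-list clause F T = path-spec C (firstVertex T F) T (clausePaths T F)

snapshot-spec : ∀ T F → snapshotT (unary T) (family F) ≡
  unary (firstVertex T F) ∙ list (map edge (clausePaths T F)) ∙ unary 0 ∙ unary 1
snapshot-spec T F rewrite clausePaths-spec T F | multiply-list clause F T = refl

∙-injective : ∀ {a b c d} → a ∙ b ≡ c ∙ d → a ≡ c × b ≡ d
∙-injective refl = refl , refl

unary-injective : ∀ {m n} → unary m ≡ unary n → m ≡ n
unary-injective {zero}  {zero}  _ = refl
unary-injective {suc m} {suc n} e = cong suc (unary-injective (proj₂ (∙-injective e)))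

bits-injective : ∀ {a b} → bits a ≡ bits b → a ≡ b
bits-injective {ℕᵇ.zero}  {ℕᵇ.zero}  _ = refl
bits-injective {2[1+ a ]} {2[1+ b ]} e = cong 2[1+_] (bits-injective (proj₂ (∙-injective e)))
bits-injective {1+[2 a ]} {1+[2 b ]} e = cong 1+[2_] (bits-injective (proj₂ (∙-injective e)))

binary-injective : ∀ {m n} → bits (ℕᵇ.fromℕ m) ≡ bits (ℕᵇ.fromℕ n) → m ≡ n
binary-injective {m} {n} e = trans (sym (toℕ-fromℕ m)) (trans (cong ℕᵇ.toℕ (bits-injective e)) (toℕ-fromℕ n))

list-injective : ∀ {xs ys} → list xs ≡ list ys → xs ≡ ys
list-injective {[]}     {[]}     _ = refl
list-injective {x ∷ xs} {y ∷ ys} e = let p , q = ∙-injective e in cong₂ _∷_ p (list-injective q)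

Hits : List ℕ → List ℕ → Set
Hits L C = Any (_∈ L) C

-- `L` may repeat elements or contain elements of no clause; this only wastes room.
HittingSet : ℕ → List (List ℕ) → Set
HittingSet h F = ∃[ L ] length L ≤ h × All (Hits L) F

members : ∀ {n} → Subset n → List ℕ
members Vec.[]                 = []
members (Bool.true  Vec.∷ p) = 0 ∷ map suc (members p)
members (Bool.false Vec.∷ p) = map suc (members p)

length-members : ∀ {n} (p : Subset n) → length (members p) ≡ ∣ p ∣
length-members Vec.[] = refl
length-members (Bool.true  Vec.∷ p) = cong suc (trans (length-map suc (members p)) (length-members p))
length-members (Bool.false Vec.∷ p) = trans (length-map suc (members p)) (length-members p)

∈-members : ∀ {n} {p : Subset n} {i} → i Subset.∈ p → toℕ i ∈ members p
∈-members {p = Bool.true Vec.∷ p}  Vec.here      = here refl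
∈-members {p = Bool.true Vec.∷ p}  (Vec.there i) = there (∈-map⁺ suc (∈-members i))
∈-members {p = Bool.false Vec.∷ p} (Vec.there i) = ∈-map⁺ suc (∈-members i)

lastVertex-cases : ∀ C base t → lastVertex C base t ≡ 0 ⊎ base ≤ lastVertex C base t
lastVertex-cases C base zero = inj₁ refl
lastVertex-cases C base (suc t) with does (t ∈? C)
... | Bool.true  = inj₂ (m≤m+n base t)
... | Bool.false = lastVertex-cases C base t

lastVertex≢1 : ∀ C {base} t → 2 ≤ base → lastVertex C base t ≢ 1
lastVertex≢1 C {base} t 2≤base e with lastVertex-cases C base t
... | inj₁ 0≡ = 0≢1+n (trans (sym 0≡) e)
... | inj₂ ≤l = <⇒≢ (≤-trans 2≤base ≤l) (sym e)

lastVertex< : ∀ C {base} t → 2 ≤ base → lastVertex C base t < base + t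
lastVertex< C {base} zero 2≤base = ≤-trans (<⇒≤ 2≤base) (m≤m+n base 0)
lastVertex< C {base} (suc t) 2≤base with does (t ∈? C)
... | Bool.true  = ≤-reflexive (sym (+-suc base t))
... | Bool.false = ≤-trans (lastVertex< C t 2≤base) (+-monoʳ-≤ base (n≤1+n t))

lastLabel≤ : ∀ C t → lastLabel C t ≤ t
lastLabel≤ C zero = z≤n
lastLabel≤ C (suc t) with does (t ∈? C)
... | Bool.true  = ≤-refl
... | Bool.false = m≤n⇒m≤1+n (lastLabel≤ C t)

lastLabel-cases : ∀ C t → lastLabel C t ≡ 0 ⊎ (∃[ u ] u ∈ C × lastLabel C t ≡ suc u)
lastLabel-cases C zero = inj₁ refl
lastLabel-cases C (suc t) with t ∈? C
... | yes t∈C = inj₂ (t , t∈C , refl)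
... | no _    = lastLabel-cases C t

-- From snapshot cuts to hitting sets

module _ (G : TemporalGraph) where
  open TemporalGraph G

  Realized : Edge → Set
  Realized (u , v , t) = ∃[ e ] toℕ (proj₁ (lookup ends e)) ≡ u × toℕ (proj₂ (lookup ends e)) ≡ v × time e ≡ t

  -- The cut belongs to an arbitrary temporal graph with the given encoding. As the encodings of
  -- numbers are injective, every generated edge occurs in it.
  realized : ∀ {es} → map edge es ≡ toList (Vec.zipWith edgeTree ends times) → All Realized es
  realized {es} = go es ends times
    where
      go : ∀ {m} es (as : Vec (V × V) m) ts → map edge es ≡ toList (Vec.zipWith edgeTree as ts) →
        All (λ (u , v , t) → ∃[ e ] toℕ (proj₁ (lookup as e)) ≡ u × toℕ (proj₂ (lookup as e)) ≡ v × lookup ts e ≡ t) es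
      go [] as ts _ = []
      go (x ∷ es) Vec.[] Vec.[] ()
      go (x ∷ es) ((a , b) Vec.∷ as) (t Vec.∷ ts) p≡q with ∷-injective p≡q
      ... | p , q = let p₁ , p′ = ∙-injective p
                        p₂ , p₃ = ∙-injective p′
        in (Fin.zero , sym (unary-injective p₁) , sym (unary-injective p₂) , sym (binary-injective p₃)) ∷
           All.map (λ (e , e≡) → Fin.suc e , e≡) (go es as ts q)

  module _ {s z : V} (s≡0 : toℕ s ≡ 0) {S : Subset lifetime} (cut : IsSnapshotCut s z S)
           (C : List ℕ) {base : ℕ} (2≤base : 2 ≤ base) {E₀ : List Edge} where

    private
      Labels : ∀ {x} → Walk x z → Set
      Labels w = All (λ e → time e ≡ 0 ⊎ (∃[ u ] u ∈ C × time e ≡ suc u)) (walkEdges w)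

      -- Keeps the partial path simple: apart from its first vertex and `z`, its vertices are
      -- numbered from `base + t` on, while the vertex prepended next has a smaller number.
      Later : ∀ {x} → ℕ → Walk x z → Set
      Later t w = All (λ v → toℕ v ≡ lastVertex C base t ⊎ toℕ v ≡ 1 ⊎ base + t ≤ toℕ v) (walkVertices w)

      linked-∷ : ∀ {x xs} → All (x ≤_) xs → Linked _≤_ xs → Linked _≤_ (x ∷ xs)
      linked-∷ []      _ = [-]
      linked-∷ (p ∷ _) l = p ∷ l

      -- The path of the clause is built backwards from z.
      complete : ∀ t {x} (w : Walk x z) → toℕ x ≡ lastVertex C base t → All Realized (trace C base t E₀) →
        All (λ e → lastLabel C t ≤ time e) (walkEdges w) → Labels w → Later t w → IsTemporal w → IsPath w →
        Hits (members S) C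
      complete zero w x≡ _ _ labels _ temporal isPath with refl ← toℕ-injective (trans x≡ (sym s≡0)) =
        hit (cut w temporal isPath) labels
        where
          hit : ∀ {es} → Any (ActiveIn S) es → All (λ e → time e ≡ 0 ⊎ (∃[ u ] u ∈ C × time e ≡ suc u)) es →
            Hits (members S) C
          -- A label 0 is not a timestep, so the edge that is cut carries the label of an element of
          -- the clause.
          hit (here (i , i∈S , t≡)) (inj₁ t≡0 ∷ _) = ⊥-elim (0≢1+n (trans (sym t≡0) t≡))
          hit (here (i , i∈S , t≡)) (inj₂ (u , u∈C , t≡u) ∷ _) =
            -- The element `u` has label `suc u`, which is also the timestep at position `u` of the
            -- subset.
            lose u∈C (subst (_∈ members S) (suc-injective (trans (sym t≡) t≡u)) (∈-members i∈S))
          hit (there a) (_ ∷ ls) = hit a ls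
      complete (suc t) w x≡ found labels≥ labels later temporal isPath with t ∈? C
      ... | no _ = complete t w x≡ found labels≥ labels
        (All.map (λ { (inj₁ e) → inj₁ e
                    ; (inj₂ (inj₁ e)) → inj₂ (inj₁ e)
                    ; (inj₂ (inj₂ p)) → inj₂ (inj₂ (≤-trans (+-monoʳ-≤ base (n≤1+n t)) p)) }) later)
        temporal isPath
      complete (suc t) {x} w x≡ ((e , a≡ , b≡ , t≡) ∷ found) labels≥ labels later temporal isPath | yes t∈C =
        complete t (step a e (inj₁ ends≡) w) a≡ found
          (≤-trans label≤ (≤-reflexive (sym t≡)) ∷ All.map (≤-trans label≤) labels≥)
          (inj₂ (t , t∈C , t≡) ∷ labels)
          (inj₁ a≡ ∷ All.map earlier later)
          (linked-∷ (All.map⁺ (All.map (λ p → ≤-trans (≤-reflexive t≡) p) labels≥)) temporal)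
          (All.map fresh later ∷ isPath)
        where
          a = proj₁ (lookup ends e)
          ends≡ : lookup ends e ≡ (a , x)
          ends≡ = cong (a ,_) (toℕ-injective (trans b≡ (sym x≡)))
          label≤ : lastLabel C t ≤ suc t
          label≤ = m≤n⇒m≤1+n (lastLabel≤ C t)
          a< : toℕ a < base + t
          a< = subst (_< base + t) (sym a≡) (lastVertex< C t 2≤base)
          suc≤ : ∀ {n} → base + suc t ≤ n → base + t ≤ n
          suc≤ = ≤-trans (+-monoʳ-≤ base (n≤1+n t))
          earlier : ∀ {v : V} → toℕ v ≡ base + t ⊎ toℕ v ≡ 1 ⊎ base + suc t ≤ toℕ v →
            toℕ v ≡ lastVertex C base t ⊎ toℕ v ≡ 1 ⊎ base + t ≤ toℕ v
          earlier (inj₁ p)        = inj₂ (inj₂ (≤-reflexive (sym p)))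
          earlier (inj₂ (inj₁ p)) = inj₂ (inj₁ p)
          earlier (inj₂ (inj₂ p)) = inj₂ (inj₂ (suc≤ p))
          fresh : ∀ {v : V} → toℕ v ≡ base + t ⊎ toℕ v ≡ 1 ⊎ base + suc t ≤ toℕ v → a ≢ v
          fresh (inj₁ p)        refl = <⇒≢ a< p
          fresh (inj₂ (inj₁ p)) refl = lastVertex≢1 C t 2≤base (trans (sym a≡) p)
          fresh (inj₂ (inj₂ p)) refl = <⇒≱ a< (suc≤ p)

    cut-hits : toℕ z ≡ 1 → ∀ T → All Realized (path C base T E₀) → Hits (members S) C
    cut-hits z≡1 T ((e , a≡ , b≡ , t≡) ∷ found) =
      complete T (step a e (inj₁ (cong (a ,_) (toℕ-injective (trans b≡ (sym z≡1))))) (stop z)) a≡ found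
        (≤-reflexive (sym t≡) ∷ []) (label (lastLabel-cases C T) ∷ [])
        (inj₁ a≡ ∷ inj₂ (inj₁ z≡1) ∷ [])
        [-] ((a≢z ∷ []) ∷ [] ∷ [])
      where
        a = proj₁ (lookup ends e)
        a≢z : a ≢ z
        a≢z p = lastVertex≢1 C T 2≤base (trans (sym a≡) (trans (cong toℕ p) z≡1))
        label : lastLabel C T ≡ 0 ⊎ (∃[ u ] u ∈ C × lastLabel C T ≡ suc u) →
          time e ≡ 0 ⊎ (∃[ u ] u ∈ C × time e ≡ suc u)
        label (inj₁ p)             = inj₁ (trans t≡ p)
        label (inj₂ (u , u∈C , p)) = inj₂ (u , u∈C , trans t≡ p)

trace-⊇ : ∀ C base t {E} → E ⊆ trace C base t E
trace-⊇ C base zero    e∈ = e∈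
trace-⊇ C base (suc t) e∈ with does (t ∈? C)
... | Bool.true  = there (trace-⊇ C base t e∈)
... | Bool.false = trace-⊇ C base t e∈

clausePaths-⊇ : ∀ T F → All (λ C → ∃[ base ] ∃[ E ] 2 ≤ base × path C base T E ⊆ clausePaths T F) F
clausePaths-⊇ T []      = []
clausePaths-⊇ T (C ∷ F) =
  (firstVertex T F , clausePaths T F , s≤s (s≤s z≤n) , λ e∈ → e∈) ∷
  All.map (λ (base , E , 2≤ , sub) → base , E , 2≤ , λ {_} e∈ → there (trace-⊇ C (firstVertex T F) T (sub e∈))) (clausePaths-⊇ T F)

snapshotTree : ℕ → List (List ℕ) → Tree
snapshotTree T F = unary (firstVertex T F) ∙ list (map edge (clausePaths T F)) ∙ unary 0 ∙ unary 1

snapshotCut⇒hittingSet : ∀ T F h → SnapshotCut (snapshotTree T F) h → HittingSet h F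
snapshotCut⇒hittingSet T F h (G , s , z , _ , x≡ , S , ∣S∣≤h , cut) =
  members S , ≤-trans (≤-reflexive (length-members S)) ∣S∣≤h ,
  All.map (λ {C} (base , E , 2≤base , sub) → cut-hits G (sym (unary-injective s≡)) cut C 2≤base
      (sym (unary-injective z≡)) T (All.tabulate λ e∈ → All.lookup (realized G (list-injective es≡)) (sub e∈)))
    (clausePaths-⊇ T F)
  where
    eq₂ = proj₂ (∙-injective x≡)
    es≡ = proj₁ (∙-injective eq₂)
    s≡  = proj₁ (∙-injective (proj₂ (∙-injective eq₂)))
    z≡  = proj₂ (∙-injective (proj₂ (∙-injective eq₂)))

-- The generated edges form a temporal graph

Below : ℕ → Edge → Set
Below n (u , v , t) = u < n × v < n

Proper : Edge → Set
Proper (u , v , t) = u ≢ v × 1 ≤ t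

-- More than distinct times of parallel edges: there are no parallel edges at all.
Apart : Edge → Edge → Set
Apart (u , v , _) (u′ , v′ , _) = ¬ (u ≡ u′ × v ≡ v′) × ¬ (u ≡ v′ × v ≡ u′)

module _ (C : List ℕ) {base : ℕ} (2≤base : 2 ≤ base) {E : List Edge} (below : All (Below base) E) where

  trace-below : ∀ t → All (Below (base + t)) (trace C base t E)
  trace-below zero = All.map (λ (u< , v<) → ≤-trans u< (m≤m+n base 0) , ≤-trans v< (m≤m+n base 0)) below
  trace-below (suc t) with does (t ∈? C)
  ... | Bool.true  =
    (≤-trans (lastVertex< C t 2≤base) (+-monoʳ-≤ base (n≤1+n t)) , ≤-reflexive (sym (+-suc base t))) ∷
    All.map (λ (u< , v<) → ≤-trans u< (+-monoʳ-≤ base (n≤1+n t)) , ≤-trans v< (+-monoʳ-≤ base (n≤1+n t))) (trace-below t)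
  ... | Bool.false =
    All.map (λ (u< , v<) → ≤-trans u< (+-monoʳ-≤ base (n≤1+n t)) , ≤-trans v< (+-monoʳ-≤ base (n≤1+n t))) (trace-below t)

  trace-proper : ∀ t → All Proper E → All Proper (trace C base t E)
  trace-proper zero    proper = proper
  trace-proper (suc t) proper with does (t ∈? C)
  ... | Bool.true  = (<⇒≢ (lastVertex< C t 2≤base) , s≤s z≤n) ∷ trace-proper t proper
  ... | Bool.false = trace-proper t proper

  trace-apart : ∀ t → AllPairs Apart E → AllPairs Apart (trace C base t E)
  trace-apart zero    apart = apart
  trace-apart (suc t) apart with does (t ∈? C)
  ... | Bool.true  = All.map (λ (u< , v<) → (λ (_ , p) → <⇒≢ v< (sym p)) , λ (_ , p) → <⇒≢ u< (sym p)) (trace-below t) ∷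
                     trace-apart t apart
  ... | Bool.false = trace-apart t apart

  -- Prepares the comparison with the final edge, which ends in vertex 1: earlier edges lie below
  -- `base`, and those of the present path avoid vertex 1.
  trace-origin : ∀ t → All (λ (u , v , l) → Below base (u , v , l) ⊎ (u ≢ 1 × v ≢ 1)) (trace C base t E)
  trace-origin zero = All.map inj₁ below
  trace-origin (suc t) with does (t ∈? C)
  ... | Bool.true  = inj₂ (lastVertex≢1 C t 2≤base , λ p → <⇒≢ (≤-trans 2≤base (m≤m+n base t)) (sym p)) ∷ trace-origin t
  ... | Bool.false = trace-origin t

  -- A positive label means that an element was met, so the final edge leaves from a vertex of this
  -- path and not from `s`. Two empty clauses would both yield an edge from `s` to `z`.
  hit-lastVertex : ∀ T → 1 ≤ lastLabel C T → base ≤ lastVertex C base T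
  hit-lastVertex (suc t) 1≤ with does (t ∈? C)
  ... | Bool.true  = m≤m+n base t
  ... | Bool.false = hit-lastVertex t 1≤

  path-below : ∀ T → All (Below (base + T)) (path C base T E)
  path-below T = (lastVertex< C T 2≤base , ≤-trans 2≤base (m≤m+n base T)) ∷ trace-below T

  path-proper : ∀ T → 1 ≤ lastLabel C T → All Proper E → All Proper (path C base T E)
  path-proper T 1≤ proper = (lastVertex≢1 C T 2≤base , 1≤) ∷ trace-proper T proper

  path-apart : ∀ T → 1 ≤ lastLabel C T → AllPairs Apart E → AllPairs Apart (path C base T E)
  path-apart T 1≤ apart = All.map (λ {e} → from {e}) (trace-origin T) ∷ trace-apart T apart
    where
      base≤ = hit-lastVertex T 1≤
      from : ∀ {e} → Below base e ⊎ (proj₁ e ≢ 1 × proj₁ (proj₂ e) ≢ 1) → Apart (lastVertex C base T , 1 , lastLabel C T) e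
      from (inj₁ (u< , v<)) = (λ (p , _) → <⇒≢ (≤-trans u< base≤) (sym p)) , λ (p , _) → <⇒≢ (≤-trans v< base≤) (sym p)
      from (inj₂ (u≢ , v≢)) = (λ (_ , p) → v≢ (sym p)) , λ (_ , p) → u≢ (sym p)

lastLabel-pos : ∀ {C} T → Any (_< T) C → 1 ≤ lastLabel C T
lastLabel-pos zero some<0 with Any.satisfied some<0
... | _ , ()
lastLabel-pos {C} (suc t) some< with t ∈? C
... | yes _   = s≤s z≤n
... | no t∉C = lastLabel-pos t (go some< (λ p → t∉C p))
  where
    go : ∀ {C} → Any (_< suc t) C → ¬ t ∈ C → Any (_< t) C
    go (here c<) t∉ = here (≤∧≢⇒< (≤-pred c<) (λ p → t∉ (here (sym p))))
    go (there a) t∉ = there (go a (λ p → t∉ (there p)))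

firstVertex-∷ : ∀ T C F → firstVertex T F + T ≡ firstVertex T (C ∷ F)
firstVertex-∷ T C F = cong (2 +_) (+-comm (length F * T) T)

clausePaths-below : ∀ T F → All (Below (firstVertex T F)) (clausePaths T F)
clausePaths-below T []      = []
clausePaths-below T (C ∷ F) = subst (λ n → All (Below n) (clausePaths T (C ∷ F))) (firstVertex-∷ T C F)
  (path-below C (s≤s (s≤s z≤n)) (clausePaths-below T F) T)

clausePaths-proper : ∀ T F → All (Any (_< T)) F → All Proper (clausePaths T F)
clausePaths-proper T []      []      = []
clausePaths-proper T (C ∷ F) (h ∷ hs) =
  path-proper C (s≤s (s≤s z≤n)) (clausePaths-below T F) T (lastLabel-pos T h) (clausePaths-proper T F hs)

clausePaths-apart : ∀ T F → All (Any (_< T)) F → AllPairs Apart (clausePaths T F)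
clausePaths-apart T []      []      = []
clausePaths-apart T (C ∷ F) (h ∷ hs) =
  path-apart C (s≤s (s≤s z≤n)) (clausePaths-below T F) T (lastLabel-pos T h) (clausePaths-apart T F hs)

-- From hitting sets to snapshot cuts

_[_↦_] : (ℕ → Bool) → ℕ → Bool → ℕ → Bool
(side [ n ↦ b ]) x = if x ≡ᵇ n then b else side x

≡ᵇ-refl : ∀ n → (n ≡ᵇ n) ≡ Bool.true
≡ᵇ-refl zero    = refl
≡ᵇ-refl (suc n) = ≡ᵇ-refl n

<⇒≡ᵇ-false : ∀ {m n} → m < n → (m ≡ᵇ n) ≡ Bool.false
<⇒≡ᵇ-false {zero}  (s≤s _) = refl
<⇒≡ᵇ-false {suc m} (s≤s p) = <⇒≡ᵇ-false p

update-at : ∀ side n b → (side [ n ↦ b ]) n ≡ b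
update-at side n b rewrite ≡ᵇ-refl n = refl

update-below : ∀ side {n} b {x} → x < n → (side [ n ↦ b ]) x ≡ side x
update-below side b x<n rewrite <⇒≡ᵇ-false x<n = refl

module _ (L : List ℕ) where

  Respects : (ℕ → Bool) → Edge → Set
  Respects side (u , v , l) = side u ≡ side v ⊎ (∃[ t ] t ∈ L × l ≡ suc t)

  -- A walk from 0 to 1 uses an edge between the sides true and false, so that
  -- neither temporality nor distinctness of its vertices matters for the cut.
  Separates : (ℕ → Bool) → List Edge → Set
  Separates side E = side 0 ≡ Bool.true × side 1 ≡ Bool.false × All (Respects side) E

  -- A new vertex inherits the side of its predecessor, unless the label of the edge between them is
  -- chosen; then it goes to the side `false`. This side is never left again, so the path ends there
  -- as soon as one of its elements is chosen.
  trace-separated : ∀ C {base E} → 2 ≤ base → All (Below base) E → ∀ {side} → Separates side E → ∀ t →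
    ∃[ side′ ] Separates side′ (trace C base t E) ×
      (∀ u → u < t → u ∈ C → u ∈ L → side′ (lastVertex C base t) ≡ Bool.false)
  trace-separated C 2≤base below {side} sep zero = side , sep , λ _ ()
  trace-separated C {base} {E} 2≤base below sep (suc t)
    with t ∈? C | trace-separated C 2≤base below sep t
  ... | no t∉C | side , sep′ , seen = side , sep′ ,
    λ u u<t u∈C u∈L → seen u (≤∧≢⇒< (≤-pred u<t) (λ { refl → t∉C u∈C })) u∈C u∈L
  ... | yes t∈C | side , (s0 , s1 , respects) , seen =
    side′ ,
    (trans (update-below side b (≤-trans (<⇒≤ 2≤base) (m≤m+n base t))) s0 ,
     trans (update-below side b (≤-trans 2≤base (m≤m+n base t))) s1 ,
     new ∷ All.zipWith (λ { ((u< , v<) , r) → old u< v< r }) (trace-below C 2≤base below t , respects)) ,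
    λ u u<t u∈C u∈L → trans (update-at side (base + t) b) (seen′ u u<t u∈C u∈L)
    where
      last = lastVertex C base t
      b = if does (t ∈? L) then Bool.false else side last
      side′ = side [ base + t ↦ b ]
      old : ∀ {u v l} → u < base + t → v < base + t → Respects side (u , v , l) → Respects side′ (u , v , l)
      old u< v< (inj₁ p) = inj₁ (trans (update-below side b u<) (trans p (sym (update-below side b v<))))
      old u< v< (inj₂ p) = inj₂ p
      b-cases : b ≡ side last ⊎ t ∈ L
      b-cases with t ∈? L
      ... | yes t∈L = inj₂ t∈L
      ... | no _    = inj₁ refl
      new : Respects side′ (last , base + t , suc t)
      new with b-cases
      ... | inj₁ p   = inj₁ (trans (update-below side b (lastVertex< C t 2≤base)) (trans (sym p) (sym (update-at side (base + t) b))))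
      ... | inj₂ t∈L = inj₂ (t , t∈L , refl)
      seen′ : ∀ u → u < suc t → u ∈ C → u ∈ L → b ≡ Bool.false
      seen′ u u<t u∈C u∈L with t ∈? L
      ... | yes _ = refl
      ... | no t∉L = seen u (≤∧≢⇒< (≤-pred u<t) (λ { refl → t∉L u∈L })) u∈C u∈L

  clausePaths-separated : ∀ T F → All (All (_< T)) F → All (Hits L) F → ∃[ side ] Separates side (clausePaths T F)
  -- At the beginning only `s` is on the side `true`.
  clausePaths-separated T []      []       []       = (λ x → x ≡ᵇ 0) , refl , refl , []
  clausePaths-separated T (C ∷ F) (C<T ∷ F<T) (hit ∷ hits) with clausePaths-separated T F F<T hits
  ... | _ , sep with trace-separated C {firstVertex T F} (s≤s (s≤s z≤n)) (clausePaths-below T F) sep T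
  ... | side , (s0 , s1 , respects) , seen = side , s0 , s1 , inj₁ (trans (found hit C<T (λ u∈ → u∈)) (sym s1)) ∷ respects
    where
      found : ∀ {D} → Hits L D → All (_< T) D → (∀ {u} → u ∈ D → u ∈ C) → side (lastVertex C (firstVertex T F) T) ≡ Bool.false
      found (here u∈L) (u<T ∷ _) ⊆C = seen _ u<T (⊆C (here refl)) u∈L
      found (there a)  (_ ∷ <T)  ⊆C = found a <T (λ u∈ → ⊆C (there u∈))

-- Elements from `n` on are dropped, since a hitting set may contain numbers beyond the lifetime.
fromMembers : ∀ {n} → List ℕ → Subset n
fromMembers []      = ⊥
fromMembers {n} (t ∷ L) with t <? n
... | yes t<n = ⁅ Fin.fromℕ< t<n ⁆ ∪ fromMembers L
... | no _    = fromMembers L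

∣p∪q∣≤∣p∣+∣q∣ : ∀ {n} (p q : Subset n) → ∣ p ∪ q ∣ ≤ ∣ p ∣ + ∣ q ∣
∣p∪q∣≤∣p∣+∣q∣ Vec.[] Vec.[] = z≤n
∣p∪q∣≤∣p∣+∣q∣ (Bool.false Vec.∷ p) (Bool.false Vec.∷ q) = ∣p∪q∣≤∣p∣+∣q∣ p q
∣p∪q∣≤∣p∣+∣q∣ (Bool.false Vec.∷ p) (Bool.true  Vec.∷ q) =
  ≤-trans (s≤s (∣p∪q∣≤∣p∣+∣q∣ p q)) (≤-reflexive (sym (+-suc ∣ p ∣ ∣ q ∣)))
∣p∪q∣≤∣p∣+∣q∣ (Bool.true  Vec.∷ p) (Bool.false Vec.∷ q) = s≤s (∣p∪q∣≤∣p∣+∣q∣ p q)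
∣p∪q∣≤∣p∣+∣q∣ (Bool.true  Vec.∷ p) (Bool.true  Vec.∷ q) =
  s≤s (≤-trans (∣p∪q∣≤∣p∣+∣q∣ p q) (+-monoʳ-≤ ∣ p ∣ (n≤1+n ∣ q ∣)))

∣fromMembers∣≤length : ∀ {n} L → ∣ fromMembers {n} L ∣ ≤ length L
∣fromMembers∣≤length {n} [] = ≤-reflexive (∣⊥∣≡0 n)
∣fromMembers∣≤length {n} (t ∷ L) with t <? n
... | yes t<n = ≤-trans (∣p∪q∣≤∣p∣+∣q∣ ⁅ Fin.fromℕ< t<n ⁆ (fromMembers L))
  (+-mono-≤ (≤-reflexive (∣⁅x⁆∣≡1 (Fin.fromℕ< t<n))) (∣fromMembers∣≤length L))
... | no _    = m≤n⇒m≤1+n (∣fromMembers∣≤length L)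

∈-fromMembers : ∀ {n t L} → t ∈ L → t < n → ∃[ i ] i Subset.∈ fromMembers {n} L × toℕ i ≡ t
∈-fromMembers {n} {t} {u ∷ L} t∈L t<n with u <? n
∈-fromMembers (here refl) t<n | yes u<n = Fin.fromℕ< u<n , x∈p∪q⁺ (inj₁ (x∈⁅x⁆ _)) , toℕ-fromℕ< u<n
∈-fromMembers (here refl) t<n | no u≮n  = ⊥-elim (u≮n t<n)
∈-fromMembers (there t∈)  t<n | yes u<n = let i , i∈ , i≡ = ∈-fromMembers t∈ t<n in i , x∈p∪q⁺ (inj₂ i∈) , i≡
∈-fromMembers (there t∈)  t<n | no _    = ∈-fromMembers t∈ t<n

-- A total conversion lets the vector of endpoints be an ordinary map; the bounds enter only in
-- `toℕ-clip`.
clip : ∀ n → ℕ → Fin (suc n)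
clip n       zero    = Fin.zero
clip zero    (suc u) = Fin.zero
clip (suc n) (suc u) = Fin.suc (clip n u)

toℕ-clip : ∀ {n u} → u < suc n → toℕ (clip n u) ≡ u
toℕ-clip {n}     {zero}  _       = refl
toℕ-clip {zero}  {suc u} (s≤s ())
toℕ-clip {suc n} {suc u} (s≤s p) = cong suc (toℕ-clip p)

All-lookup : ∀ {A : Set} {P : A → Set} {xs} → All P xs → ∀ i → P (lookup (fromList xs) i)
All-lookup (p ∷ ps) Fin.zero    = p
All-lookup (p ∷ ps) (Fin.suc i) = All-lookup ps i

AllPairs-lookup : ∀ {A : Set} {R : A → A → Set} {xs} → (∀ {x y} → R x y → R y x) → AllPairs R xs →
  ∀ i j → i ≢ j → R (lookup (fromList xs) i) (lookup (fromList xs) j)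
AllPairs-lookup sym-R (r ∷ rs) Fin.zero    Fin.zero    i≢j = ⊥-elim (i≢j refl)
AllPairs-lookup sym-R (r ∷ rs) Fin.zero    (Fin.suc j) _   = All-lookup r j
AllPairs-lookup sym-R (r ∷ rs) (Fin.suc i) Fin.zero    _   = sym-R (All-lookup r i)
AllPairs-lookup sym-R (r ∷ rs) (Fin.suc i) (Fin.suc j) i≢j = AllPairs-lookup sym-R rs i j (λ p → i≢j (cong Fin.suc p))

module _ (n : ℕ) (E : List Edge) (below : All (Below (suc n)) E) (proper : All Proper E) (apart : AllPairs Apart E) where
  private
    endpoints : Edge → Fin (suc n) × Fin (suc n)
    endpoints (u , v , _) = clip n u , clip n v

    label : Edge → ℕ
    label (_ , _ , t) = t

    es : Vec Edge (length E)
    es = fromList E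

  graphOf : Graph
  graphOf = record
    { order    = suc n
    ; edges    = length E
    ; ends     = Vec.map endpoints es
    ; loopless = λ e p → proj₁ (All-lookup proper e) (unclip e p)
    }
    where
      unclip : ∀ e → proj₁ (lookup (Vec.map endpoints es) e) ≡ proj₂ (lookup (Vec.map endpoints es) e) →
        proj₁ (lookup es e) ≡ proj₁ (proj₂ (lookup es e))
      unclip e p rewrite lookup-map e endpoints es =
        let u< , v< = All-lookup below e in trans (sym (toℕ-clip u<)) (trans (cong toℕ p) (toℕ-clip v<))

  open Graph graphOf using (Joins)

  joins : ∀ e {x y} → Joins e x y → let u , v , _ = lookup es e in
    (toℕ x ≡ u × toℕ y ≡ v) ⊎ (toℕ x ≡ v × toℕ y ≡ u)
  joins e j rewrite lookup-map e endpoints es with All-lookup below e | j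
  ... | u< , v< | inj₁ refl = inj₁ (toℕ-clip u< , toℕ-clip v<)
  ... | u< , v< | inj₂ refl = inj₂ (toℕ-clip v< , toℕ-clip u<)

  temporalGraphOf : TemporalGraph
  temporalGraphOf = record
    { graph    = graphOf
    ; times    = Vec.map label es
    ; positive = λ e → subst (1 ≤_) (sym (lookup-map e label es)) (proj₂ (All-lookup proper e))
    ; distinct = λ e e′ e≢e′ j j′ _ → different {lookup es e} {lookup es e′}
        (AllPairs-lookup (λ {x} {y} → Apart-sym {x} {y}) apart e e′ e≢e′) (joins e j) (joins e′ j′)
    }
    where
      Apart-sym : ∀ {e e′} → Apart e e′ → Apart e′ e
      Apart-sym (p , q) = (λ (a , b) → p (sym a , sym b)) , λ (a , b) → q (sym b , sym a)
      different : ∀ {e e′ x y} → Apart e e′ →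
        (x ≡ proj₁ e × y ≡ proj₁ (proj₂ e)) ⊎ (x ≡ proj₁ (proj₂ e) × y ≡ proj₁ e) →
        (x ≡ proj₁ e′ × y ≡ proj₁ (proj₂ e′)) ⊎ (x ≡ proj₁ (proj₂ e′) × y ≡ proj₁ e′) → Empty.⊥
      different (p , q) (inj₁ (a , b)) (inj₁ (c , d)) = p (trans (sym a) c , trans (sym b) d)
      different (p , q) (inj₁ (a , b)) (inj₂ (c , d)) = q (trans (sym a) c , trans (sym b) d)
      different (p , q) (inj₂ (a , b)) (inj₁ (c , d)) = q (trans (sym b) d , trans (sym a) c)
      different (p , q) (inj₂ (a , b)) (inj₂ (c , d)) = p (trans (sym b) d , trans (sym a) c)

  open TemporalGraph temporalGraphOf hiding (E; edges; Joins)

  edgeTrees : toList (Vec.zipWith edgeTree ends times) ≡ map edge E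
  edgeTrees = go below
    where
      go : ∀ {E} → All (Below (suc n)) E →
        toList (Vec.zipWith edgeTree (Vec.map endpoints (fromList E)) (Vec.map label (fromList E))) ≡ map edge E
      go [] = refl
      go ((u< , v<) ∷ bs) = cong₂ _∷_ (cong₂ (λ a b → unary a ∙ unary b ∙ _) (toℕ-clip u<) (toℕ-clip v<)) (go bs)

  time≤lifetime : ∀ e → time e ≤ lifetime
  time≤lifetime e = All.lookup (xs≤max 0 (toList times)) (∈-toList⁺ (∈-lookup e times))

  separated-cut : ∀ {L side} {s z : V} → toℕ s ≡ 0 → toℕ z ≡ 1 → Separates L side E →
    IsSnapshotCut s z (fromMembers L)
  separated-cut {L} {side} {s} {z} s≡0 z≡1 (s0 , s1 , respects) w _ _ =
    crossing w (trans (cong side s≡0) s0)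
    where
      active : ∀ e → (∃[ t ] t ∈ L × proj₂ (proj₂ (lookup es e)) ≡ suc t) → ActiveIn (fromMembers L) e
      active e (t , t∈L , l≡) =
        let time≡ = trans (lookup-map e label es) l≡
            i , i∈ , i≡ = ∈-fromMembers t∈L (subst (_≤ lifetime) time≡ (time≤lifetime e))
        in i , i∈ , trans time≡ (cong suc (sym i≡))
      crossing : ∀ {x} (w : Walk x z) → side (toℕ x) ≡ Bool.true → Any (ActiveIn (fromMembers L)) (walkEdges w)
      crossing (stop _) x≡ with trans (sym x≡) (trans (cong side z≡1) s1)
      ... | ()
      crossing (step x {y} e j w) x≡ with All-lookup respects e | joins e j
      ... | inj₂ a | _ = here (active e a)
      ... | inj₁ p | inj₁ (a , b) = there (crossing w (trans (trans (cong side b) (trans (sym p) (cong side (sym a)))) x≡))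
      ... | inj₁ p | inj₂ (a , b) = there (crossing w (trans (trans (cong side b) (trans p (cong side (sym a)))) x≡))

hittingSet⇒snapshotCut : ∀ T F h → All (All (_< T)) F → HittingSet h F → SnapshotCut (snapshotTree T F) h
hittingSet⇒snapshotCut T F h F<T (L , L≤h , hits) =
  temporalGraphOf _ E below proper apart , Fin.zero , Fin.suc Fin.zero , (λ ()) ,
  cong (λ es → unary (firstVertex T F) ∙ list es ∙ unary 0 ∙ unary 1) (sym (edgeTrees _ E below proper apart)) ,
  fromMembers L , ≤-trans (∣fromMembers∣≤length L) L≤h ,
  separated-cut _ E below proper apart {L} refl refl (proj₂ (clausePaths-separated L T F F<T hits))
  where
    E = clausePaths T F
    below = clausePaths-below T F
    some : ∀ {C} → All (_< T) C → Hits L C → Any (_< T) C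
    some (u<T ∷ _) (here _)  = here u<T
    some (_ ∷ C<T) (there a) = there (some C<T a)
    -- A clause that is hit is not empty, which rules out the label 0.
    F-some : All (Any (_< T)) F
    F-some = All.zipWith (λ (C<T , hit) → some C<T hit) (F<T , hits)
    proper = clausePaths-proper T F F-some
    apart = clausePaths-apart T F F-some

snapshotCut⇔hittingSet : ∀ T F h → All (All (_< T)) F → SnapshotCut (snapshotTree T F) h ⇔ HittingSet h F
snapshotCut⇔hittingSet T F h F<T = mk⇔ (snapshotCut⇒hittingSet T F h) (hittingSet⇒snapshotCut T F h F<T)

-- Circuits and hitting sets

append-list : ∀ xs ys → append (list xs) (list ys) ≡ list (xs ++ ys)
append-list []       ys = refl
append-list (x ∷ xs) ys = cong (x ∙_) (append-list xs ys)

append-clause : ∀ C D → append (clause C) (clause D) ≡ clause (C ++ D)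
append-clause C D = trans (append-list (map unary C) (map unary D)) (cong list (sym (map-++ unary C D)))

append-family : ∀ F G → append (family F) (family G) ≡ family (F ++ G)
append-family F G = trans (append-list (map clause F) (map clause G)) (cong list (sym (map-++ clause F G)))

-- Element v of slot j; each slot has N elements.
slot : ℕ → ℕ → ℕ → ℕ
slot N j v = j * N + v

slot-spec : ∀ N j v → slotT (unary N) (unary j) (unary v) ≡ unary (slot N j v)
slot-spec N j v = trans (cong (λ x → append x (unary v)) (multiply-unary j N)) (append-unary (j * N) v)

row : ℕ → ℕ → ℕ → List ℕ
row N j zero    = []
row N j (suc v) = slot N j v ∷ row N j v

row-spec : ∀ N j n → rowT (unary N) (unary j) (unary n) ≡ clause (row N j n)
row-spec N j zero    = refl
row-spec N j (suc v) = cong₂ _∙_ (slot-spec N j v) (row-spec N j v)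

othersBelow : ℕ → ℕ → ℕ → ℕ → List ℕ
othersBelow N j v zero    = []
othersBelow N j v (suc u) = (if does (u ≟ v) then [] else slot N j u ∷ []) ++ othersBelow N j v u

others : ℕ → ℕ → ℕ → List ℕ
others N j v = othersBelow N j v N

othersBelow-spec : ∀ N j v m → para (λ _ u r → append (ifT (same u (unary v)) nil (slotT (unary N) (unary j) u ∙ nil)) r) (unary m) nil ≡
  clause (othersBelow N j v m)
othersBelow-spec N j v zero    = refl
othersBelow-spec N j v (suc u) rewrite ==-unary u v | othersBelow-spec N j v u with u ≡ᵇ v
... | Bool.true  = refl
... | Bool.false = cong (_∙ clause (othersBelow N j v u)) (slot-spec N j u)

others-spec : ∀ N j v → othersT (unary N) (unary j) (unary v) ≡ clause (others N j v)
others-spec N j v = othersBelow-spec N j v N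

addToAll-spec : ∀ C B → addToAllT (clause C) (family B) ≡ family (map (C ++_) B)
addToAll-spec C []      = refl
addToAll-spec C (D ∷ B) = cong₂ _∙_ (append-clause C D) (addToAll-spec C B)

-- The distributive law: a CNF for the disjunction of two CNFs.
product : List (List ℕ) → List (List ℕ) → List (List ℕ)
product []      B = []
product (C ∷ A) B = map (C ++_) B ++ product A B

product-spec : ∀ A B → productT (family A) (family B) ≡ family (product A B)
product-spec []      B = refl
product-spec (C ∷ A) B = trans (cong₂ append (addToAll-spec C B) (product-spec A B)) (append-family (map (C ++_) B) (product A B))

positive : ℕ → ℕ → ℕ → ℕ → List ℕ
positive o N zero    v = []
positive o N (suc i) v = slot N (o + i) v ∷ positive o N i v

positive-spec : ∀ o N k v → positiveT o (unary N ∙ unary k) (unary v) ≡ family (positive o N k v ∷ [])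
positive-spec o N k v = cong (_∙ nil) (go k)
  where
    go : ∀ k → para (λ _ i r → slotT (unary N) (append (unary o) i) (unary v) ∙ r) (unary k) nil ≡ clause (positive o N k v)
    go zero    = refl
    go (suc i) = cong₂ _∙_ (trans (cong (λ j → slotT (unary N) j (unary v)) (append-unary o i)) (slot-spec N (o + i) v)) (go i)

-- The negated literal `v`: each main slot picks something else.
negative : ℕ → ℕ → ℕ → ℕ → List (List ℕ)
negative o N zero    v = []
negative o N (suc i) v = others N (o + i) v ∷ negative o N i v

negative-spec : ∀ o N k v → negativeT o (unary N ∙ unary k) (unary v) ≡ family (negative o N k v)
negative-spec o N zero    v = refl
negative-spec o N (suc i) v =
  cong₂ _∙_ (trans (cong (λ j → othersT (unary N) j (unary v)) (append-unary o i)) (others-spec N (o + i) v)) (negative-spec o N i v)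

-- A gate comes with the circuit before it, so that translations can recurse on the depth and follow
-- references directly instead of walking through the circuit.
data Node (n : ℕ) : Set where
  input : Fin n → Node n
  gate  : ∀ {m} → Circuit n m → Gate (Fin m) → Node n

node : ∀ {n m} → Circuit n m → Fin m → Node n
node inputs  i           = input i
node (c ▷ g) Fin.zero    = gate c g
node (c ▷ g) (Fin.suc i) = node c i

drop-tail : ∀ l x → drop l (tail x) ≡ tail (drop l x)
drop-tail nil     x = refl
drop-tail (a ∙ l) x = cong tail (drop-tail l x)

drop-nil : ∀ l → drop l nil ≡ nil
drop-nil nil     = refl
drop-nil (a ∙ l) = cong tail (drop-nil l)

NodeAt : ∀ {n} → Tree → Tree → Node n → Set
NodeAt gs i (input v)  = drop i gs ≡ nil × drop gs i ≡ index v
NodeAt gs i (gate c g) = drop i gs ≡ gateTree g ∙ gatesTree c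

node-at : ∀ {n m} (c : Circuit n m) i → NodeAt (gatesTree c) (index i) (node c i)
node-at inputs  i           = drop-nil (index i) , refl
node-at (c ▷ g) Fin.zero    = refl
node-at (c ▷ g) (Fin.suc i) with node c i | node-at c i
... | input v   | p , q = trans (sym (drop-tail (index i) (gatesTree (c ▷ g)))) p ,
                          trans (sym (drop-tail (gatesTree c) (index (Fin.suc i)))) q
... | gate c′ h | p     = trans (sym (drop-tail (index i) (gatesTree (c ▷ g)))) p

module _ {m : ℕ} (C₀ C₁ : Fin m → List (List ℕ)) where
  smallAnd smallOr : List (Fin m) → List (List ℕ)
  smallAnd []           = []
  smallAnd (i ∷ [])     = C₀ i
  smallAnd (i ∷ j ∷ is) = C₀ i ++ C₁ j
  smallOr []           = [] ∷ []
  smallOr (i ∷ [])     = C₀ i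
  smallOr (i ∷ j ∷ is) = product (C₀ i) (C₁ j)

module _ (N : ℕ) {m : ℕ} (C : Fin m → List (List ℕ)) where
  largeAnd : List (Fin m) → List (List ℕ)
  largeAnd []       = []
  largeAnd (i ∷ is) = C i ++ largeAnd is

  -- The implication from slot `o` picking `i` to `C i`, for each argument `i`; the negated premise
  -- is the monotone clause `others`, added to every clause of `C i`.
  witnessed : ℕ → List (Fin m) → List (List ℕ)
  witnessed o []       = []
  witnessed o (i ∷ is) = map (others N o (toℕ i) ++_) (C i) ++ witnessed o is

  -- Slot o picks an argument i, and then the clauses C i have to be hit.
  largeOr : ℕ → List (Fin m) → List (List ℕ)
  largeOr o is = map (λ i → slot N o (toℕ i)) is ∷ witnessed o is

isLarge : ∀ {A : Set} → List A → Bool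
isLarge (_ ∷ _ ∷ _ ∷ _) = Bool.true
isLarge _               = Bool.false

module _ (W N k : ℕ) where
  leaf : Bool → ℕ → List (List ℕ)
  leaf Bool.true  v = positive W N k v ∷ []
  leaf Bool.false v = negative W N k v

  cnf     : ∀ {n m} → Bool → (d o : ℕ) → Bool → Circuit n m → Fin m → List (List ℕ)
  nodeCNF : ∀ {n} → Bool → (d o : ℕ) → Bool → Node n → List (List ℕ)
  andCNF orCNF : ∀ {n m} → Bool → (d o : ℕ) → Bool → Circuit n m → List (Fin m) → List (List ℕ)

  cnf big d o b c i = nodeCNF big d o b (node c i)
  nodeCNF big d       o b (input v)            = leaf b (toℕ v)
  nodeCNF big zero    o b (gate c g)           = []
  nodeCNF big (suc d) o b (gate c (neg i))     = cnf big d o (not b) c i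
  nodeCNF big (suc d) o b (gate c (conj is))   = if b then andCNF big d o b c is else orCNF big d o b c is
  nodeCNF big (suc d) o b (gate c (disj is))   = if b then orCNF big d o b c is else andCNF big d o b c is
  andCNF Bool.false d o b c is = smallAnd (cnf Bool.false d 0 b c) (cnf Bool.false d 0 b c) is
  andCNF Bool.true  d o b c is = if isLarge is
    then largeAnd N (cnf Bool.false d 0 b c) is
    else smallAnd (cnf Bool.true d o b c) (cnf Bool.true d (o + slots Bool.true d) b c) is
  orCNF Bool.false d o b c is = smallOr (cnf Bool.false d 0 b c) (cnf Bool.false d 0 b c) is
  orCNF Bool.true  d o b c is = if isLarge is
    then largeOr N (cnf Bool.false d 0 b c) o is
    else smallOr (cnf Bool.true d o b c) (cnf Bool.true d (o + slots Bool.true d) b c) is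

  private
    e : Tree
    e = unary N ∙ unary k

  leaf-spec : ∀ b v → leafT W b e (unary v) ≡ family (leaf b v)
  leaf-spec Bool.true  v = positive-spec W N k v
  leaf-spec Bool.false v = negative-spec W N k v

  module _ {m : ℕ} (gs : Tree) where
    Computes : (Tree → Tree → Tree → Tree) → (Fin m → List (List ℕ)) → Set
    Computes T C = ∀ i → T e gs (index i) ≡ family (C i)

    smallAnd-spec : ∀ T₀ T₁ {C₀ C₁} → Computes T₀ C₀ → Computes T₁ C₁ → ∀ is →
      smallAndT T₀ T₁ e gs (list (map index is)) ≡ family (smallAnd C₀ C₁ is)
    smallAnd-spec T₀ T₁ p q []           = refl
    smallAnd-spec T₀ T₁ p q (i ∷ [])     = p i
    smallAnd-spec T₀ T₁ {C₀} {C₁} p q (i ∷ j ∷ is) = trans (cong₂ append (p i) (q j)) (append-family (C₀ i) (C₁ j))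

    smallOr-spec : ∀ T₀ T₁ {C₀ C₁} → Computes T₀ C₀ → Computes T₁ C₁ → ∀ is →
      smallOrT T₀ T₁ e gs (list (map index is)) ≡ family (smallOr C₀ C₁ is)
    smallOr-spec T₀ T₁ p q []           = refl
    smallOr-spec T₀ T₁ p q (i ∷ [])     = p i
    smallOr-spec T₀ T₁ {C₀} {C₁} p q (i ∷ j ∷ is) = trans (cong₂ productT (p i) (q j)) (product-spec (C₀ i) (C₁ j))

    largeAnd-spec : ∀ T {C} → Computes T C → ∀ is →
      largeAndT T e gs (list (map index is)) ≡ family (largeAnd N C is)
    largeAnd-spec T p [] = refl
    largeAnd-spec T {C} p (i ∷ is) =
      trans (cong₂ append (p i) (largeAnd-spec T p is)) (append-family (C i) (largeAnd N C is))

    witnessed-spec : ∀ T {C} → Computes T C → ∀ o is →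
      para (λ i _ r → append (addToAllT (othersT (unary N) (unary o) i) (T e gs i)) r) (list (map index is)) nil ≡
      family (witnessed N C o is)
    witnessed-spec T p o [] = refl
    witnessed-spec T {C} p o (i ∷ is) = trans
      (cong₂ append (trans (cong₂ addToAllT (others-spec N o (toℕ i)) (p i)) (addToAll-spec (others N o (toℕ i)) (C i)))
                    (witnessed-spec T p o is))
      (append-family (map (others N o (toℕ i) ++_) (C i)) (witnessed N C o is))

    options-spec : ∀ o (is : List (Fin m)) →
      para (λ i _ r → slotT (unary N) (unary o) i ∙ r) (list (map index is)) nil ≡
      clause (map (λ i → slot N o (toℕ i)) is)
    options-spec o []       = refl
    options-spec o (i ∷ is) = cong₂ _∙_ (slot-spec N o (toℕ i)) (options-spec o is)

    largeOr-spec : ∀ T {C} → Computes T C → ∀ o is →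
      largeOrT o T e gs (list (map index is)) ≡ family (largeOr N C o is)
    largeOr-spec T p o is = cong₂ _∙_ (options-spec o is) (witnessed-spec T p o is)

    ifLarge-spec : ∀ is {x y F G} → x ≡ family F → y ≡ family G →
      ifT (tail (tail (list (map (index {m}) is)))) x y ≡ family (if isLarge is then F else G)
    ifLarge-spec []               p q = q
    ifLarge-spec (_ ∷ [])         p q = q
    ifLarge-spec (_ ∷ _ ∷ [])     p q = q
    ifLarge-spec (_ ∷ _ ∷ _ ∷ is) p q = p

  cnf-spec : ∀ {n m} big d o b (c : Circuit n m) i →
    cnfT W big d o b e (gatesTree c) (index i) ≡ family (cnf big d o b c i)
  node-spec : ∀ {n} big d o b (x : Node n) gs i → NodeAt gs i x → cnfT W big d o b e gs i ≡ family (nodeCNF big d o b x)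
  and-spec : ∀ {n m} big d o b (c : Circuit n m) is →
    andT W big d o b e (gatesTree c) (list (map index is)) ≡ family (andCNF big d o b c is)
  or-spec : ∀ {n m} big d o b (c : Circuit n m) is →
    orT W big d o b e (gatesTree c) (list (map index is)) ≡ family (orCNF big d o b c is)

  cnf-spec big d o b c i = node-spec big d o b (node c i) (gatesTree c) (index i) (node-at c i)

  node-spec big d o b (input v) gs i (p , q) rewrite p | q = leaf-spec b (toℕ v)
  node-spec big zero o b (gate c g) gs i p rewrite p = refl
  node-spec big (suc d) o b (gate c (neg j)) gs i p rewrite p = cnf-spec big d o (not b) c j
  node-spec big (suc d) o Bool.true  (gate c (conj is)) gs i p rewrite p = and-spec big d o Bool.true c is
  node-spec big (suc d) o Bool.false (gate c (conj is)) gs i p rewrite p = or-spec big d o Bool.false c is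
  node-spec big (suc d) o Bool.true  (gate c (disj is)) gs i p rewrite p = or-spec big d o Bool.true c is
  node-spec big (suc d) o Bool.false (gate c (disj is)) gs i p rewrite p = and-spec big d o Bool.false c is

  and-spec Bool.false d o b c is = smallAnd-spec (gatesTree c) (cnfT W Bool.false d 0 b) (cnfT W Bool.false d 0 b) (cnf-spec Bool.false d 0 b c) (cnf-spec Bool.false d 0 b c) is
  and-spec Bool.true  d o b c is = ifLarge-spec (gatesTree c) is
    (largeAnd-spec (gatesTree c) (cnfT W Bool.false d 0 b) (cnf-spec Bool.false d 0 b c) is)
    (smallAnd-spec (gatesTree c) (cnfT W Bool.true d o b)
      (cnfT W Bool.true d (o + slots Bool.true d) b) (cnf-spec Bool.true d o b c) (cnf-spec Bool.true d (o + slots Bool.true d) b c) is)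

  or-spec Bool.false d o b c is = smallOr-spec (gatesTree c) (cnfT W Bool.false d 0 b) (cnfT W Bool.false d 0 b) (cnf-spec Bool.false d 0 b c) (cnf-spec Bool.false d 0 b c) is
  or-spec Bool.true  d o b c is = ifLarge-spec (gatesTree c) is
    (largeOr-spec (gatesTree c) (cnfT W Bool.false d 0 b) (cnf-spec Bool.false d 0 b c) o is)
    (smallOr-spec (gatesTree c) (cnfT W Bool.true d o b)
      (cnfT W Bool.true d (o + slots Bool.true d) b) (cnf-spec Bool.true d o b c) (cnf-spec Bool.true d (o + slots Bool.true d) b c) is)

distinctPair : ℕ → ℕ → ℕ → ℕ → ℕ → List (List ℕ)
distinctPair W N zero    i j = []
distinctPair W N (suc v) i j = (others N (W + i) v ++ others N (W + j) v) ∷ distinctPair W N v i j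

distinctFrom : ℕ → ℕ → ℕ → ℕ → ℕ → List (List ℕ)
distinctFrom W N n i zero    = []
distinctFrom W N n i (suc j) = distinctPair W N n i j ++ distinctFrom W N n i j

distinct : ℕ → ℕ → ℕ → ℕ → List (List ℕ)
distinct W N n zero    = []
distinct W N n (suc i) = distinctFrom W N n i i ++ distinct W N n i

rows : ℕ → ℕ → ℕ → ℕ → List (List ℕ)
rows o N n zero    = []
rows o N n (suc i) = row N (o + i) n ∷ rows o N n i

others-at-spec : ∀ W N i v → othersT (unary N) (append (unary W) (unary i)) (unary v) ≡ clause (others N (W + i) v)
others-at-spec W N i v = trans (cong (λ j → othersT (unary N) j (unary v)) (append-unary W i)) (others-spec N (W + i) v)

distinctPair-spec : ∀ W N n i j → distinctPairT W (unary N ∙ unary n) (unary i) (unary j) ≡ family (distinctPair W N n i j)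
distinctPair-spec W N zero    i j = refl
distinctPair-spec W N (suc v) i j = cong₂ _∙_
  (trans (cong₂ append (others-at-spec W N i v) (others-at-spec W N j v)) (append-clause (others N (W + i) v) (others N (W + j) v)))
  (distinctPair-spec W N v i j)

distinctFrom-spec : ∀ W N n i → distinctFromT W (unary N ∙ unary n) (unary i) ≡ family (distinctFrom W N n i i)
distinctFrom-spec W N n i = go i
  where
    go : ∀ j → para (λ _ j r → append (distinctPairT W (unary N ∙ unary n) (unary i) j) r) (unary j) nil ≡
               family (distinctFrom W N n i j)
    go zero    = refl
    go (suc j) = trans (cong₂ append (distinctPair-spec W N n i j) (go j)) (append-family (distinctPair W N n i j) (distinctFrom W N n i j))

distinct-spec : ∀ W N n k → distinctT W (unary N ∙ unary n) (unary k) ≡ family (distinct W N n k)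
distinct-spec W N n zero    = refl
distinct-spec W N n (suc i) =
  trans (cong₂ append (distinctFrom-spec W N n i) (distinct-spec W N n i)) (append-family (distinctFrom W N n i i) (distinct W N n i))

rows-spec : ∀ o N n k → rowsT o (unary N) (unary n) (unary k) ≡ family (rows o N n k)
rows-spec o N n zero    = refl
rows-spec o N n (suc i) =
  cong₂ _∙_ (trans (cong (λ j → rowT (unary N) j (unary n)) (append-unary o i)) (row-spec N (o + i) n)) (rows-spec o N n i)

clauses : ∀ {n m} → ℕ → ℕ → ℕ → Circuit n m → Fin m → List (List ℕ)
clauses {n} d N k c i =
  rows W N n k ++ (rows 0 N N W ++ (distinct W N n k ++ cnf W N k Bool.true d 0 Bool.true c i))
  where W = slots Bool.true d

clauses-spec : ∀ {n m} d N k (c : Circuit n m) i →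
  clausesT d (unary N) (unary k) (unary n) (gatesTree c) (index i) ≡ family (clauses d N k c i)
clauses-spec {n} d N k c i =
  trans (cong₂ append (rows-spec W N n k) (trans (cong₂ append (rows-spec 0 N N W)
    (trans (cong₂ append (distinct-spec W N n k) (cnf-spec W N k Bool.true d 0 Bool.true c i))
      (append-family (distinct W N n k) _))) (append-family (rows 0 N N W) _))) (append-family (rows W N n k) _)
  where W = slots Bool.true d

-- Values of gates and hits of clauses

and-true⁺ : ∀ {A : Set} {f : A → Bool} {xs} → All (λ x → f x ≡ Bool.true) xs → and (map f xs) ≡ Bool.true
and-true⁺ []       = refl
and-true⁺ (p ∷ ps) rewrite p = and-true⁺ ps

and-true⁻ : ∀ {A : Set} {f : A → Bool} xs → and (map f xs) ≡ Bool.true → All (λ x → f x ≡ Bool.true) xs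
and-true⁻ [] _ = []
and-true⁻ {f = f} (x ∷ xs) e with f x in fx
... | Bool.true = fx ∷ and-true⁻ xs e

and-false⁺ : ∀ {A : Set} {f : A → Bool} {xs} → Any (λ x → f x ≡ Bool.false) xs → and (map f xs) ≡ Bool.false
and-false⁺ (here p) rewrite p = refl
and-false⁺ {f = f} {x ∷ _} (there p) with f x
... | Bool.true  = and-false⁺ p
... | Bool.false = refl

and-false⁻ : ∀ {A : Set} {f : A → Bool} xs → and (map f xs) ≡ Bool.false → Any (λ x → f x ≡ Bool.false) xs
and-false⁻ {f = f} (x ∷ xs) e with f x in fx
... | Bool.true  = there (and-false⁻ xs e)
... | Bool.false = here fx

or-true⁺ : ∀ {A : Set} {f : A → Bool} {xs} → Any (λ x → f x ≡ Bool.true) xs → or (map f xs) ≡ Bool.true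
or-true⁺ (here p) rewrite p = refl
or-true⁺ {f = f} {x ∷ _} (there p) with f x
... | Bool.true  = refl
... | Bool.false = or-true⁺ p

or-true⁻ : ∀ {A : Set} {f : A → Bool} xs → or (map f xs) ≡ Bool.true → Any (λ x → f x ≡ Bool.true) xs
or-true⁻ {f = f} (x ∷ xs) e with f x in fx
... | Bool.true  = here fx
... | Bool.false = there (or-true⁻ xs e)

or-false⁺ : ∀ {A : Set} {f : A → Bool} {xs} → All (λ x → f x ≡ Bool.false) xs → or (map f xs) ≡ Bool.false
or-false⁺ []       = refl
or-false⁺ (p ∷ ps) rewrite p = or-false⁺ ps

or-false⁻ : ∀ {A : Set} {f : A → Bool} xs → or (map f xs) ≡ Bool.false → All (λ x → f x ≡ Bool.false) xs
or-false⁻ [] _ = []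
or-false⁻ {f = f} (x ∷ xs) e with f x in fx
... | Bool.false = fx ∷ or-false⁻ xs e

nodeEvaluate : ∀ {A : Set} {n} → (Gate A → A) → Vec A n → Node n → A
nodeEvaluate op as (input v)  = lookup as v
nodeEvaluate op as (gate c g) = op (mapGate (lookup (evaluate op as c)) g)

evaluate-node : ∀ {A : Set} {n m} (op : Gate A → A) as (c : Circuit n m) i →
  lookup (evaluate op as c) i ≡ nodeEvaluate op as (node c i)
evaluate-node op as inputs  i           = refl
evaluate-node op as (c ▷ g) Fin.zero    = refl
evaluate-node op as (c ▷ g) (Fin.suc i) = evaluate-node op as c i

nodeValue : ∀ {n} → Subset n → Node n → Bool
nodeValue S = nodeEvaluate boolean S

nodeSize : ∀ {n} → Node n → ℕ
nodeSize (input _)      = 0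
nodeSize (gate {m} _ _) = m

nodeSize≤ : ∀ {n m} (c : Circuit n m) i → nodeSize (node c i) ≤ m
nodeSize≤ inputs  i           = z≤n
nodeSize≤ (c ▷ g) Fin.zero    = n≤1+n _
nodeSize≤ (c ▷ g) (Fin.suc i) = m≤n⇒m≤1+n (nodeSize≤ c i)

-- Depth at most d and weft at most 1, or at most 0 if big is false.
Shallow : ∀ {n} → Bool → ℕ → Node n → Set
Shallow big d       (input v)  = ⊤
Shallow big zero    (gate c g) = Empty.⊥
Shallow big (suc d) (gate c g) = (isLarge (predecessors g) ≡ Bool.false ⊎ big ≡ Bool.true) ×
  All (λ i → Shallow (big ∧ not (isLarge (predecessors g))) d (node c i)) (predecessors g)

others⁻ : ∀ {N j v} {P : ℕ → Set} → Any P (others N j v) → ∃[ u ] u < N × u ≢ v × P (slot N j u)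
others⁻ {N} {j} {v} {P} = go N
  where
    go : ∀ m → Any P (othersBelow N j v m) → ∃[ u ] u < m × u ≢ v × P (slot N j u)
    go (suc m) a with m ≡ᵇ v in e
    go (suc m) a         | Bool.true  = let u , u<m , r = go m a in u , m≤n⇒m≤1+n u<m , r
    go (suc m) (here p)  | Bool.false = m , ≤-refl , (λ { refl → subst Bool.T e (≡⇒≡ᵇ m m refl) }) , p
    go (suc m) (there a) | Bool.false = let u , u<m , r = go m a in u , m≤n⇒m≤1+n u<m , r

others⁺ : ∀ {N j u v} → u < N → u ≢ v → slot N j u ∈ others N j v
others⁺ {N} {j} {u} {v} u<N u≢v = go N u<N
  where
    go : ∀ m → u < m → slot N j u ∈ othersBelow N j v m
    go (suc m) u<m with m ≡ᵇ v in e | u ≟ m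
    ... | Bool.true  | yes refl = ⊥-elim (u≢v (≡ᵇ⇒≡ m v (subst Bool.T (sym e) tt)))
    ... | Bool.true  | no u≢m = go m (≤∧≢⇒< (≤-pred u<m) u≢m)
    ... | Bool.false | yes refl = here refl
    ... | Bool.false | no u≢m = there (go m (≤∧≢⇒< (≤-pred u<m) u≢m))

positive⁻ : ∀ {o N} k {v} {P : ℕ → Set} → Any P (positive o N k v) → ∃[ i ] i < k × P (slot N (o + i) v)
positive⁻ (suc k) (here p)  = k , ≤-refl , p
positive⁻ (suc k) (there a) = let i , i<k , p = positive⁻ k a in i , m≤n⇒m≤1+n i<k , p

positive⁺ : ∀ {o N k v i} → i < k → slot N (o + i) v ∈ positive o N k v
positive⁺ {k = suc k} {i = i} i<k with i ≟ k
... | yes refl = here refl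
... | no i≢k   = there (positive⁺ (≤∧≢⇒< (≤-pred i<k) i≢k))

negative⁻ : ∀ {o N} k {v} {P : List ℕ → Set} → All P (negative o N k v) → ∀ {i} → i < k → P (others N (o + i) v)
negative⁻ (suc k) (p ∷ ps) {i} i<k with i ≟ k
... | yes refl = p
... | no i≢k   = negative⁻ k ps (≤∧≢⇒< (≤-pred i<k) i≢k)

negative⁺ : ∀ {o N} k {v} {P : List ℕ → Set} → (∀ {i} → i < k → P (others N (o + i) v)) → All P (negative o N k v)
negative⁺ zero    f = []
negative⁺ (suc k) f = f ≤-refl ∷ negative⁺ k (λ i<k → f (m≤n⇒m≤1+n i<k))

module _ (L : List ℕ) where
  -- If `L` misses some clause of `A`, the combinations of this clause force every clause of `B` to
  -- be hit; if it misses none, then `A` is hit.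
  product-hits⁻ : ∀ A B → All (Hits L) (product A B) → All (Hits L) A ⊎ All (Hits L) B
  product-hits⁻ []      B hits = inj₁ []
  product-hits⁻ (C ∷ A) B hits with any? (_∈? L) C | All.++⁻ (map (C ++_) B) hits
  ... | no ¬hit | hits₁ , _ = inj₂ (remaining B hits₁)
    where
      remaining : ∀ B → All (Hits L) (map (C ++_) B) → All (Hits L) B
      remaining [] [] = []
      remaining (D ∷ B) (h ∷ hs) with Any.++⁻ C h
      ... | inj₁ hit = ⊥-elim (¬hit hit)
      ... | inj₂ hit = hit ∷ remaining B hs
  ... | yes hit | _ , hits₂ with product-hits⁻ A B hits₂
  ...   | inj₁ hitsA = inj₁ (hit ∷ hitsA)
  ...   | inj₂ hitsB = inj₂ hitsB

  addToAll-hitsˡ : ∀ {C} B → Hits L C → All (Hits L) (map (C ++_) B)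
  addToAll-hitsˡ []      hit = []
  addToAll-hitsˡ (D ∷ B) hit = Any.++⁺ˡ hit ∷ addToAll-hitsˡ B hit

  addToAll-hitsʳ : ∀ C {B} → All (Hits L) B → All (Hits L) (map (C ++_) B)
  addToAll-hitsʳ C []         = []
  addToAll-hitsʳ C (hit ∷ hits) = Any.++⁺ʳ C hit ∷ addToAll-hitsʳ C hits

  product-hitsˡ : ∀ {A} B → All (Hits L) A → All (Hits L) (product A B)
  product-hitsˡ B []           = []
  product-hitsˡ B (hit ∷ hits) = All.++⁺ (addToAll-hitsˡ B hit) (product-hitsˡ B hits)

  product-hitsʳ : ∀ A {B} → All (Hits L) B → All (Hits L) (product A B)
  product-hitsʳ []      hits = []
  product-hitsʳ (C ∷ A) hits = All.++⁺ (addToAll-hitsʳ C hits) (product-hitsʳ A hits)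

-- Hit CNFs force the values of gates

slots-step : ∀ {o W} big d → o + slots big (suc d) ≤ W → o + slots big d ≤ W
slots-step Bool.false d o≤ = o≤
slots-step {o} Bool.true d o≤ = ≤-trans (+-monoʳ-≤ o (m≤n⇒m≤1+n (m≤m+n _ _))) o≤

slots-second : ∀ {o W} d → o + slots Bool.true (suc d) ≤ W → o + slots Bool.true d + slots Bool.true d ≤ W
slots-second {o} d o≤ = ≤-trans (≤-reflexive (+-assoc o _ _)) (≤-trans (+-monoʳ-≤ o (n≤1+n _)) o≤)

slots-first : ∀ {o W} d → o + slots Bool.true (suc d) ≤ W → o < W
slots-first {o} d o≤ = ≤-trans (≤-trans (≤-reflexive (+-comm 1 o)) (+-monoʳ-≤ o (s≤s z≤n))) o≤

-- All that is used of the hitting set: its main slots pick exactly the inputs in `S`, and no slot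
-- contains two elements. The latter makes a hit of `others` a negation.
module Soundness {n N k W : ℕ} (n≤N : n ≤ N) (S : Subset n) (L : List ℕ)
  (main⁺ : ∀ v {i} → i < k → slot N (W + i) (toℕ v) ∈ L → lookup S v ≡ Bool.true)
  (main⁻ : ∀ v → lookup S v ≡ Bool.true → ∃[ i ] i < k × slot N (W + i) (toℕ v) ∈ L)
  (unique : ∀ {j u v} → j < W + k → u < N → v < N → slot N j u ∈ L → slot N j v ∈ L → u ≡ v) where

  others-hit : ∀ {j v} → j < W + k → v < N → Hits L (others N j v) → ¬ slot N j v ∈ L
  others-hit {j} {v} j< v<N hit v∈L with others⁻ {N} {j} {v} hit
  ... | u , u<N , u≢v , u∈L = u≢v (unique j< u<N v<N u∈L v∈L)

  module _ {m : ℕ} {P : Fin m → Set} {C₀ C₁ : Fin m → List (List ℕ)} where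
    smallAnd-sound : ∀ {is} {Q : Fin m → Set} → isLarge is ≡ Bool.false → All Q is →
      (∀ i → Q i → All (Hits L) (C₀ i) → P i) → (∀ i → Q i → All (Hits L) (C₁ i) → P i) →
      All (Hits L) (smallAnd C₀ C₁ is) → All P is
    smallAnd-sound {[]}         _ []           f g hits = []
    smallAnd-sound {i ∷ []}     _ (q ∷ [])     f g hits = f i q hits ∷ []
    smallAnd-sound {i ∷ j ∷ []} _ (q ∷ r ∷ []) f g hits =
      let h , h′ = All.++⁻ (C₀ i) hits in f i q h ∷ g j r h′ ∷ []

    smallOr-sound : ∀ {is} {Q : Fin m → Set} → isLarge is ≡ Bool.false → All Q is →
      (∀ i → Q i → All (Hits L) (C₀ i) → P i) → (∀ i → Q i → All (Hits L) (C₁ i) → P i) →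
      All (Hits L) (smallOr C₀ C₁ is) → Any P is
    smallOr-sound {[]}         _ []           f g (() ∷ [])
    smallOr-sound {i ∷ []}     _ (q ∷ [])     f g hits = here (f i q hits)
    smallOr-sound {i ∷ j ∷ []} _ (q ∷ r ∷ []) f g hits with product-hits⁻ L (C₀ i) (C₁ j) hits
    ... | inj₁ h = here (f i q h)
    ... | inj₂ h = there (here (g j r h))

  module _ {m : ℕ} {P : Fin m → Set} {C : Fin m → List (List ℕ)} where
    largeAnd-sound : ∀ {is} {Q : Fin m → Set} → All Q is → (∀ i → Q i → All (Hits L) (C i) → P i) →
      All (Hits L) (largeAnd N C is) → All P is
    largeAnd-sound []       f hits = []
    largeAnd-sound {i ∷ is} (q ∷ qs) f hits =
      let h , h′ = All.++⁻ (C i) hits in f i q h ∷ largeAnd-sound qs f h′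

    -- The first clause makes slot `o` pick an argument `i`. The prefixes `others` of the clauses
    -- for `i` are then missed, so what remains of them is hit.
    largeOr-sound : ∀ {o is} {Q : Fin m → Set} → m ≤ N → o < W + k → All Q is →
      (∀ i → Q i → All (Hits L) (C i) → P i) → All (Hits L) (largeOr N C o is) → Any P is
    largeOr-sound {o} m≤N o< qs f (hit ∷ hits) = go qs f hit hits
      where
        unhit : ∀ i F → slot N o (toℕ i) ∈ L → All (Hits L) (map (others N o (toℕ i) ++_) F) → All (Hits L) F
        unhit i []      i∈L []       = []
        unhit i (D ∷ F) i∈L (h ∷ hs) with Any.++⁻ (others N o (toℕ i)) h
        ... | inj₁ h′ = ⊥-elim (others-hit o< (≤-trans (toℕ<n i) m≤N) h′ i∈L)
        ... | inj₂ h′ = h′ ∷ unhit i F i∈L hs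
        go : ∀ {is Q} → All Q is → (∀ i → Q i → All (Hits L) (C i) → P i) →
          Hits L (map (λ i → slot N o (toℕ i)) is) → All (Hits L) (witnessed N C o is) → Any P is
        go {i ∷ is} (q ∷ qs) f (here i∈L) hits =
          here (f i q (unhit i (C i) i∈L (proj₁ (All.++⁻ (map (others N o (toℕ i) ++_) (C i)) hits))))
        go {i ∷ is} (q ∷ qs) f (there a) hits =
          there (go qs f a (proj₂ (All.++⁻ (map (others N o (toℕ i) ++_) (C i)) hits)))

  leaf-sound : ∀ b v → All (Hits L) (leaf W N k b (toℕ v)) → lookup S v ≡ b
  leaf-sound Bool.true v (hit ∷ []) = let i , i<k , v∈L = positive⁻ k hit in main⁺ v i<k v∈L
  leaf-sound Bool.false v hits with lookup S v in e
  ... | Bool.false = refl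
  ... | Bool.true = let i , i<k , v∈L = main⁻ v e in
    ⊥-elim (others-hit (+-monoʳ-< W i<k) (≤-trans (toℕ<n v) n≤N) (negative⁻ k hits i<k) v∈L)

  cnf-sound : ∀ {m} big d o b (c : Circuit n m) i → m ≤ N → o + slots big d ≤ W → Shallow big d (node c i) →
    All (Hits L) (cnf W N k big d o b c i) → value c S i ≡ b
  node-sound : ∀ big d o b (x : Node n) → nodeSize x ≤ N → o + slots big d ≤ W → Shallow big d x →
    All (Hits L) (nodeCNF W N k big d o b x) → nodeValue S x ≡ b
  and-sound : ∀ {m} big d o b (c : Circuit n m) is → m ≤ N → o + slots big (suc d) ≤ W →
    isLarge is ≡ Bool.false ⊎ big ≡ Bool.true → All (λ i → Shallow (big ∧ not (isLarge is)) d (node c i)) is →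
    All (Hits L) (andCNF W N k big d o b c is) → All (λ i → value c S i ≡ b) is
  or-sound : ∀ {m} big d o b (c : Circuit n m) is → m ≤ N → o + slots big (suc d) ≤ W →
    isLarge is ≡ Bool.false ⊎ big ≡ Bool.true → All (λ i → Shallow (big ∧ not (isLarge is)) d (node c i)) is →
    All (Hits L) (orCNF W N k big d o b c is) → Any (λ i → value c S i ≡ b) is

  cnf-sound big d o b c i m≤N o≤ sh hits = trans (evaluate-node boolean S c i)
    (node-sound big d o b (node c i) (≤-trans (nodeSize≤ c i) m≤N) o≤ sh hits)

  node-sound big d o b (input v) _ o≤ sh hits = leaf-sound b v hits
  node-sound big (suc d) o b (gate c (neg i)) m≤N o≤ (_ , sh ∷ []) hits = trans (cong not
    (cnf-sound big d o (not b) c i m≤N (slots-step big d o≤) (subst (λ z → Shallow z d (node c i)) (Bool.∧-identityʳ big) sh) hits))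
    (Bool.not-involutive b)
  node-sound big (suc d) o Bool.true  (gate c (conj is)) m≤N o≤ (big? , sh) hits =
    and-true⁺ (and-sound big d o Bool.true c is m≤N o≤ big? sh hits)
  node-sound big (suc d) o Bool.false (gate c (conj is)) m≤N o≤ (big? , sh) hits =
    and-false⁺ (or-sound big d o Bool.false c is m≤N o≤ big? sh hits)
  node-sound big (suc d) o Bool.true  (gate c (disj is)) m≤N o≤ (big? , sh) hits =
    or-true⁺ (or-sound big d o Bool.true c is m≤N o≤ big? sh hits)
  node-sound big (suc d) o Bool.false (gate c (disj is)) m≤N o≤ (big? , sh) hits =
    or-false⁺ (and-sound big d o Bool.false c is m≤N o≤ big? sh hits)

  and-sound Bool.false d o b c is m≤N o≤ (inj₁ small) sh hits =
    smallAnd-sound small sh (λ i → cnf-sound Bool.false d 0 b c i m≤N z≤n) (λ i → cnf-sound Bool.false d 0 b c i m≤N z≤n) hits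
  and-sound Bool.true d o b c is m≤N o≤ _ sh hits with isLarge is in large
  ... | Bool.true  = largeAnd-sound sh (λ i → cnf-sound Bool.false d 0 b c i m≤N z≤n) hits
  ... | Bool.false = smallAnd-sound large sh (λ i → cnf-sound Bool.true d o b c i m≤N (slots-step Bool.true d o≤))
    (λ i → cnf-sound Bool.true d _ b c i m≤N (slots-second d o≤)) hits

  or-sound Bool.false d o b c is m≤N o≤ (inj₁ small) sh hits =
    smallOr-sound small sh (λ i → cnf-sound Bool.false d 0 b c i m≤N z≤n) (λ i → cnf-sound Bool.false d 0 b c i m≤N z≤n) hits
  or-sound Bool.true d o b c is m≤N o≤ _ sh hits with isLarge is in large
  ... | Bool.true  = largeOr-sound m≤N (m≤n⇒m≤n+o k (slots-first d o≤)) sh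
    (λ i → cnf-sound Bool.false d 0 b c i m≤N z≤n) hits
  ... | Bool.false = smallOr-sound large sh (λ i → cnf-sound Bool.true d o b c i m≤N (slots-step Bool.true d o≤))
    (λ i → cnf-sound Bool.true d _ b c i m≤N (slots-second d o≤)) hits

-- Values of gates make the CNFs hittable

chosen : ℕ → (ℕ → ℕ) → ℕ → List ℕ
chosen N a zero    = []
chosen N a (suc j) = slot N j (a j) ∷ chosen N a j

∈-chosen : ∀ {N a K j} → j < K → slot N j (a j) ∈ chosen N a K
∈-chosen {K = suc K} {j} j<K with j ≟ K
... | yes refl = here refl
... | no j≢K   = there (∈-chosen (≤∧≢⇒< (≤-pred j<K) j≢K))

module Completeness {n N k W : ℕ} (S : Subset n) (main : ℕ → ℕ) (main<N : ∀ {i} → i < k → main i < N)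
  (main⁺ : ∀ v → lookup S v ≡ Bool.true → ∃[ i ] i < k × main i ≡ toℕ v)
  (main⁻ : ∀ v {i} → i < k → main i ≡ toℕ v → lookup S v ≡ Bool.true) (1≤N : 1 ≤ N) where

  -- `w` prescribes the picks of the block of `len` slots from `o` on. All assignments that agree
  -- with it and with `main` must work, so prescriptions for disjoint blocks can be merged.
  Works : ℕ → ℕ → (ℕ → ℕ) → List (List ℕ) → Set
  Works o len w F = ∀ a → (∀ {i} → i < k → a (W + i) ≡ main i) → (∀ {j} → o ≤ j → j < o + len → a j ≡ w j) →
    All (Hits (chosen N a (W + k))) F

  Satisfiable : ℕ → ℕ → List (List ℕ) → Set
  Satisfiable o len F = ∃[ w ] (∀ j → w j < N) × Works o len w F

  satisfiable-⊆ : ∀ {o len o′ len′ F} → (∀ {j} → o ≤ j → j < o + len → o′ ≤ j × j < o′ + len′) →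
    Satisfiable o len F → Satisfiable o′ len′ F
  satisfiable-⊆ sub (w , w<N , works) = w , w<N , λ a main≡ w≡ →
    works a main≡ (λ o≤ j< → let p , q = sub o≤ j< in w≡ p q)

  satisfiable-map : ∀ {o len F G} → (∀ L → All (Hits L) F → All (Hits L) G) → Satisfiable o len F → Satisfiable o len G
  satisfiable-map f (w , w<N , works) = w , w<N , λ a main≡ w≡ → f _ (works a main≡ w≡)

  satisfiable-[] : ∀ {o len} → Satisfiable o len []
  satisfiable-[] = (λ _ → 0) , (λ _ → 1≤N) , λ _ _ _ → []

  satisfiable-++ : ∀ {o len len′ F G} → Satisfiable o len F → Satisfiable (o + len) len′ G →
    Satisfiable o (len + len′) (F ++ G)
  satisfiable-++ {o} {len} {len′} (w , w<N , works) (w′ , w′<N , works′) = both , both<N , λ a main≡ w≡ →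
    All.++⁺ (works a main≡ (λ o≤ j< → trans (w≡ o≤ (≤-trans j< (+-monoʳ-≤ o (m≤m+n len len′)))) (low j<)))
            (works′ a main≡ (λ o≤ j< → trans (w≡ (≤-trans (m≤m+n o len) o≤) (≤-trans j< (≤-reflexive (+-assoc o len len′)))) (high o≤)))
    where
      both : ℕ → ℕ
      both j with j <? o + len
      ... | yes _ = w j
      ... | no _  = w′ j
      both<N : ∀ j → both j < N
      both<N j with j <? o + len
      ... | yes _ = w<N j
      ... | no _  = w′<N j
      low : ∀ {j} → j < o + len → both j ≡ w j
      low {j} j< with j <? o + len
      ... | yes _ = refl
      ... | no ≮  = ⊥-elim (≮ j<)
      high : ∀ {j} → o + len ≤ j → both j ≡ w′ j
      high {j} ≤j with j <? o + len
      ... | yes j< = ⊥-elim (<⇒≱ j< ≤j)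
      ... | no _   = refl

  -- The main slots alone decide. This holds for the arguments of a large gate, below which no slot
  -- is guessed.
  Free : List (List ℕ) → Set
  Free F = ∀ a → (∀ {i} → i < k → a (W + i) ≡ main i) → All (Hits (chosen N a (W + k))) F

  free : ∀ {o F} → Satisfiable o 0 F → Free F
  free {o} (w , _ , works) a main≡ = works a main≡
    (λ o≤ j< → ⊥-elim (<⇒≱ j< (≤-trans (≤-reflexive (+-identityʳ o)) o≤)))

  free-satisfiable : ∀ {o len F} → Free F → Satisfiable o len F
  free-satisfiable f = (λ _ → 0) , (λ _ → 1≤N) , λ a main≡ _ → f a main≡

  module _ {m o len : ℕ} {C₀ C₁ : Fin m → List (List ℕ)} where
    smallAnd-complete : ∀ {is} → isLarge is ≡ Bool.false → All (λ i → Satisfiable o len (C₀ i)) is →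
      All (λ i → Satisfiable (o + len) len (C₁ i)) is → Satisfiable o (len + len) (smallAnd C₀ C₁ is)
    smallAnd-complete {[]}         _ [] [] = satisfiable-[]
    smallAnd-complete {i ∷ []}     _ (p ∷ []) _ =
      satisfiable-⊆ (λ o≤ j< → o≤ , ≤-trans j< (+-monoʳ-≤ o (m≤m+n len len))) p
    smallAnd-complete {i ∷ j ∷ []} _ (p ∷ _) (_ ∷ q ∷ []) = satisfiable-++ p q

    smallOr-complete : ∀ {is} → isLarge is ≡ Bool.false →
      Any (λ i → Satisfiable o len (C₀ i) × Satisfiable (o + len) len (C₁ i)) is →
      Satisfiable o (len + len) (smallOr C₀ C₁ is)
    smallOr-complete {i ∷ []} _ (here (p , _)) =
      satisfiable-⊆ (λ o≤ j< → o≤ , ≤-trans j< (+-monoʳ-≤ o (m≤m+n len len))) p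
    smallOr-complete {i ∷ j ∷ []} _ (here (p , _)) =
      satisfiable-⊆ (λ o≤ j< → o≤ , ≤-trans j< (+-monoʳ-≤ o (m≤m+n len len)))
        (satisfiable-map (λ L → product-hitsˡ L (C₁ j)) p)
    smallOr-complete {i ∷ j ∷ []} _ (there (here (_ , q))) =
      satisfiable-⊆ (λ o≤ j< → ≤-trans (m≤m+n o len) o≤ , ≤-trans j< (≤-reflexive (+-assoc o len len)))
        (satisfiable-map (λ L → product-hitsʳ L (C₀ i)) q)

  module _ {m : ℕ} {C : Fin m → List (List ℕ)} where
    largeAnd-complete : ∀ {is} → All (λ i → Free (C i)) is → Free (largeAnd N C is)
    largeAnd-complete []       a main≡ = []
    largeAnd-complete (p ∷ ps) a main≡ = All.++⁺ (p a main≡) (largeAnd-complete ps a main≡)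

    -- Slot `o` picks an argument `p` that has the wanted value. The clauses for `p` are hit by
    -- assumption, those for another argument by `p` itself, which occurs in their prefix `others`.
    largeOr-complete : ∀ {o len is} → m ≤ N → o < W + k → Any (λ i → Free (C i)) is →
      Satisfiable o (suc len) (largeOr N C o is)
    largeOr-complete {o} {len} {is} m≤N o< some with find some
    ... | p , p∈is , freeC = (λ _ → toℕ p) , (λ _ → p<N) , works
      where
        p<N : toℕ p < N
        p<N = ≤-trans (toℕ<n p) m≤N
        works : Works o (suc len) (λ _ → toℕ p) (largeOr N C o is)
        works a main≡ w≡ = lose (∈-map⁺ (λ i → slot N o (toℕ i)) p∈is) p∈L ∷ all-witnessed is
          where
            p∈L : slot N o (toℕ p) ∈ chosen N a (W + k)
            p∈L = subst (λ u → slot N o u ∈ chosen N a (W + k))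
              (w≡ ≤-refl (≤-trans (≤-reflexive (+-comm 1 o)) (+-monoʳ-≤ o (s≤s z≤n)))) (∈-chosen o<)
            all-witnessed : ∀ is → All (Hits (chosen N a (W + k))) (witnessed N C o is)
            all-witnessed [] = []
            all-witnessed (i ∷ is) with i Fin.≟ p
            ... | yes refl = All.++⁺ (addToAll-hitsʳ _ (others N o (toℕ i)) (freeC a main≡)) (all-witnessed is)
            ... | no i≢p = All.++⁺ (addToAll-hitsˡ _ (C i)
              (lose (others⁺ p<N (λ e → i≢p (toℕ-injective (sym e)))) p∈L)) (all-witnessed is)

  leaf-complete : ∀ b v → lookup S v ≡ b → Free (leaf W N k b (toℕ v))
  leaf-complete Bool.true v e a main≡ with main⁺ v e
  ... | i , i<k , p = lose {P = _∈ _} (positive⁺ i<k)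
    (subst (λ u → slot N (W + i) u ∈ chosen N a (W + k)) (trans (main≡ i<k) p) (∈-chosen (+-monoʳ-< W i<k))) ∷ []
  leaf-complete Bool.false v e a main≡ = negative⁺ k λ {i} i<k →
    lose (others⁺ (subst (_< N) (sym (main≡ i<k)) (main<N i<k))
                  (λ p → true≢false (trans (sym (main⁻ v i<k (trans (sym (main≡ i<k)) p))) e)))
         (∈-chosen (+-monoʳ-< W i<k))
    where
      true≢false : Bool.true ≢ Bool.false
      true≢false ()

  satisfiable-suc : ∀ {o len F} → Satisfiable o len F → Satisfiable o (suc len) F
  satisfiable-suc {o} = satisfiable-⊆ (λ o≤ j< → o≤ , ≤-trans j< (+-monoʳ-≤ o (n≤1+n _)))

  slots-⊆ : ∀ {o j} big d → o ≤ j → j < o + slots big d → o ≤ j × j < o + slots big (suc d)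
  slots-⊆ Bool.false d o≤ j< = o≤ , j<
  slots-⊆ {o} Bool.true d o≤ j< = o≤ , ≤-trans j< (+-monoʳ-≤ o (m≤n⇒m≤1+n (m≤m+n _ _)))

  zipAny : ∀ {A : Set} {P Q : A → Set} {xs} → All P xs → Any Q xs → Any (λ x → P x × Q x) xs
  zipAny (p ∷ _)  (here q)  = here (p , q)
  zipAny (_ ∷ ps) (there a) = there (zipAny ps a)

  cnf-complete : ∀ {m} big d o b (c : Circuit n m) i → m ≤ N → o + slots big d ≤ W → Shallow big d (node c i) →
    value c S i ≡ b → Satisfiable o (slots big d) (cnf W N k big d o b c i)
  node-complete : ∀ big d o b (x : Node n) → nodeSize x ≤ N → o + slots big d ≤ W → Shallow big d x →
    nodeValue S x ≡ b → Satisfiable o (slots big d) (nodeCNF W N k big d o b x)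
  and-complete : ∀ {m} big d o b (c : Circuit n m) is → m ≤ N → o + slots big (suc d) ≤ W →
    isLarge is ≡ Bool.false ⊎ big ≡ Bool.true → All (λ i → Shallow (big ∧ not (isLarge is)) d (node c i)) is →
    All (λ i → value c S i ≡ b) is → Satisfiable o (slots big (suc d)) (andCNF W N k big d o b c is)
  or-complete : ∀ {m} big d o b (c : Circuit n m) is → m ≤ N → o + slots big (suc d) ≤ W →
    isLarge is ≡ Bool.false ⊎ big ≡ Bool.true → All (λ i → Shallow (big ∧ not (isLarge is)) d (node c i)) is →
    Any (λ i → value c S i ≡ b) is → Satisfiable o (slots big (suc d)) (orCNF W N k big d o b c is)

  cnf-complete big d o b c i m≤N o≤ sh v = node-complete big d o b (node c i) (≤-trans (nodeSize≤ c i) m≤N) o≤ sh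
    (trans (sym (evaluate-node boolean S c i)) v)

  node-complete big d o b (input v) _ o≤ sh v≡ = free-satisfiable (leaf-complete b v v≡)
  node-complete big (suc d) o b (gate c (neg i)) m≤N o≤ (_ , sh ∷ []) v≡ = satisfiable-⊆ (slots-⊆ big d)
    (cnf-complete big d o (not b) c i m≤N (slots-step big d o≤)
      (subst (λ z → Shallow z d (node c i)) (Bool.∧-identityʳ big) sh)
      (trans (sym (Bool.not-involutive (value c S i))) (cong not v≡)))
  node-complete big (suc d) o Bool.true  (gate c (conj is)) m≤N o≤ (big? , sh) v≡ =
    and-complete big d o Bool.true c is m≤N o≤ big? sh (and-true⁻ is v≡)
  node-complete big (suc d) o Bool.false (gate c (conj is)) m≤N o≤ (big? , sh) v≡ =
    or-complete big d o Bool.false c is m≤N o≤ big? sh (and-false⁻ is v≡)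
  node-complete big (suc d) o Bool.true  (gate c (disj is)) m≤N o≤ (big? , sh) v≡ =
    or-complete big d o Bool.true c is m≤N o≤ big? sh (or-true⁻ is v≡)
  node-complete big (suc d) o Bool.false (gate c (disj is)) m≤N o≤ (big? , sh) v≡ =
    and-complete big d o Bool.false c is m≤N o≤ big? sh (or-false⁻ is v≡)

  and-complete Bool.false d o b c is m≤N o≤ (inj₁ small) sh vs =
    free-satisfiable (free (smallAnd-complete {o = 0} {0} small children children))
    where
      children = All.zipWith (λ { {i} (q , v) → cnf-complete Bool.false d 0 b c i m≤N z≤n q v }) (sh , vs)
  and-complete Bool.true d o b c is m≤N o≤ _ sh vs with isLarge is in large
  ... | Bool.true = free-satisfiable (largeAnd-complete
    (All.zipWith (λ { {i} (q , v) → free (cnf-complete Bool.false d 0 b c i m≤N z≤n q v) }) (sh , vs)))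
  ... | Bool.false = satisfiable-suc (smallAnd-complete large
    (All.zipWith (λ { {i} (q , v) → cnf-complete Bool.true d o b c i m≤N (slots-step Bool.true d o≤) q v }) (sh , vs))
    (All.zipWith (λ { {i} (q , v) → cnf-complete Bool.true d _ b c i m≤N (slots-second d o≤) q v }) (sh , vs)))

  or-complete Bool.false d o b c is m≤N o≤ (inj₁ small) sh vs =
    free-satisfiable (free (smallOr-complete {o = 0} {0} small
      (Any.map (λ { {i} (q , v) → let s = cnf-complete Bool.false d 0 b c i m≤N z≤n q v in s , s }) (zipAny sh vs))))
  or-complete Bool.true d o b c is m≤N o≤ _ sh vs with isLarge is in large
  ... | Bool.true = largeOr-complete m≤N
    (m≤n⇒m≤n+o k (slots-first d o≤))
    (Any.map (λ { {i} (q , v) → free (cnf-complete Bool.false d 0 b c i m≤N z≤n q v) }) (zipAny sh vs))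
  ... | Bool.false = satisfiable-suc (smallOr-complete large (Any.map (λ { {i} (q , v) →
      cnf-complete Bool.true d o b c i m≤N (slots-step Bool.true d o≤) q v ,
      cnf-complete Bool.true d _ b c i m≤N (slots-second d o≤) q v }) (zipAny sh vs)))

-- The universe of the hitting set instance

slot< : ∀ {N K j u} → j < K → u < N → slot N j u < K * N
slot< {N} {K} {j} {u} j<K u<N = begin-strict
  j * N + u   <⟨ +-monoʳ-< (j * N) u<N ⟩
  j * N + N   ≡⟨ +-comm (j * N) N ⟩
  suc j * N   ≤⟨ *-monoˡ-≤ N j<K ⟩
  K * N       ∎
  where open ≤-Reasoning

-- Uniqueness of quotient and remainder modulo `N`.
slot-injective : ∀ {N i j u v} → u < N → v < N → slot N i u ≡ slot N j v → i ≡ j × u ≡ v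
slot-injective {N} {i} {j} {u} {v} u<N v<N e with <-cmp i j
... | tri< i<j _ _ = ⊥-elim (<⇒≢ (≤-trans (slot< i<j u<N) (m≤m+n (j * N) v)) e)
... | tri≈ _ refl _ = refl , +-cancelˡ-≡ (i * N) u v e
... | tri> _ _ j<i = ⊥-elim (<⇒≢ (≤-trans (slot< j<i v<N) (m≤m+n (i * N) u)) (sym e))

-- The path of a clause records only elements below `T`; a hit elsewhere would cut nothing on it.
Bounded : ℕ → List (List ℕ) → Set
Bounded T F = All (All (_< T)) F

module _ {N K : ℕ} where
  others-bounded : ∀ {j} v → j < K → All (_< K * N) (others N j v)
  others-bounded {j} v j<K = go N ≤-refl
    where
      go : ∀ m → m ≤ N → All (_< K * N) (othersBelow N j v m)
      go zero    _ = []
      go (suc m) m<N with m ≡ᵇ v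
      ... | Bool.true  = go m (<⇒≤ m<N)
      ... | Bool.false = slot< j<K m<N ∷ go m (<⇒≤ m<N)

  row-bounded : ∀ {j n} → j < K → n ≤ N → All (_< K * N) (row N j n)
  row-bounded {n = zero}  j<K n≤N = []
  row-bounded {n = suc v} j<K n≤N = slot< j<K n≤N ∷ row-bounded j<K (<⇒≤ n≤N)

module _ {T : ℕ} where
  addToAll-bounded : ∀ {C B} → All (_< T) C → Bounded T B → Bounded T (map (C ++_) B)
  addToAll-bounded c []       = []
  addToAll-bounded c (b ∷ bs) = All.++⁺ c b ∷ addToAll-bounded c bs

  product-bounded : ∀ {A B} → Bounded T A → Bounded T B → Bounded T (product A B)
  product-bounded []       bs = []
  product-bounded (a ∷ as) bs = All.++⁺ (addToAll-bounded a bs) (product-bounded as bs)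

  module _ {m : ℕ} {C₀ C₁ : Fin m → List (List ℕ)} (p : ∀ i → Bounded T (C₀ i)) (q : ∀ i → Bounded T (C₁ i)) where
    smallAnd-bounded : ∀ is → Bounded T (smallAnd C₀ C₁ is)
    smallAnd-bounded []           = []
    smallAnd-bounded (i ∷ [])     = p i
    smallAnd-bounded (i ∷ j ∷ is) = All.++⁺ (p i) (q j)

    smallOr-bounded : ∀ is → Bounded T (smallOr C₀ C₁ is)
    smallOr-bounded []           = [] ∷ []
    smallOr-bounded (i ∷ [])     = p i
    smallOr-bounded (i ∷ j ∷ is) = product-bounded (p i) (q j)

  module _ {m : ℕ} {C : Fin m → List (List ℕ)} (p : ∀ i → Bounded T (C i)) where
    largeAnd-bounded : ∀ {N} is → Bounded T (largeAnd N C is)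
    largeAnd-bounded []           = []
    largeAnd-bounded {N} (i ∷ is) = All.++⁺ (p i) (largeAnd-bounded {N} is)

module _ {N K : ℕ} {m : ℕ} {C : Fin m → List (List ℕ)} (p : ∀ i → Bounded (K * N) (C i)) where
  largeOr-bounded : ∀ {o} → m ≤ N → o < K → ∀ is → Bounded (K * N) (largeOr N C o is)
  largeOr-bounded {o} m≤N o<K is = options is ∷ witnesses is
    where
      options : ∀ is → All (_< K * N) (map (λ i → slot N o (toℕ i)) is)
      options []       = []
      options (i ∷ is) = slot< o<K (≤-trans (toℕ<n i) m≤N) ∷ options is
      witnesses : ∀ is → Bounded (K * N) (witnessed N C o is)
      witnesses []       = []
      witnesses (i ∷ is) = All.++⁺ (addToAll-bounded (others-bounded (toℕ i) o<K) (p i)) (witnesses is)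

module _ (W N k n : ℕ) (n≤N : n ≤ N) where
  private
    T = (W + k) * N

  positive-bounded : ∀ {v} → v < N → ∀ i → i ≤ k → All (_< T) (positive W N i v)
  positive-bounded v<N zero    _   = []
  positive-bounded v<N (suc i) i<k = slot< (+-monoʳ-< W i<k) v<N ∷ positive-bounded v<N i (<⇒≤ i<k)

  negative-bounded : ∀ v i → i ≤ k → Bounded T (negative W N i v)
  negative-bounded v zero    _   = []
  negative-bounded v (suc i) i<k = others-bounded v (+-monoʳ-< W i<k) ∷ negative-bounded v i (<⇒≤ i<k)

  leaf-bounded : ∀ b {v} → v < N → Bounded T (leaf W N k b v)
  leaf-bounded Bool.true  v<N = positive-bounded v<N k ≤-refl ∷ []
  leaf-bounded Bool.false v<N = negative-bounded _ k ≤-refl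

  cnf-bounded : ∀ {m} big d o b (c : Circuit n m) i → m ≤ N → o + slots big d ≤ W → Bounded T (cnf W N k big d o b c i)
  node-bounded : ∀ big d o b (x : Node n) → nodeSize x ≤ N → o + slots big d ≤ W → Bounded T (nodeCNF W N k big d o b x)
  and-bounded : ∀ {m} big d o b (c : Circuit n m) is → m ≤ N → o + slots big (suc d) ≤ W →
    Bounded T (andCNF W N k big d o b c is)
  or-bounded : ∀ {m} big d o b (c : Circuit n m) is → m ≤ N → o + slots big (suc d) ≤ W →
    Bounded T (orCNF W N k big d o b c is)

  cnf-bounded big d o b c i m≤N o≤ = node-bounded big d o b (node c i) (≤-trans (nodeSize≤ c i) m≤N) o≤

  node-bounded big d       o b (input v)            _   o≤ = leaf-bounded b (≤-trans (toℕ<n v) n≤N)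
  node-bounded big zero    o b (gate c g)           m≤N o≤ = []
  node-bounded big (suc d) o b (gate c (neg i))     m≤N o≤ = cnf-bounded big d o (not b) c i m≤N (slots-step big d o≤)
  node-bounded big (suc d) o Bool.true  (gate c (conj is)) m≤N o≤ = and-bounded big d o Bool.true c is m≤N o≤
  node-bounded big (suc d) o Bool.false (gate c (conj is)) m≤N o≤ = or-bounded big d o Bool.false c is m≤N o≤
  node-bounded big (suc d) o Bool.true  (gate c (disj is)) m≤N o≤ = or-bounded big d o Bool.true c is m≤N o≤
  node-bounded big (suc d) o Bool.false (gate c (disj is)) m≤N o≤ = and-bounded big d o Bool.false c is m≤N o≤

  and-bounded Bool.false d o b c is m≤N o≤ =
    smallAnd-bounded (λ i → cnf-bounded Bool.false d 0 b c i m≤N z≤n) (λ i → cnf-bounded Bool.false d 0 b c i m≤N z≤n) is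
  and-bounded Bool.true d o b c is m≤N o≤ with isLarge is
  ... | Bool.true  = largeAnd-bounded (λ i → cnf-bounded Bool.false d 0 b c i m≤N z≤n) {N} is
  ... | Bool.false = smallAnd-bounded (λ i → cnf-bounded Bool.true d o b c i m≤N (slots-step Bool.true d o≤))
    (λ i → cnf-bounded Bool.true d _ b c i m≤N (slots-second d o≤)) is

  or-bounded Bool.false d o b c is m≤N o≤ =
    smallOr-bounded (λ i → cnf-bounded Bool.false d 0 b c i m≤N z≤n) (λ i → cnf-bounded Bool.false d 0 b c i m≤N z≤n) is
  or-bounded Bool.true d o b c is m≤N o≤ with isLarge is
  ... | Bool.true  = largeOr-bounded (λ i → cnf-bounded Bool.false d 0 b c i m≤N z≤n) m≤N (m≤n⇒m≤n+o k (slots-first d o≤)) is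
  ... | Bool.false = smallOr-bounded (λ i → cnf-bounded Bool.true d o b c i m≤N (slots-step Bool.true d o≤))
    (λ i → cnf-bounded Bool.true d _ b c i m≤N (slots-second d o≤)) is

-- Row and distinctness clauses

rows⁻ : ∀ {o N n} k {P : List ℕ → Set} → All P (rows o N n k) → ∀ {i} → i < k → P (row N (o + i) n)
rows⁻ (suc k) (p ∷ ps) {i} i<k with i ≟ k
... | yes refl = p
... | no i≢k   = rows⁻ k ps (≤∧≢⇒< (≤-pred i<k) i≢k)

rows⁺ : ∀ {o N n} k {P : List ℕ → Set} → (∀ {i} → i < k → P (row N (o + i) n)) → All P (rows o N n k)
rows⁺ zero    f = []
rows⁺ (suc k) f = f ≤-refl ∷ rows⁺ k (λ i<k → f (m≤n⇒m≤1+n i<k))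

row⁻ : ∀ {N j} n {P : ℕ → Set} → Any P (row N j n) → ∃[ v ] v < n × P (slot N j v)
row⁻ (suc n) (here p)  = n , ≤-refl , p
row⁻ (suc n) (there a) = let v , v<n , p = row⁻ n a in v , m≤n⇒m≤1+n v<n , p

row⁺ : ∀ {N j n v} → v < n → slot N j v ∈ row N j n
row⁺ {n = suc n} {v} v<n with v ≟ n
... | yes refl = here refl
... | no v≢n   = there (row⁺ (≤∧≢⇒< (≤-pred v<n) v≢n))

module _ {W N : ℕ} {P : List ℕ → Set} where
  distinctPair⁻ : ∀ n {i j} → All P (distinctPair W N n i j) → ∀ {v} → v < n → P (others N (W + i) v ++ others N (W + j) v)
  distinctPair⁻ (suc n) (p ∷ ps) {v} v<n with v ≟ n
  ... | yes refl = p
  ... | no v≢n   = distinctPair⁻ n ps (≤∧≢⇒< (≤-pred v<n) v≢n)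

  distinctPair⁺ : ∀ n {i j} → (∀ {v} → v < n → P (others N (W + i) v ++ others N (W + j) v)) → All P (distinctPair W N n i j)
  distinctPair⁺ zero    f = []
  distinctPair⁺ (suc n) f = f ≤-refl ∷ distinctPair⁺ n (λ v<n → f (m≤n⇒m≤1+n v<n))

  distinctFrom⁻ : ∀ {n i} m → All P (distinctFrom W N n i m) → ∀ {j} → j < m → All P (distinctPair W N n i j)
  distinctFrom⁻ {n} {i} (suc m) ps {j} j<m with j ≟ m
  ... | yes refl = proj₁ (All.++⁻ (distinctPair W N n i m) ps)
  ... | no j≢m   = distinctFrom⁻ m (proj₂ (All.++⁻ (distinctPair W N n i m) ps)) (≤∧≢⇒< (≤-pred j<m) j≢m)

  distinctFrom⁺ : ∀ {n i} m → (∀ {j} → j < m → All P (distinctPair W N n i j)) → All P (distinctFrom W N n i m)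
  distinctFrom⁺ zero    f = []
  distinctFrom⁺ (suc m) f = All.++⁺ (f ≤-refl) (distinctFrom⁺ m (λ j<m → f (m≤n⇒m≤1+n j<m)))

  distinct⁻ : ∀ {n} k → All P (distinct W N n k) → ∀ {i j v} → i < k → j < i → v < n → P (others N (W + i) v ++ others N (W + j) v)
  distinct⁻ {n} (suc k) ps {i} i<k j<i v<n with i ≟ k
  ... | yes refl = distinctPair⁻ n (distinctFrom⁻ k (proj₁ (All.++⁻ (distinctFrom W N n k k) ps)) j<i) v<n
  ... | no i≢k   = distinct⁻ k (proj₂ (All.++⁻ (distinctFrom W N n k k) ps)) (≤∧≢⇒< (≤-pred i<k) i≢k) j<i v<n

  distinct⁺ : ∀ {n} k → (∀ {i j v} → i < k → j < i → v < n → P (others N (W + i) v ++ others N (W + j) v)) → All P (distinct W N n k)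
  distinct⁺ zero    f = []
  distinct⁺ {n} (suc k) f = All.++⁺ (distinctFrom⁺ k (λ j<k → distinctPair⁺ n (λ v<n → f ≤-refl j<k v<n)))
    (distinct⁺ k (λ i<k → f (m≤n⇒m≤1+n i<k)))

inputs≤nodes : ∀ {n m} → Circuit n m → n ≤ m
inputs≤nodes inputs  = ≤-refl
inputs≤nodes (c ▷ g) = m≤n⇒m≤1+n (inputs≤nodes c)

clauses-bounded : ∀ {n m} d k (c : Circuit n m) i → Bounded ((slots Bool.true d + k) * m) (clauses d m k c i)
clauses-bounded {n} {m} d k c i = All.++⁺ (rows⁺ k (λ i<k → row-bounded (+-monoʳ-< W i<k) n≤m))
  (All.++⁺ (rows⁺ W (λ i<W → row-bounded (m≤n⇒m≤n+o k i<W) ≤-refl))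
  (All.++⁺ (distinct⁺ k (λ {_} {_} {v} i<k j<i _ → All.++⁺ (others-bounded v (+-monoʳ-< W i<k))
                                           (others-bounded v (+-monoʳ-< W (<-trans j<i i<k)))))
           (cnf-bounded W m k n n≤m Bool.true d 0 Bool.true c i ≤-refl ≤-refl)))
  where
    W = slots Bool.true d
    n≤m = inputs≤nodes c

-- Counting the elements of slots

length-⊆ : ∀ {xs ys : List ℕ} → Unique xs → xs ⊆ ys → length xs ≤ length ys
length-⊆ {[]}     _        _  = z≤n
length-⊆ {x ∷ xs} {ys} (x∉xs ∷ u) xs⊆ys with ∈-∃++ (xs⊆ys (here refl))
... | as , bs , refl = ≤-trans (s≤s (length-⊆ u avoiding)) (≤-reflexive (sym (length-++-sucʳ as x bs)))
  where
    avoiding : xs ⊆ as ++ bs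
    avoiding {y} y∈xs with ∈-++⁻ as (xs⊆ys (there y∈xs))
    ... | inj₁ y∈as         = ∈-++⁺ˡ y∈as
    ... | inj₂ (here refl)  = ⊥-elim (All.lookup x∉xs y∈xs refl)
    ... | inj₂ (there y∈bs) = ∈-++⁺ʳ as y∈bs

length-chosen : ∀ N a K → length (chosen N a K) ≡ K
length-chosen N a zero    = refl
length-chosen N a (suc K) = cong suc (length-chosen N a K)

chosen⁻ : ∀ {N a} K {P : ℕ → Set} → Any P (chosen N a K) → ∃[ j ] j < K × P (slot N j (a j))
chosen⁻ (suc K) (here p)    = K , ≤-refl , p
chosen⁻ (suc K) (there any) = let j , j<K , p = chosen⁻ K any in j , m≤n⇒m≤1+n j<K , p

chosen-unique : ∀ {N a} K → (∀ {j} → j < K → a j < N) → Unique (chosen N a K)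
chosen-unique zero a<N = []
chosen-unique {N} {a} (suc K) a<N =
  All.tabulate (λ {x} x∈ p → let j , j<K , e = chosen⁻ K x∈ in
    <⇒≢ j<K (sym (proj₁ (slot-injective (a<N ≤-refl) (a<N (m≤n⇒m≤1+n j<K)) (trans p e))))) ∷
  chosen-unique K (λ j<K → a<N (m≤n⇒m≤1+n j<K))

-- Pigeonhole: L has no room for a second element of a slot.
slots-unique : ∀ {N K L} (a : ℕ → ℕ) → length L ≤ K → (∀ {j} → j < K → a j < N × slot N j (a j) ∈ L) →
  ∀ {j u} → j < K → u < N → slot N j u ∈ L → u ≡ a j
slots-unique {N} {K} {L} a L≤K a∈ {j} {u} j<K u<N u∈L with slot N j u ∈? chosen N a K
... | yes u∈ = let i , i<K , e = chosen⁻ K u∈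
                   j≡i , u≡ = slot-injective u<N (proj₁ (a∈ i<K)) e
               in trans u≡ (cong a (sym j≡i))
-- A further element, put in front of the `K` picks, would give `K + 1` distinct elements of `L`.
... | no u∉ = ⊥-elim (<⇒≱ (s≤s L≤K) (≤-trans (≤-reflexive (cong suc (sym (length-chosen N a K)))) (length-⊆
        (All.tabulate (λ x∈ p → u∉ (subst (_∈ chosen N a K) (sym p) x∈)) ∷ chosen-unique K (λ j<K → proj₁ (a∈ j<K)))
        (λ { (here refl) → u∈L ; (there x∈) → let i , i<K , e = chosen⁻ K x∈ in subst (_∈ L) (sym e) (proj₂ (a∈ i<K)) }))))

∈-fromMembers⁻ : ∀ {n} L {i : Fin n} → i Subset.∈ fromMembers L → toℕ i ∈ L
∈-fromMembers⁻ [] i∈ = ⊥-elim (∉⊥ i∈)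
∈-fromMembers⁻ {n} (t ∷ L) i∈ with t <? n
... | no _ = there (∈-fromMembers⁻ L i∈)
... | yes t<n with x∈p∪q⁻ ⁅ Fin.fromℕ< t<n ⁆ (fromMembers L) i∈
...   | inj₁ p = here (trans (cong toℕ (x∈⁅y⁆⇒x≡y _ p)) (toℕ-fromℕ< t<n))
...   | inj₂ p = there (∈-fromMembers⁻ L p)

∈-members⁻ : ∀ {n} (p : Subset n) {t} → t ∈ members p → ∃[ i ] i Subset.∈ p × toℕ i ≡ t
∈-members⁻ (Bool.true Vec.∷ p) (here refl) = Fin.zero , Vec.here , refl
∈-members⁻ (Bool.true Vec.∷ p) (there t∈) with ∈-map⁻ suc t∈
... | u , u∈ , refl = let i , i∈ , e = ∈-members⁻ p u∈ in Fin.suc i , Vec.there i∈ , cong suc e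
∈-members⁻ (Bool.false Vec.∷ p) t∈ with ∈-map⁻ suc t∈
... | u , u∈ , refl = let i , i∈ , e = ∈-members⁻ p u∈ in Fin.suc i , Vec.there i∈ , cong suc e

members-unique : ∀ {n} (p : Subset n) → Unique (members p)
members-unique Vec.[] = []
members-unique (Bool.true Vec.∷ p) =
  All.tabulate (λ x∈ 0≡x → let u , _ , e = ∈-map⁻ suc x∈ in 0≢1+n (trans 0≡x e)) ∷
  Unique.map⁺ suc-injective (members-unique p)
members-unique (Bool.false Vec.∷ p) = Unique.map⁺ suc-injective (members-unique p)

nth : List ℕ → ℕ → ℕ
nth []       i       = 0
nth (x ∷ xs) zero    = x
nth (x ∷ xs) (suc i) = nth xs i

nth-∈ : ∀ xs {i} → i < length xs → nth xs i ∈ xs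
nth-∈ (x ∷ xs) {zero}  _       = here refl
nth-∈ (x ∷ xs) {suc i} (s≤s p) = there (nth-∈ xs p)

∈-nth : ∀ {xs x} → x ∈ xs → ∃[ i ] i < length xs × nth xs i ≡ x
∈-nth (here refl) = 0 , s≤s z≤n , refl
∈-nth (there x∈)  = let i , i< , e = ∈-nth x∈ in suc i , s≤s i< , e

nth-injective : ∀ {xs} → Unique xs → ∀ {i j} → j < i → i < length xs → nth xs i ≢ nth xs j
nth-injective (x∉ ∷ u) {suc i} {zero}  _         (s≤s i<) e = All.lookup x∉ (nth-∈ _ i<) (sym e)
nth-injective (x∉ ∷ u) {suc i} {suc j} (s≤s j<i) (s≤s i<) e = nth-injective u j<i i< e

-- Hitting sets of all clauses and satisfying inputs of weight `k`

WeightedSat : ∀ {n m} → ℕ → Circuit n m → Fin m → Set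
WeightedSat {n} k c out = Σ[ S ∈ Subset n ] (∣ S ∣ ≡ k × value c S out ≡ Bool.true)

module _ {n m : ℕ} (d k : ℕ) (c : Circuit n m) (out : Fin m) (shallow : Shallow Bool.true d (node c out)) where
  private
    W = slots Bool.true d
    K = W + k
    n≤m = inputs≤nodes c
    K< : ∀ {i} → i < k → W + i < K
    K< = +-monoʳ-< W

  module _ {L : List ℕ} (L≤K : length L ≤ K) (hits : All (Hits L) (clauses d m k c out)) where
    private
      hits₁ = All.++⁻ (rows W m n k) hits
      hits₂ = All.++⁻ (rows 0 m m W) (proj₂ hits₁)
      hits₃ = All.++⁻ (distinct W m n k) (proj₂ hits₂)

      mainHit : ∀ {i} → i < k → ∃[ v ] v < n × slot m (W + i) v ∈ L
      mainHit i<k = row⁻ n (rows⁻ k (proj₁ hits₁) i<k)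

      slotHit : ∀ {j} → j < K → ∃[ v ] v < m × slot m j v ∈ L
      slotHit {j} j<K with j <? W
      ... | yes j<W = row⁻ m (rows⁻ W (proj₁ hits₂) j<W)
      ... | no j≮W with mainHit {j ∸ W} (+-cancelˡ-< W (j ∸ W) k (subst (_< K) (sym (m+[n∸m]≡n (≮⇒≥ j≮W))) j<K))
      ...   | v , v<n , v∈L = v , ≤-trans v<n n≤m , subst (λ j → slot m j v ∈ L) (m+[n∸m]≡n (≮⇒≥ j≮W)) v∈L

      -- The pick of each slot, made total by the value 0 outside the range.
      a : ℕ → ℕ
      a j with j <? K
      ... | yes j<K = proj₁ (slotHit j<K)
      ... | no _    = 0

      a∈ : ∀ {j} → j < K → a j < m × slot m j (a j) ∈ L
      a∈ {j} j<K with j <? K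
      ... | yes p = proj₂ (slotHit p)
      ... | no ≮  = ⊥-elim (≮ j<K)

      only : ∀ {j u} → j < K → u < m → slot m j u ∈ L → u ≡ a j
      only = slots-unique a L≤K a∈

      main<n : ∀ {i} → i < k → a (W + i) < n
      main<n i<k = let v , v<n , v∈L = mainHit i<k in subst (_< n) (only (K< i<k) (≤-trans v<n n≤m) v∈L) v<n

      -- The distinctness clause for the input picked by slot `i` is hit by an element other than
      -- this input, in slot `i` or `j`; but the pick is the only element of each slot.
      main-distinct : ∀ {i j} → i < k → j < i → a (W + i) ≢ a (W + j)
      main-distinct {i} {j} i<k j<i e with Any.++⁻ (others m (W + i) (a (W + i))) (distinct⁻ k (proj₁ hits₃) i<k j<i (main<n i<k))
      ... | inj₁ hit = let u , u<m , u≢ , u∈L = others⁻ {m} {W + i} hit in u≢ (only (K< i<k) u<m u∈L)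
      ... | inj₂ hit = let u , u<m , u≢ , u∈L = others⁻ {m} {W + j} hit in
                       u≢ (trans (only (K< (<-trans j<i i<k)) u<m u∈L) (sym e))

      vs : ℕ → List ℕ
      vs zero    = []
      vs (suc i) = a (W + i) ∷ vs i

      vs⁻ : ∀ i {P : ℕ → Set} → Any P (vs i) → ∃[ j ] j < i × P (a (W + j))
      vs⁻ (suc i) (here p)  = i , ≤-refl , p
      vs⁻ (suc i) (there q) = let j , j<i , p = vs⁻ i q in j , m≤n⇒m≤1+n j<i , p

      vs⁺ : ∀ {i j} → j < i → a (W + j) ∈ vs i
      vs⁺ {suc i} {j} j<i with j ≟ i
      ... | yes refl = here refl
      ... | no j≢i   = there (vs⁺ (≤∧≢⇒< (≤-pred j<i) j≢i))

      vs-unique : ∀ i → i ≤ k → Unique (vs i)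
      vs-unique zero    _   = []
      vs-unique (suc i) i<k = All.tabulate (λ x∈ e → let j , j<i , p = vs⁻ i x∈ in main-distinct i<k j<i (trans e p)) ∷
        vs-unique i (<⇒≤ i<k)

      length-vs : ∀ i → length (vs i) ≡ i
      length-vs zero    = refl
      length-vs (suc i) = cong suc (length-vs i)

      S : Subset n
      S = fromMembers (vs k)

      vs⊆S : vs k ⊆ members S
      vs⊆S x∈ with vs⁻ k x∈
      ... | j , j<k , refl with ∈-fromMembers {n} (vs⁺ j<k) (main<n j<k)
      ...   | i , i∈S , e = subst (_∈ members S) e (∈-members i∈S)

      -- The lower bound is where distinctness of the picks enters.
      ∣S∣≡k : ∣ S ∣ ≡ k
      ∣S∣≡k = ≤-antisym (≤-trans (∣fromMembers∣≤length (vs k)) (≤-reflexive (length-vs k)))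
        (≤-trans (≤-reflexive (sym (length-vs k)))
          (≤-trans (length-⊆ (vs-unique k ≤-refl) vs⊆S) (≤-reflexive (length-members S))))

      main⁺ : ∀ v {i} → i < k → slot m (W + i) (toℕ v) ∈ L → lookup S v ≡ Bool.true
      main⁺ v {i} i<k v∈L with ∈-fromMembers {n} (vs⁺ i<k) (main<n i<k)
      ... | u , u∈S , e = []=⇒lookup (subst (Subset._∈ S)
        (toℕ-injective (trans e (sym (only (K< i<k) (≤-trans (toℕ<n v) n≤m) v∈L)))) u∈S)

      main⁻ : ∀ v → lookup S v ≡ Bool.true → ∃[ i ] i < k × slot m (W + i) (toℕ v) ∈ L
      main⁻ v e = let j , j<k , p = vs⁻ k (∈-fromMembers⁻ (vs k) (lookup⇒[]= v S e)) in
        j , j<k , subst (λ u → slot m (W + j) u ∈ L) (sym p) (proj₂ (a∈ (K< j<k)))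

      module Sound = Soundness {n} {m} {k} {W} n≤m S L main⁺ main⁻
        (λ j<K u<m v<m u∈L v∈L → trans (only j<K u<m u∈L) (sym (only j<K v<m v∈L)))

    hittingSet⇒sat : WeightedSat k c out
    hittingSet⇒sat = S , ∣S∣≡k , Sound.cnf-sound Bool.true d 0 Bool.true c out ≤-refl ≤-refl shallow (proj₂ hits₃)

  module _ (S : Subset n) (∣S∣≡k : ∣ S ∣ ≡ k) where
    private
      main : ℕ → ℕ
      -- Main slot `i` picks the `i`-th input set to true.
      main = nth (members S)

      i<length : ∀ {i} → i < k → i < length (members S)
      i<length = subst (_ <_) (sym (trans (length-members S) ∣S∣≡k))

      main<n : ∀ {i} → i < k → main i < n
      main<n i<k = let v , _ , e = ∈-members⁻ S (nth-∈ (members S) (i<length i<k)) in subst (_< n) e (toℕ<n v)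

      main<m : ∀ {i} → i < k → main i < m
      main<m i<k = ≤-trans (main<n i<k) n≤m

      main⁺ : ∀ v → lookup S v ≡ Bool.true → ∃[ i ] i < k × main i ≡ toℕ v
      main⁺ v e = let i , i< , p = ∈-nth (∈-members (lookup⇒[]= v S e)) in
        i , subst (i <_) (trans (length-members S) ∣S∣≡k) i< , p

      main⁻ : ∀ v {i} → i < k → main i ≡ toℕ v → lookup S v ≡ Bool.true
      main⁻ v i<k e = let u , u∈S , p = ∈-members⁻ S (nth-∈ (members S) (i<length i<k)) in
        []=⇒lookup (subst (Subset._∈ S) (toℕ-injective (trans p e)) u∈S)

      1≤m : 1 ≤ m
      1≤m = ≤-trans (s≤s z≤n) (toℕ<n out)

    module _ (w : ℕ → ℕ) where
      assignment : ℕ → ℕ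
      assignment j with j <? W
      ... | yes _ = w j
      ... | no _  = main (j ∸ W)

      assignment-witness : ∀ {j} → j < W → assignment j ≡ w j
      assignment-witness {j} j<W with j <? W
      ... | yes _ = refl
      ... | no ≮  = ⊥-elim (≮ j<W)

      assignment-main : ∀ i → assignment (W + i) ≡ main i
      assignment-main i with W + i <? W
      ... | yes p = ⊥-elim (<⇒≱ p (m≤m+n W i))
      ... | no _  = cong main (m+n∸m≡n W i)

      private
        L : List ℕ
        L = chosen m assignment K

      main∈ : ∀ {i} → i < k → slot m (W + i) (main i) ∈ L
      main∈ {i} i<k = subst (λ u → slot m (W + i) u ∈ L) (assignment-main i) (∈-chosen (K< i<k))

      mainRow-hit : ∀ {i} → i < k → Hits L (row m (W + i) n)
      mainRow-hit i<k = lose (row⁺ (main<n i<k)) (main∈ i<k)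

      witnessRow-hit : (∀ j → w j < m) → ∀ {j} → j < W → Hits L (row m j m)
      witnessRow-hit w<m {j} j<W = lose (row⁺ (w<m j))
        (subst (λ u → slot m j u ∈ L) (assignment-witness j<W) (∈-chosen (m≤n⇒m≤n+o k j<W)))

      -- The picks of slots `i` and `j` differ, so at least one of them is not `v`.
      distinct-hit : ∀ {i j v} → i < k → j < i → v < n → Hits L (others m (W + i) v ++ others m (W + j) v)
      distinct-hit {i} {j} {v} i<k j<i v<n with main i ≟ v
      ... | no ≢v = Any.++⁺ˡ (lose (others⁺ (main<m i<k) ≢v) (main∈ i<k))
      ... | yes refl = Any.++⁺ʳ (others m (W + i) (main i)) (lose
        (others⁺ (main<m j<k) (λ e → nth-injective (members-unique S) j<i (i<length i<k) (sym e))) (main∈ j<k))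
        where j<k = <-trans j<i i<k

      assignment-hits : (∀ j → w j < m) → All (Hits L) (cnf W m k Bool.true d 0 Bool.true c out) →
        HittingSet K (clauses d m k c out)
      assignment-hits w<m hits = L , ≤-reflexive (length-chosen m assignment K) ,
        All.++⁺ {xs = rows W m n k} (rows⁺ k mainRow-hit)
          (All.++⁺ {xs = rows 0 m m W} (rows⁺ W (witnessRow-hit w<m))
            (All.++⁺ {xs = distinct W m n k} (distinct⁺ k distinct-hit) hits))

    sat⇒hittingSet : value c S out ≡ Bool.true → HittingSet K (clauses d m k c out)
    sat⇒hittingSet sat =
      let w , w<m , works = Completeness.cnf-complete S main main<m main⁺ main⁻ 1≤m
                              Bool.true d 0 Bool.true c out ≤-refl ≤-refl shallow sat
      in assignment-hits w w<m (works (assignment w) (λ {i} _ → assignment-main w i) (λ _ j<W → assignment-witness w j<W))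

  hittingSet⇔sat : HittingSet K (clauses d m k c out) ⇔ WeightedSat k c out
  hittingSet⇔sat = mk⇔ (λ (L , L≤K , hits) → hittingSet⇒sat L≤K hits) (λ (S , ∣S∣≡k , sat) → sat⇒hittingSet S ∣S∣≡k sat)

-- Recognising circuits of weft one

predecessors-map : ∀ {A B : Set} (f : A → B) g → predecessors (mapGate f g) ≡ map f (predecessors g)
predecessors-map f (neg a)   = refl
predecessors-map f (conj as) = refl
predecessors-map f (disj as) = refl

large-map : ∀ {A B : Set} (f : A → B) g → large (mapGate f g) ≡ (if isLarge (predecessors g) then 1 else 0)
large-map {A} {B} f = cases
  where
    go : ∀ (is : List A) → large (conj (map f is)) ≡ (if isLarge is then 1 else 0)
    go []               = refl
    go (_ ∷ [])         = refl
    go (_ ∷ _ ∷ [])     = refl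
    go (_ ∷ _ ∷ _ ∷ is) = refl
    cases : ∀ g → large (mapGate f g) ≡ (if isLarge (predecessors g) then 1 else 0)
    cases (neg a)   = refl
    cases (conj as) = go as
    cases (disj as) = go as

depthOp weftOp : Gate ℕ → ℕ
depthOp g = suc (max 0 (predecessors g))
weftOp  g = large g + max 0 (predecessors g)

max-map≤⁻ : ∀ {A : Set} (f : A → ℕ) g {b} → max 0 (predecessors (mapGate f g)) ≤ b → All (λ i → f i ≤ b) (predecessors g)
max-map≤⁻ f g max≤b rewrite predecessors-map f g =
  All.map⁻ (All.map (λ p → ≤-trans p max≤b) (xs≤max 0 (map f (predecessors g))))

max-map≤⁺ : ∀ {A : Set} (f : A → ℕ) g {b} → All (λ i → f i ≤ b) (predecessors g) → max 0 (predecessors (mapGate f g)) ≤ b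
max-map≤⁺ f g all rewrite predecessors-map f g = max≤v⁺ z≤n (All.map⁺ all)

weftBound : Bool → ℕ
weftBound big = if big then 1 else 0

shallow⁻ : ∀ {n} big d (x : Node n) → Shallow big d x →
  nodeEvaluate depthOp (replicate n 0) x ≤ d × nodeEvaluate weftOp (replicate n 0) x ≤ weftBound big
shallow⁻ big d (input v) _ rewrite lookup-replicate v 0 = z≤n , z≤n
shallow⁻ {n} big (suc d) (gate c g) (big? , sh) =
  s≤s (max-map≤⁺ (depth c) g (All.map proj₁ children)) , weft≤ (isLarge (predecessors g)) refl big?
  where
    children : All (λ i → depth c i ≤ d × weft c i ≤ weftBound (big ∧ not (isLarge (predecessors g)))) (predecessors g)
    children = All.map (λ {i} s → let p , q = shallow⁻ _ d (node c i) s in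
      subst (_≤ d) (sym (evaluate-node depthOp (replicate n 0) c i)) p ,
      subst (_≤ weftBound (big ∧ not (isLarge (predecessors g)))) (sym (evaluate-node weftOp (replicate n 0) c i)) q) sh
    below : max 0 (predecessors (mapGate (weft c) g)) ≤ weftBound (big ∧ not (isLarge (predecessors g)))
    below = max-map≤⁺ (weft c) g (All.map proj₂ children)
    weft≤ : ∀ l → isLarge (predecessors g) ≡ l → l ≡ Bool.false ⊎ big ≡ Bool.true →
      large (mapGate (weft c) g) + max 0 (predecessors (mapGate (weft c) g)) ≤ weftBound big
    weft≤ l l≡ big? rewrite large-map (weft c) g with below
    ... | b rewrite l≡ = go l big? b
      where
        go : ∀ l {big x} → l ≡ Bool.false ⊎ big ≡ Bool.true → x ≤ weftBound (big ∧ not l) →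
          (if l then 1 else 0) + x ≤ weftBound big
        go Bool.false {Bool.false} _ p = p
        go Bool.false {Bool.true}  _ p = p
        go Bool.true  {Bool.true}  _ p = s≤s p
        go Bool.true  {Bool.false} (inj₁ ()) p
        go Bool.true  {Bool.false} (inj₂ ()) p

-- A large gate contributes 1 to the weft: a budget of 1 leaves 0 for its arguments, and a budget of
-- 0 is exceeded. This is how `big` changes from a gate to its arguments.
shallow⁺ : ∀ {n} big d (x : Node n) → nodeEvaluate depthOp (replicate n 0) x ≤ d →
  nodeEvaluate weftOp (replicate n 0) x ≤ weftBound big → Shallow big d x
shallow⁺ big d (input v) _ _ = tt
shallow⁺ {n} big (suc d) (gate c g) (s≤s depth≤) weft≤ rewrite large-map (weft c) g =
  let big? , below = split (isLarge (predecessors g)) weft≤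
  in big? , All.zipWith (λ { {i} (p , q) → shallow⁺ _ d (node c i)
       (subst (_≤ d) (evaluate-node depthOp (replicate n 0) c i) p)
       (subst (_≤ weftBound (big ∧ not (isLarge (predecessors g)))) (evaluate-node weftOp (replicate n 0) c i) q) })
     (max-map≤⁻ (depth c) g depth≤ , max-map≤⁻ (weft c) g below)
  where
    split : ∀ l {big x} → (if l then 1 else 0) + x ≤ weftBound big →
      (l ≡ Bool.false ⊎ big ≡ Bool.true) × x ≤ weftBound (big ∧ not l)
    split Bool.false {Bool.false} p = inj₁ refl , p
    split Bool.false {Bool.true}  p = inj₁ refl , p
    split Bool.true  {Bool.true}  p = inj₂ refl , ≤-pred p

-- Correctness of the recogniser

Truthy : Tree → Set
Truthy nil     = Empty.⊥
Truthy (_ ∙ _) = ⊤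

if-and⁺ : ∀ {c x} → Truthy c → Truthy x → Truthy (ifT c x nil)
if-and⁺ {_ ∙ _} _ p = p

if-and⁻ : ∀ {c x} → Truthy (ifT c x nil) → Truthy c × Truthy x
if-and⁻ {_ ∙ _} p = tt , p

module _ {A : Set} (f : Tree → Tree) (e : A → Tree) where
  all⁺ : ∀ {xs} → All (λ x → Truthy (f (e x))) xs → Truthy (para (λ a _ r → ifT (f a) r nil) (list (map e xs)) (nil ∙ nil))
  all⁺ []       = tt
  all⁺ {x ∷ _} (p ∷ ps) = if-and⁺ {f (e x)} p (all⁺ ps)

  all⁻ : ∀ xs → Truthy (para (λ a _ r → ifT (f a) r nil) (list (map e xs)) (nil ∙ nil)) → All (λ x → Truthy (f (e x))) xs
  all⁻ []       _ = []
  all⁻ (x ∷ xs) p = let q , r = if-and⁻ {f (e x)} p in q ∷ all⁻ xs r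

predecessorsT-spec : ∀ {m} (g : Gate (Fin m)) → predecessorsT (gateTree g) ≡ list (map index (predecessors g))
predecessorsT-spec (neg i)   = refl
predecessorsT-spec (conj is) = refl
predecessorsT-spec (disj is) = refl

ifT-large : ∀ {m} (is : List (Fin m)) x y → ifT (tail (tail (list (map index is)))) x y ≡ (if isLarge is then x else y)
ifT-large []               x y = refl
ifT-large (_ ∷ [])         x y = refl
ifT-large (_ ∷ _ ∷ [])     x y = refl
ifT-large (_ ∷ _ ∷ _ ∷ is) x y = refl

shallowT⁺ : ∀ {n} big d (x : Node n) gs i → NodeAt gs i x → Shallow big d x → Truthy (shallowT big d gs i)
shallowT⁺ big d (input v) gs i (p , _) sh rewrite p = tt
shallowT⁺ Bool.false (suc d) (gate c g) gs i p (inj₁ small , sh)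
  rewrite p | predecessorsT-spec g |
    ifT-large (predecessors g) nil (allShallowT (shallowT Bool.false d) (gatesTree c) (list (map index (predecessors g)))) | small =
  all⁺ (shallowT Bool.false d (gatesTree c)) index (All.map (λ {j} s → shallowT⁺ Bool.false d (node c j) _ _ (node-at c j) s) sh)
shallowT⁺ Bool.true (suc d) (gate c g) gs i p (_ , sh)
  rewrite p | predecessorsT-spec g |
    ifT-large (predecessors g) (allShallowT (shallowT Bool.false d) (gatesTree c) (list (map index (predecessors g))))
      (allShallowT (shallowT Bool.true d) (gatesTree c) (list (map index (predecessors g))))
  with isLarge (predecessors g)
... | Bool.true  =
  all⁺ (shallowT Bool.false d (gatesTree c)) index (All.map (λ {j} s → shallowT⁺ Bool.false d (node c j) _ _ (node-at c j) s) sh)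
... | Bool.false =
  all⁺ (shallowT Bool.true d (gatesTree c)) index (All.map (λ {j} s → shallowT⁺ Bool.true d (node c j) _ _ (node-at c j) s) sh)

shallowT⁻ : ∀ {n} big d (x : Node n) gs i → NodeAt gs i x → Truthy (shallowT big d gs i) → Shallow big d x
shallowT⁻ big d (input v) gs i _ _ = tt
shallowT⁻ big zero (gate c g) gs i p t rewrite p = t
shallowT⁻ Bool.false (suc d) (gate c g) gs i p t
  rewrite p | predecessorsT-spec g |
    ifT-large (predecessors g) nil (allShallowT (shallowT Bool.false d) (gatesTree c) (list (map index (predecessors g))))
  with isLarge (predecessors g)
... | Bool.false = inj₁ refl , All.map (λ {j} → shallowT⁻ Bool.false d (node c j) _ _ (node-at c j))
  (all⁻ (shallowT Bool.false d (gatesTree c)) index (predecessors g) t)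
shallowT⁻ Bool.true (suc d) (gate c g) gs i p t
  rewrite p | predecessorsT-spec g |
    ifT-large (predecessors g) (allShallowT (shallowT Bool.false d) (gatesTree c) (list (map index (predecessors g))))
      (allShallowT (shallowT Bool.true d) (gatesTree c) (list (map index (predecessors g))))
  with isLarge (predecessors g)
... | Bool.true = inj₂ refl , All.map (λ {j} → shallowT⁻ Bool.false d (node c j) _ _ (node-at c j))
  (all⁻ (shallowT Bool.false d (gatesTree c)) index (predecessors g) t)
... | Bool.false = inj₁ refl , All.map (λ {j} → shallowT⁻ Bool.true d (node c j) _ _ (node-at c j))
  (all⁻ (shallowT Bool.true d (gatesTree c)) index (predecessors g) t)

num-tail : ∀ t → num (tail t) ≡ pred (num t)
num-tail nil     = refl
num-tail (_ ∙ _) = refl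

num-drop : ∀ l t → num (drop l t) ≡ num t ∸ num l
num-drop nil     t = refl
num-drop (a ∙ l) t = begin
  num (tail (drop l t)) ≡⟨ num-tail (drop l t) ⟩
  pred (num (drop l t)) ≡⟨ cong pred (num-drop l t) ⟩
  pred (num t ∸ num l)  ≡⟨ pred[m∸n]≡m∸[1+n] (num t) (num l) ⟩
  num t ∸ suc (num l)   ∎
  where open ≡-Reasoning

truthy⇒num : ∀ {t} → Truthy t → 0 < num t
truthy⇒num {_ ∙ _} _ = s≤s z≤n

num⇒truthy : ∀ {t} → 0 < num t → Truthy t
num⇒truthy {_ ∙ _} _ = tt

num-unary : ∀ n → num (unary n) ≡ n
num-unary zero    = refl
num-unary (suc n) = cong suc (num-unary n)

num-append : ∀ l t → num (append l t) ≡ num l + num t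
num-append nil     t = refl
num-append (_ ∙ l) t = cong suc (num-append l t)

len≡unary : ∀ t → len t ≡ unary (num t)
len≡unary nil     = refl
len≡unary (_ ∙ l) = cong (nil ∙_) (len≡unary l)

unaryT⁻ : ∀ t → Truthy (unaryT t) → t ≡ unary (num t)
unaryT⁻ nil         _ = refl
unaryT⁻ (nil ∙ l)   p = cong (nil ∙_) (unaryT⁻ l p)

unaryT⁺ : ∀ n → Truthy (unaryT (unary n))
unaryT⁺ zero    = tt
unaryT⁺ (suc n) = unaryT⁺ n

indexT⁻ : ∀ {t m} → num t ≡ m → ∀ i → Truthy (indexT t i) → Σ[ f ∈ Fin m ] i ≡ index f
indexT⁻ {t} {m} t≡m i p =
  Fin.fromℕ< i<m , trans (unaryT⁻ i (proj₁ both)) (cong unary (sym (toℕ-fromℕ< i<m)))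
  where
    both = if-and⁻ {unaryT i} p
    i<m : num i < m
    i<m = m∸n≢0⇒n<m (λ e → <⇒≢ (truthy⇒num (proj₂ both))
      (sym (trans (num-drop i t) (trans (cong (_∸ num i) t≡m) e))))

indexT⁺ : ∀ {t m} → num t ≡ m → (f : Fin m) → Truthy (indexT t (index f))
indexT⁺ {t} refl f = if-and⁺ {unaryT (index f)} (unaryT⁺ (toℕ f)) (num⇒truthy
  (subst (0 <_) (sym (trans (num-drop (index f) t) (cong (num t ∸_) (num-unary (toℕ f))))) (m<n⇒0<n∸m (toℕ<n f))))

indicesT⁻ : ∀ {t m} → num t ≡ m → ∀ is → Truthy (indicesT t is) → ∃[ fs ] is ≡ list (map (index {m}) fs)
indicesT⁻ t≡m nil      _ = [] , refl
indicesT⁻ {t} t≡m (i ∙ is) p =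
  let q , r    = if-and⁻ {indexT t i} p
      f , i≡   = indexT⁻ t≡m i q
      fs , is≡ = indicesT⁻ t≡m is r
  in f ∷ fs , cong₂ _∙_ i≡ is≡

indicesT⁺ : ∀ {t m} → num t ≡ m → (fs : List (Fin m)) → Truthy (indicesT t (list (map index fs)))
indicesT⁺ {t} t≡m fs = all⁺ (indexT t) index (All.universal (indexT⁺ t≡m) fs)

wellFormedGateT⁻ : ∀ {t m} → num t ≡ m → ∀ g → Truthy (wellFormedGateT t g) → Σ[ h ∈ Gate (Fin m) ] g ≡ gateTree h
wellFormedGateT⁻ t≡m (nil ∙ i) p = let f , i≡ = indexT⁻ t≡m i p in neg f , cong (nil ∙_) i≡
wellFormedGateT⁻ t≡m ((a ∙ b) ∙ is) p with (a ∙ b) == (nil ∙ nil) in conj?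
... | Bool.true = let fs , is≡ = indicesT⁻ t≡m is p in conj fs , cong₂ _∙_ (==-sound (a ∙ b) (nil ∙ nil) conj?) is≡
... | Bool.false with (a ∙ b) == (nil ∙ nil ∙ nil) in disj?
...   | Bool.true = let fs , is≡ = indicesT⁻ t≡m is p in disj fs , cong₂ _∙_ (==-sound (a ∙ b) (nil ∙ nil ∙ nil) disj?) is≡

wellFormedGateT⁺ : ∀ {t m} → num t ≡ m → (h : Gate (Fin m)) → Truthy (wellFormedGateT t (gateTree h))
wellFormedGateT⁺ t≡m (neg f)   = indexT⁺ t≡m f
wellFormedGateT⁺ t≡m (conj fs) = indicesT⁺ t≡m fs
wellFormedGateT⁺ t≡m (disj fs) = indicesT⁺ t≡m fs

-- The circuit is rebuilt from the inputs upwards; the count of its nodes is carried along because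
-- it is the type of the references of the next gate.
wellFormedT⁻ : ∀ t {n} → num t ≡ n → ∀ gs → Truthy (wellFormedT t gs) →
  ∃[ m ] Σ[ c ∈ Circuit n m ] gs ≡ gatesTree c × num gs + n ≡ m
wellFormedT⁻ t {n} t≡n nil _ = n , inputs , refl , refl
wellFormedT⁻ t {n} t≡n (g ∙ gs) p =
  let q , r            = if-and⁻ {wellFormedGateT (append gs t) g} p
      m , c , gs≡ , m≡ = wellFormedT⁻ t t≡n gs r
      h , g≡           = wellFormedGateT⁻ (trans (num-append gs t) (trans (cong (num gs +_) t≡n) m≡)) g q
  in suc m , c ▷ h , cong₂ _∙_ g≡ gs≡ , cong suc m≡

num-gates : ∀ {n m} (c : Circuit n m) → num (gatesTree c) + n ≡ m
num-gates inputs  = refl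
num-gates (c ▷ g) = cong suc (num-gates c)

num-nodes : ∀ {n m} (c : Circuit n m) → num (append (gatesTree c) (unary n)) ≡ m
num-nodes {n} c = trans (num-append (gatesTree c) (unary n)) (trans (cong (num (gatesTree c) +_) (num-unary n)) (num-gates c))

wellFormedT⁺ : ∀ {n m} (c : Circuit n m) → Truthy (wellFormedT (unary n) (gatesTree c))
wellFormedT⁺ inputs = tt
wellFormedT⁺ {n} (c ▷ g) =
  if-and⁺ {wellFormedGateT (append (gatesTree c) (unary n)) (gateTree g)} (wellFormedGateT⁺ (num-nodes c) g) (wellFormedT⁺ c)

parseT⁻ : ∀ x → Truthy (parseT x) → ∃[ n ] ∃[ m ] Σ[ c ∈ Circuit n m ] Σ[ i ∈ Fin m ] x ≡ circuitTree c i
parseT⁻ (t ∙ gs ∙ i) p =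
  let q , r           = if-and⁻ {unaryT t} p
      s , u           = if-and⁻ {wellFormedT t gs} r
      m , c , gs≡ , m≡ = wellFormedT⁻ t refl gs s
      f , i≡          = indexT⁻ (trans (num-append gs t) m≡) i u
  in num t , m , c , f , cong₂ _∙_ (unaryT⁻ t q) (cong₂ _∙_ gs≡ i≡)

parseT⁺ : ∀ {n m} (c : Circuit n m) i → Truthy (parseT (circuitTree c i))
parseT⁺ {n} c i = if-and⁺ {unaryT (unary n)} (unaryT⁺ n)
  (if-and⁺ {wellFormedT (unary n) (gatesTree c)} (wellFormedT⁺ c) (indexT⁺ (num-nodes c) i))

validT⁻ : ∀ d x → Truthy (validT d x) →
  ∃[ n ] ∃[ m ] Σ[ c ∈ Circuit n m ] Σ[ i ∈ Fin m ] x ≡ circuitTree c i × Shallow Bool.true d (node c i)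
validT⁻ d x p with if-and⁻ {parseT x} p
... | q , r with parseT⁻ x q
...   | n , m , c , i , refl = n , m , c , i , refl , shallowT⁻ Bool.true d (node c i) _ _ (node-at c i) r

validT⁺ : ∀ {n m} d (c : Circuit n m) i → Shallow Bool.true d (node c i) → Truthy (validT d (circuitTree c i))
validT⁺ d c i sh = if-and⁺ {parseT (circuitTree c i)} (parseT⁺ c i) (shallowT⁺ Bool.true d (node c i) _ _ (node-at c i) sh)

-- The reduction and the hardness result

parameterT-spec : ∀ d k → parameterT d (unary k) ≡ unary (slots Bool.true d + k)
parameterT-spec d k = append-unary (slots Bool.true d) k

-- The number of possible times is that of all elements: one slot of `m` elements for each unit of
-- the parameter.
instance-spec : ∀ {n m} d k (c : Circuit n m) i → instanceFor d (circuitTree c i) (unary k) ≡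
  snapshotTree ((slots Bool.true d + k) * m) (clauses d m k c i)
instance-spec {n} {m} d k c i = begin
  snapshotT (multiply (parameterT d (unary k)) N) (clausesT d N (unary k) (unary n) (gatesTree c) (index i))
    ≡⟨ cong₂ (λ p N → snapshotT (multiply p N) (clausesT d N (unary k) (unary n) (gatesTree c) (index i)))
         (parameterT-spec d k) (trans (len≡unary (append (gatesTree c) (unary n))) (cong unary (num-nodes c))) ⟩
  snapshotT (multiply (unary (slots Bool.true d + k)) (unary m)) (clausesT d (unary m) (unary k) (unary n) (gatesTree c) (index i))
    ≡⟨ cong₂ snapshotT (multiply-unary (slots Bool.true d + k) m) (clauses-spec d m k c i) ⟩
  snapshotT (unary ((slots Bool.true d + k) * m)) (family (clauses d m k c i))
    ≡⟨ snapshot-spec ((slots Bool.true d + k) * m) (clauses d m k c i) ⟩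
  snapshotTree ((slots Bool.true d + k) * m) (clauses d m k c i) ∎
  where
    open ≡-Reasoning
    N = nodesT (circuitTree c i)

circuit⇔snapshotCut : ∀ {n m} d k (c : Circuit n m) i → Shallow Bool.true d (node c i) →
  WeightedSat k c i ⇔ SnapshotCut (instanceFor d (circuitTree c i) (unary k)) (slots Bool.true d + k)
circuit⇔snapshotCut {n} {m} d k c i sh = subst (λ x → WeightedSat k c i ⇔ SnapshotCut x h) (sym (instance-spec d k c i))
  (⇔-sym (hittingSet⇔sat d k c i sh ⇔-∘ snapshotCut⇔hittingSet _ (clauses d m k c i) h (clauses-bounded d k c i)))
  where h = slots Bool.true d + k

reduct-correct : ∀ d x k → WeightedCircuitSat 1 d x k ⇔ SnapshotCut (reductT d x (unary k)) (slots Bool.true d + k)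
reduct-correct d x k = mk⇔ to from
  where
    h = slots Bool.true d + k
    ifT-truthy : ∀ {c} a b → Truthy c → ifT c a b ≡ a
    ifT-truthy {_ ∙ _} a b _ = refl
    to : WeightedCircuitSat 1 d x k → SnapshotCut (reductT d x (unary k)) h
    to (n , m , c , i , refl , weft≤ , depth≤ , sat) =
      subst (λ y → SnapshotCut y h) (sym (ifT-truthy (instanceFor d x (unary k)) nil (validT⁺ d c i sh)))
        (Equivalence.to (circuit⇔snapshotCut d k c i sh) sat)
      where
        sh = shallow⁺ Bool.true d (node c i)
          (subst (_≤ d) (evaluate-node depthOp (replicate n 0) c i) depth≤)
          (subst (_≤ 1) (evaluate-node weftOp (replicate n 0) c i) weft≤)
    from : SnapshotCut (reductT d x (unary k)) h → WeightedCircuitSat 1 d x k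
    from cut with validT d x in valid
    -- The encoding of an instance is never `nil`.
    from (_ , _ , _ , _ , () , _) | nil
    from cut | _ ∙ _ with validT⁻ d x (subst Truthy (sym valid) tt)
    ... | n , m , c , i , refl , sh =
      let depth≤ , weft≤ = shallow⁻ Bool.true d (node c i) sh in
      n , m , c , i , refl ,
      subst (_≤ 1) (sym (evaluate-node weftOp (replicate n 0) c i)) weft≤ ,
      subst (_≤ d) (sym (evaluate-node depthOp (replicate n 0) c i)) depth≤ ,
      Equivalence.from (circuit⇔snapshotCut d k c i sh) cut

reduction : ∀ d → PolynomialReduction (WeightedCircuitSat 1 d) SnapshotCut
reduction d = record
  { polyTime = reductionᵖ d
  ; reduct   = λ x k → reductT d x (unary k)
  ; increase = slots Bool.true d
  ; computes = λ x k → cong (reductT d x (unary k) ∙_) (parameterT-spec d k)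
  ; correct  = reduct-correct d
  }

-- Membership in `W[ 1 ]` supplies a fixed depth `d`, on which the program of the reduction and the
-- increase of the parameter may depend.
theorem7 : (W[ 1 ] -hard) SnapshotCut
theorem7 A (d , A≤) = ≤fpt-trans A≤ (reduction d)
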